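{- Let $A$ be any non-universal ceer. Then there are infinitely many pairwise $\leq$-incomparable self-full ceers $(E_l)_{l\in\omega}$ such that for every $n\geq 1$ and every $l$, $A\oplus\mathrm{Id}_n\leq E_l$, and for every ceer $X$, if $X<E_l$ then $X\leq A\oplus\mathrm{Id}_k$ for some $k\geq1$. Moreover, for each $l$, any two distinct $E_l$-equivalence classes are computably inseparable, and thus each $E_l$-equivalence class is non-computable.
   Context: A ceer is a computably enumerable equivalence relation on $\omega$. For equivalence relations $E,R$ on $\omega$, $E\leq R$ means there is a computable $f$ with $x\mathrel{E}y\iff f(x)\mathrel{R}f(y)$ for all $x,y$; $X<E$ means $X\leq E$ and $E\not\leq X$. A ceer is universal if every ceer is $\leq$ it. For $n\geq1$, $\mathrm{Id}_n$ is congruence modulo $n$. The uniform join $E\oplus R$ is defined by $2u\mathrel{(E\oplus R)}2v\iff u\mathrel{E}v$, $2u+1\mathrel{(E\oplus R)}2v+1\iff u\mathrel{R}v$, and no even number equivalent to an odd one. A ceer $E$ is self-full if for every computable $g$ that is a reduction of $E$ to $E$ and every $j$ there is $k$ with $g(k)\mathrel{E}j$. Two disjoint sets are computably inseparable if no computable set contains one and is disjoint from the other. -}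

module Defs where

open import Level using (0ℓ)
open import Data.Nat using (ℕ; zero; suc; _+_; _*_; _<_; NonZero)
open import Data.Nat.DivMod using (_%_)
open import Data.Fin using (Fin)
open import Data.Vec using (Vec; []; _∷_; lookup)
open import Data.Product using (Σ; ∃; _×_)
open import Data.Sum using (_⊎_)
open import Relation.Binary.PropositionalEquality using (_≡_)
open import Relation.Binary.Core using (Rel)
open import Relation.Binary.Structures using (IsEquivalence)
open import Relation.Nullary using (¬_)
open import Relation.Unary using (Pred)
open import Function.Bundles using (_⇔_)

data PR : ℕ → Set where
  zer  : ∀ {n} → PR n
  succ : PR 1
  proj : ∀ {n} → Fin n → PR n
  comp : ∀ {m n} → PR m → Vec (PR n) m → PR n
  prec : ∀ {n} → PR n → PR (suc (suc n)) → PR (suc n)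
  mini : ∀ {n} → PR (suc n) → PR n

data _[_]⇓_ : ∀ {n} → PR n → Vec ℕ n → ℕ → Set
data _[_]⇓*_ : ∀ {n m} → Vec (PR n) m → Vec ℕ n → Vec ℕ m → Set

data _[_]⇓_ where
  zer⇓  : ∀ {n} {xs : Vec ℕ n} → zer [ xs ]⇓ 0
  succ⇓ : ∀ {x} → succ [ x ∷ [] ]⇓ suc x
  proj⇓ : ∀ {n} {i : Fin n} {xs} → proj i [ xs ]⇓ lookup xs i
  comp⇓ : ∀ {m n} {f : PR m} {gs : Vec (PR n) m} {xs ys y} →
          gs [ xs ]⇓* ys → f [ ys ]⇓ y → comp f gs [ xs ]⇓ y
  prec0 : ∀ {n} {f : PR n} {g xs y} →
          f [ xs ]⇓ y → prec f g [ 0 ∷ xs ]⇓ y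
  precS : ∀ {n} {f : PR n} {g xs k y z} →
          prec f g [ k ∷ xs ]⇓ y → g [ k ∷ y ∷ xs ]⇓ z →
          prec f g [ suc k ∷ xs ]⇓ z
  mini⇓ : ∀ {n} {f : PR (suc n)} {xs k} →
          f [ k ∷ xs ]⇓ 0 →
          (∀ j → j < k → ∃ λ v → f [ j ∷ xs ]⇓ suc v) →
          mini f [ xs ]⇓ k

data _[_]⇓*_ where
  []⇓  : ∀ {n} {xs : Vec ℕ n} → [] [ xs ]⇓* []
  _∷⇓_ : ∀ {n m} {g : PR n} {gs : Vec (PR n) m} {xs y ys} →
         g [ xs ]⇓ y → gs [ xs ]⇓* ys → (g ∷ gs) [ xs ]⇓* (y ∷ ys)

Computable : (ℕ → ℕ) → Set
Computable f = Σ (PR 1) λ c → ∀ x → c [ x ∷ [] ]⇓ f x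

ComputableSet : Pred ℕ 0ℓ → Set
ComputableSet C = Σ (ℕ → ℕ) λ χ → Computable χ × (∀ x → C x ⇔ χ x ≡ 1)

CE : Rel ℕ 0ℓ → Set
CE R = Σ (PR 2) λ c → ∀ x y → R x y ⇔ (∃ λ v → c [ x ∷ y ∷ [] ]⇓ v)

IsCeer : Rel ℕ 0ℓ → Set
IsCeer R = IsEquivalence R × CE R

infix 4 _≤ᶜ_ _<ᶜ_

_≤ᶜ_ : Rel ℕ 0ℓ → Rel ℕ 0ℓ → Set
E ≤ᶜ R = Σ (ℕ → ℕ) λ f → Computable f × (∀ x y → E x y ⇔ R (f x) (f y))

_<ᶜ_ : Rel ℕ 0ℓ → Rel ℕ 0ℓ → Set
X <ᶜ E = X ≤ᶜ E × ¬ (E ≤ᶜ X)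

Universal : Rel ℕ 0ℓ → Set₁
Universal E = ∀ (X : Rel ℕ 0ℓ) → IsCeer X → X ≤ᶜ E

Id : (n : ℕ) → .{{NonZero n}} → Rel ℕ 0ℓ
Id n x y = x % n ≡ y % n

infixl 6 _⊕_
_⊕_ : Rel ℕ 0ℓ → Rel ℕ 0ℓ → Rel ℕ 0ℓ
(E ⊕ R) x y =
  (∃ λ u → ∃ λ v → x ≡ 2 * u × y ≡ 2 * v × E u v) ⊎
  (∃ λ u → ∃ λ v → x ≡ 2 * u + 1 × y ≡ 2 * v + 1 × R u v)

SelfFull : Rel ℕ 0ℓ → Set
SelfFull E = ∀ (g : ℕ → ℕ) → Computable g →
             (∀ x y → E x y ⇔ E (g x) (g y)) →
             ∀ j → ∃ λ k → E (g k) j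

CompInseparable : Pred ℕ 0ℓ → Pred ℕ 0ℓ → Set₁
CompInseparable P Q =
  ¬ (Σ (Pred ℕ 0ℓ) λ C → ComputableSet C ×
       (∀ x → P x → C x) × (∀ x → C x → ¬ Q x))

{-# OPTIONS --safe #-}
module Submission where

-- E is built in stages s from a map M s sending every element to a representative of its class: even numbers
-- carry A and represent themselves, odd representatives can be collapsed into other classes. A requirement of the
-- first kind, for e and j, collapses an element of the range of φ e into the class of j as soon as one appears
-- above its restraint; so a computable range meets every class or lies in A and finitely many further classes.
-- A requirement of the second kind keeps φ e from reducing E to a given non-universal B by coding into E a ceer D
-- with D ≰ B: whenever φ e behaves like a reduction on one more pair, a new coding location is opened and one more
-- pair of D is coded. Were this to happen infinitely often, then D ≤ E ≤ B. So all injuries are finite.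
--
-- The dichotomy for ranges gives the inseparability of the classes, self-fullness, and the bound on every X < E.
-- By inseparability a reduction of E to a join uses only one side, hence a join of non-universal ceers is not
-- universal and E l can be built over B = A ⊕ E 0 ⊕ … ⊕ E (l - 1). Then E l ≰ E i for i < l, while E i ≤ E l would
-- give E i < E l, hence E i ≤ A ⊕ Id k and E i ≤ A.

open import Defs
open import Level using (0ℓ; Lift; lift; lower) renaming (suc to lsuc)
open import Axiom.ExcludedMiddle using (ExcludedMiddle)
open import Data.Bool using (Bool; true; false; if_then_else_; _∧_; _∨_; not; T)
open import Data.Empty using (⊥; ⊥-elim)
open import Data.Fin using (Fin; zero; suc)
open import Data.List using (List; []; _∷_)
open import Data.Nat
open import Data.Nat.DivMod
open import Data.Nat.Induction using (<-rec)
open import Data.Nat.Properties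
open import Data.Product using (Σ; ∃; _×_; _,_; proj₁; proj₂)
open import Data.Sum using (_⊎_; inj₁; inj₂)
open import Data.Unit using (tt)
open import Data.Vec using (Vec; []; _∷_; lookup; tabulate)
open import Data.Vec.Properties using (tabulate∘lookup)
open import Function using (_∘_; _⇔_; mk⇔; Equivalence)
open import Relation.Binary.Core using (Rel)
open import Relation.Binary.Definitions using (tri<; tri≈; tri>)
open import Relation.Binary.PropositionalEquality
open import Relation.Binary.Structures using (IsEquivalence)
open import Relation.Nullary using (¬_; Dec; yes; no)
open import Relation.Nullary.Decidable using (map′)
open import Relation.Unary using (Pred)
open Equivalence using (to; from)

-- Two demands compete for the odd numbers. Collapsing must be generous, or a computable range could
-- escape it; yet infinitely many odd classes have to stay apart from each other and from A, because
-- every A ⊕ Id n is to embed. Hence the restraint: requirement n may remove only odd numbers of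
-- index above L + n, where L is the first stage after its last injury, and the number exactly at
-- the final bound survives for good, one for each n. Even numbers are never removed, so a range
-- that keeps to A and finitely many further classes is excused from meeting every class; this
-- exception is the source of the bound A ⊕ Id k. Agreement between E and B along φ e refutes
-- nothing by itself. It becomes contradictory only because E is made to absorb D while the
-- agreement lasts. The witness D comes from excluded middle, without uniformity in B. The
-- construction takes it as a parameter and is computable; all other classical decisions concern the
-- finished E. A stage has to run arbitrary programs for a bounded time, whereas `PR` has only a
-- big-step semantics; therefore a universal step machine is built beforehand.

record Comp {n : ℕ} (f : Vec ℕ n → ℕ) : Set where
  constructor mkComp
  field
    code : PR n
    computes : ∀ xs → code [ xs ]⇓ f xs

open Comp

-- Combinators for total computable functions

comp-ext : ∀ {n} {f g : Vec ℕ n → ℕ} → (∀ xs → f xs ≡ g xs) → Comp f → Comp g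
comp-ext f≗g (mkComp c ok) = mkComp c λ xs → subst (c [ xs ]⇓_) (f≗g xs) (ok xs)

var : ∀ {n} (i : Fin n) → Comp (λ xs → lookup xs i)
var i = mkComp (proj i) λ _ → proj⇓

v0 : ∀ {n} → Comp {1 + n} (λ xs → lookup xs zero)
v0 = var zero
v1 : ∀ {n} → Comp {2 + n} (λ xs → lookup xs (suc zero))
v1 = var (suc zero)
v2 : ∀ {n} → Comp {3 + n} (λ xs → lookup xs (suc (suc zero)))
v2 = var (suc (suc zero))
v3 : ∀ {n} → Comp {4 + n} (λ xs → lookup xs (suc (suc (suc zero))))
v3 = var (suc (suc (suc zero)))
v4 : ∀ {n} → Comp {5 + n} (λ xs → lookup xs (suc (suc (suc (suc zero)))))
v4 = var (suc (suc (suc (suc zero))))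
v5 : ∀ {n} → Comp {6 + n} (λ xs → lookup xs (suc (suc (suc (suc (suc zero))))))
v5 = var (suc (suc (suc (suc (suc zero)))))

c-suc : ∀ {n} {f : Vec ℕ n → ℕ} → Comp f → Comp (λ xs → suc (f xs))
c-suc (mkComp c ok) = mkComp (comp succ (c ∷ [])) λ xs → comp⇓ (ok xs ∷⇓ []⇓) succ⇓

c-const : ∀ {n} (k : ℕ) → Comp {n} (λ _ → k)
c-const zero = mkComp zer λ _ → zer⇓
c-const (suc k) = c-suc (c-const k)

nrec : ℕ → (ℕ → ℕ → ℕ) → ℕ → ℕ
nrec z s zero = z
nrec z s (suc k) = s k (nrec z s k)

infix 5 _∷c_
data Comps {n : ℕ} : {m : ℕ} → (Vec ℕ n → Vec ℕ m) → Set where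
  []c : Comps (λ _ → [])
  _∷c_ : ∀ {m} {f : Vec ℕ n → ℕ} {g : Vec ℕ n → Vec ℕ m} →
         Comp f → Comps g → Comps (λ xs → f xs ∷ g xs)

c-sub : ∀ {n m} {f : Vec ℕ m → ℕ} {g : Vec ℕ n → Vec ℕ m} →
        Comp f → Comps g → Comp (λ xs → f (g xs))
c-sub {n} {m} {f} (mkComp c ok) cs = mkComp (comp c (codes cs)) λ xs → comp⇓ (oks cs xs) (ok _)
  where
  codes : ∀ {k} {h : Vec ℕ n → Vec ℕ k} → Comps h → Vec (PR n) k
  codes []c = []
  codes (c ∷c cs) = code c ∷ codes cs
  oks : ∀ {k} {h : Vec ℕ n → Vec ℕ k} (cs : Comps h) xs → codes cs [ xs ]⇓* h xs
  oks []c xs = []⇓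
  oks (c ∷c cs) xs = computes c xs ∷⇓ oks cs xs

vars : ∀ {n} → Comps {n} (λ xs → tabulate (lookup xs))
vars {n} = go (λ i → i)
  where
  go : ∀ {m} (ρ : Fin m → Fin n) → Comps {n} (λ xs → tabulate (λ i → lookup xs (ρ i)))
  go {zero} ρ = []c
  go {suc m} ρ = var (ρ zero) ∷c go (ρ ∘ suc)

-- In the step, variable 0 is the counter, variable 1 the value so far, and the variables of the
-- surrounding context are shifted by two. The code recurses on its first argument with the other
-- arguments fixed, so the length `t` is substituted afterwards.
c-nrec : ∀ {n} {z : Vec ℕ n → ℕ} {s : Vec ℕ (2 + n) → ℕ} {t : Vec ℕ n → ℕ} →
         Comp z → Comp s → Comp t →
         Comp (λ xs → nrec (z xs) (λ k y → s (k ∷ y ∷ xs)) (t xs))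
c-nrec {n} {z} {s} {t} cz cs ct =
  comp-ext (λ xs → cong (λ ys → nrec (z ys) (λ k y → s (k ∷ y ∷ ys)) (t xs)) (tabulate∘lookup xs))
    (c-sub {f = f} base (ct ∷c vars))
  where
  f : Vec ℕ (suc n) → ℕ
  f (k ∷ xs) = nrec (z xs) (λ k y → s (k ∷ y ∷ xs)) k
  run : ∀ k xs → prec (code cz) (code cs) [ k ∷ xs ]⇓ f (k ∷ xs)
  run zero xs = prec0 (computes cz xs)
  run (suc k) xs = precS (run k xs) (computes cs _)
  base : Comp f
  base = mkComp (prec (code cz) (code cs)) λ { (k ∷ xs) → run k xs }

-- Computability is phrased as closure in an arbitrary context, so that a computability proof can
-- copy the shape of the term that it is about.
Op₁ : (ℕ → ℕ) → Set
Op₁ f = ∀ {n} {a : Vec ℕ n → ℕ} → Comp a → Comp (λ xs → f (a xs))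
Op₂ : (ℕ → ℕ → ℕ) → Set
Op₂ f = ∀ {n} {a b : Vec ℕ n → ℕ} → Comp a → Comp b → Comp (λ xs → f (a xs) (b xs))
Op₃ : (ℕ → ℕ → ℕ → ℕ) → Set
Op₃ f = ∀ {n} {a b c : Vec ℕ n → ℕ} → Comp a → Comp b → Comp c →
        Comp (λ xs → f (a xs) (b xs) (c xs))
Op₄ : (ℕ → ℕ → ℕ → ℕ → ℕ) → Set
Op₄ f = ∀ {n} {a b c d : Vec ℕ n → ℕ} → Comp a → Comp b → Comp c → Comp d →
        Comp (λ xs → f (a xs) (b xs) (c xs) (d xs))
Op₅ : (ℕ → ℕ → ℕ → ℕ → ℕ → ℕ) → Set
Op₅ f = ∀ {n} {a b c d e : Vec ℕ n → ℕ} → Comp a → Comp b → Comp c → Comp d → Comp e →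
        Comp (λ xs → f (a xs) (b xs) (c xs) (d xs) (e xs))

x0 : ∀ {n} → Vec ℕ (1 + n) → ℕ
x0 xs = lookup xs zero
x1 : ∀ {n} → Vec ℕ (2 + n) → ℕ
x1 xs = lookup xs (suc zero)
x2 : ∀ {n} → Vec ℕ (3 + n) → ℕ
x2 xs = lookup xs (suc (suc zero))
x3 : ∀ {n} → Vec ℕ (4 + n) → ℕ
x3 xs = lookup xs (suc (suc (suc zero)))
x4 : ∀ {n} → Vec ℕ (5 + n) → ℕ
x4 xs = lookup xs (suc (suc (suc (suc zero))))

op₁ : ∀ f → Comp {1} (λ xs → f (x0 xs)) → Op₁ f
op₁ f c a = c-sub c (a ∷c []c)
op₂ : ∀ f → Comp {2} (λ xs → f (x0 xs) (x1 xs)) → Op₂ f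
op₂ f c a b = c-sub c (a ∷c (b ∷c []c))
op₃ : ∀ f → Comp {3} (λ xs → f (x0 xs) (x1 xs) (x2 xs)) → Op₃ f
op₃ f c a b d = c-sub c (a ∷c (b ∷c (d ∷c []c)))
op₄ : ∀ f → Comp {4} (λ xs → f (x0 xs) (x1 xs) (x2 xs) (x3 xs)) → Op₄ f
op₄ f c a b d e = c-sub c (a ∷c (b ∷c (d ∷c (e ∷c []c))))
op₅ : ∀ f → Comp {5} (λ xs → f (x0 xs) (x1 xs) (x2 xs) (x3 xs) (x4 xs)) → Op₅ f
op₅ f c a b d e g = c-sub c (a ∷c (b ∷c (d ∷c (e ∷c (g ∷c []c)))))

toComputable : ∀ {f} → Op₁ f → Computable f
toComputable {f} c = code c′ , λ x → computes c′ (x ∷ [])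
  where
  c′ : Comp {1} (λ xs → f (x0 xs))
  c′ = c v0

fromComputable : ∀ {f} → Computable f → Op₁ f
fromComputable {f} (c , ok) = op₁ f (mkComp c λ { (x ∷ []) → ok x })

c-pred : Op₁ pred
c-pred = op₁ pred (comp-ext (λ { (zero ∷ []) → refl ; (suc x ∷ []) → refl })
                            (c-nrec (c-const 0) v0 v0))

c-+ : Op₂ _+_
c-+ = op₂ _+_ (comp-ext (λ { (x ∷ y ∷ []) → eq x y }) (c-nrec v1 (c-suc v1) v0))
  where
  eq : ∀ x y → nrec y (λ _ r → suc r) x ≡ x + y
  eq zero y = refl
  eq (suc x) y = cong suc (eq x y)

c-∸ : Op₂ _∸_
c-∸ = op₂ _∸_ (comp-ext (λ { (x ∷ y ∷ []) → eq x y }) (c-nrec v0 (c-pred v1) v1))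
  where
  eq : ∀ x y → nrec x (λ _ r → pred r) y ≡ x ∸ y
  eq x zero = refl
  eq x (suc y) = trans (cong pred (eq x y)) (pred[m∸n]≡m∸[1+n] x y)

b2n : Bool → ℕ
b2n true = 1
b2n false = 0

record CompB {n : ℕ} (b : Vec ℕ n → Bool) : Set where
  constructor mkCompB
  field numeric : Comp (λ xs → b2n (b xs))
open CompB

OpB₂ : (ℕ → ℕ → Bool) → Set
OpB₂ f = ∀ {n} {a b : Vec ℕ n → ℕ} → Comp a → Comp b → CompB (λ xs → f (a xs) (b xs))
OpB₃ : (ℕ → ℕ → ℕ → Bool) → Set
OpB₃ f = ∀ {n} {a b c : Vec ℕ n → ℕ} → Comp a → Comp b → Comp c →
         CompB (λ xs → f (a xs) (b xs) (c xs))

c-if : ∀ {n} {b : Vec ℕ n → Bool} {f g : Vec ℕ n → ℕ} →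
       CompB b → Comp f → Comp g → Comp (λ xs → if b xs then f xs else g xs)
c-if {b = b} {f} {g} (mkCompB cb) cf cg =
  comp-ext (λ xs → eq (b xs) (f xs) (g xs))
    -- A recursion of length 0 or 1: `v2` is the third argument `g`, and the shift by two turns the
    -- second argument `f` into `v3` inside the step.
    (c-sub (c-nrec v2 v3 v0) (cb ∷c (cf ∷c (cg ∷c []c))))
  where
  eq : ∀ c x y → nrec y (λ _ _ → x) (b2n c) ≡ (if c then x else y)
  eq true x y = refl
  eq false x y = refl

c-∧ : ∀ {n} {a b : Vec ℕ n → Bool} → CompB a → CompB b → CompB (λ xs → a xs ∧ b xs)
c-∧ {a = a} {b} ca cb =
  mkCompB (comp-ext (λ xs → eq (a xs) (b xs)) (c-if ca (numeric cb) (c-const 0)))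
  where
  eq : ∀ x y → (if x then b2n y else 0) ≡ b2n (x ∧ y)
  eq true y = refl
  eq false y = refl

c-not : ∀ {n} {a : Vec ℕ n → Bool} → CompB a → CompB (λ xs → not (a xs))
c-not {a = a} ca = mkCompB (comp-ext (λ xs → eq (a xs)) (c-if ca (c-const 0) (c-const 1)))
  where
  eq : ∀ x → (if x then 0 else 1) ≡ b2n (not x)
  eq true = refl
  eq false = refl

c-∨ : ∀ {n} {a b : Vec ℕ n → Bool} → CompB a → CompB b → CompB (λ xs → a xs ∨ b xs)
c-∨ {a = a} {b} ca cb =
  mkCompB (comp-ext (λ xs → eq (a xs) (b xs)) (c-if ca (c-const 1) (numeric cb)))
  where
  eq : ∀ x y → (if x then 1 else b2n y) ≡ b2n (x ∨ y)
  eq true y = refl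
  eq false y = refl

c-<ᵇ : OpB₂ _<ᵇ_
c-<ᵇ {a = a} {b} ca cb = mkCompB (comp-ext (λ xs → eq (a xs) (b xs))
                          (c-∸ (c-const 1) (c-∸ (c-const 1) (c-∸ cb ca))))
  where
  eq : ∀ x y → 1 ∸ (1 ∸ (y ∸ x)) ≡ b2n (x <ᵇ y)
  eq zero zero = refl
  eq zero (suc y) = cong (1 ∸_) (0∸n≡0 y)
  eq (suc x) zero = refl
  eq (suc x) (suc y) = eq x y

c-≡ᵇ : OpB₂ _≡ᵇ_
c-≡ᵇ {a = a} {b} ca cb = mkCompB (comp-ext (λ xs → eq (a xs) (b xs))
                          (c-∸ (c-const 1) (c-+ (c-∸ ca cb) (c-∸ cb ca))))
  where
  eq : ∀ x y → 1 ∸ ((x ∸ y) + (y ∸ x)) ≡ b2n (x ≡ᵇ y)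
  eq zero zero = refl
  eq zero (suc y) = 0∸n≡0 y
  eq (suc x) zero = 0∸n≡0 (x + 0)
  eq (suc x) (suc y) = eq x y

_≡b_ : Bool → Bool → Bool
x ≡b y = if x then y else not y

c-≡b : ∀ {n} {a b : Vec ℕ n → Bool} → CompB a → CompB b → CompB (λ xs → a xs ≡b b xs)
c-≡b {a = a} {b} ca cb =
  mkCompB (comp-ext (λ xs → eq (a xs) (b xs)) (c-if ca (numeric cb) (numeric (c-not cb))))
  where
  eq : ∀ x y → (if x then b2n y else b2n (not y)) ≡ b2n (x ≡b y)
  eq true y = refl
  eq false y = refl

c-ifB : ∀ {n} {b f g : Vec ℕ n → Bool} →
        CompB b → CompB f → CompB g → CompB (λ xs → if b xs then f xs else g xs)
c-ifB {b = b} {f} {g} cb cf cg =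
  mkCompB (comp-ext (λ xs → eq (b xs) (f xs) (g xs)) (c-if cb (numeric cf) (numeric cg)))
  where
  eq : ∀ c x y → (if c then b2n x else b2n y) ≡ b2n (if c then x else y)
  eq true x y = refl
  eq false x y = refl

≡ᵇ-yes : ∀ {x y} → x ≡ y → (x ≡ᵇ y) ≡ true
≡ᵇ-yes {zero} refl = refl
≡ᵇ-yes {suc x} refl = ≡ᵇ-yes {x} refl

≡ᵇ-no : ∀ {x y} → x ≢ y → (x ≡ᵇ y) ≡ false
≡ᵇ-no {zero} {zero} x≢y = ⊥-elim (x≢y refl)
≡ᵇ-no {zero} {suc y} x≢y = refl
≡ᵇ-no {suc x} {zero} x≢y = refl
≡ᵇ-no {suc x} {suc y} x≢y = ≡ᵇ-no {x} {y} (x≢y ∘ cong suc)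

≡ᵇ-true : ∀ x y → (x ≡ᵇ y) ≡ true → x ≡ y
≡ᵇ-true x y eq = ≡ᵇ⇒≡ x y (subst T (sym eq) tt)

<ᵇ-yes : ∀ {x y} → x < y → (x <ᵇ y) ≡ true
<ᵇ-yes {zero} (s≤s _) = refl
<ᵇ-yes {suc x} (s≤s x<y) = <ᵇ-yes x<y

<ᵇ-true : ∀ x y → (x <ᵇ y) ≡ true → x < y
<ᵇ-true x y eq = <ᵇ⇒< x y (subst T (sym eq) tt)

∧-true : ∀ {a b} → (a ∧ b) ≡ true → a ≡ true × b ≡ true
∧-true {true} {true} _ = refl , refl

∧-yes : ∀ {a b} → a ≡ true → b ≡ true → (a ∧ b) ≡ true
∧-yes refl refl = refl

≡b-true : ∀ {a b} → (a ≡b b) ≡ true → a ≡ b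
≡b-true {true} {true} _ = refl
≡b-true {false} {false} _ = refl

≡b-yes : ∀ {a b} → a ≡ b → (a ≡b b) ≡ true
≡b-yes {true} refl = refl
≡b-yes {false} refl = refl

-- Cantor pairing

tri : ℕ → ℕ
tri n = nrec 0 (λ k y → y + suc k) n

c-tri : Op₁ tri
c-tri = op₁ tri (c-nrec (c-const 0) (c-+ v1 (c-suc v0)) v0)

-- The largest r with `tri r` at most z, found by counting up to z: r grows exactly when the counter
-- reaches the next triangular number.
troot : ℕ → ℕ
troot z = nrec 0 (λ k r → if suc k ≡ᵇ tri (suc r) then suc r else r) z

c-troot : Op₁ troot
c-troot = op₁ troot (c-nrec (c-const 0)
  (c-if (c-≡ᵇ (c-suc v0) (c-tri (c-suc v1))) (c-suc v1) v1) v0)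

-- Induction along the enumeration of pairs: the end of diagonal n precedes the start of diagonal n
-- + 1, and within a diagonal no triangular number is met.
troot-tri : ∀ n k → k ≤ n → troot (tri n + k) ≡ n
troot-tri zero zero _ = refl
troot-tri (suc n) zero _ = trans (cong troot eq) (trans (cong g (troot-tri n n ≤-refl)) step)
  where
  eq : tri (suc n) + 0 ≡ suc (tri n + n)
  eq = trans (+-identityʳ _) (+-suc (tri n) n)
  g : ℕ → ℕ
  g r = if suc (tri n + n) ≡ᵇ tri (suc r) then suc r else r
  step : g n ≡ suc n
  step rewrite ≡ᵇ-yes {suc (tri n + n)} {tri (suc n)} (sym (+-suc (tri n) n)) = refl
troot-tri n (suc k) k<n = trans (cong troot (+-suc (tri n) k))
                            (trans (cong g (troot-tri n k (<⇒≤ k<n))) step)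
  where
  g : ℕ → ℕ
  g r = if suc (tri n + k) ≡ᵇ tri (suc r) then suc r else r
  step : g n ≡ n
  step rewrite ≡ᵇ-no {suc (tri n + k)} {tri (suc n)}
                 (λ eq → <-irrefl (+-cancelˡ-≡ (tri n) (suc k) (suc n)
                           (trans (+-suc (tri n) k) eq)) (s≤s k<n)) = refl

opaque
  pair : ℕ → ℕ → ℕ
  pair x y = tri (x + y) + y

  snd : ℕ → ℕ
  snd z = z ∸ tri (troot z)

  fst : ℕ → ℕ
  fst z = troot z ∸ snd z

  c-pair : Op₂ pair
  c-pair = op₂ pair (c-+ (c-tri (c-+ v0 v1)) v1)

  c-snd : Op₁ snd
  c-snd = op₁ snd (c-∸ v0 (c-tri (c-troot v0)))

  c-fst : Op₁ fst
  c-fst = op₁ fst (c-∸ (c-troot v0) (c-snd v0))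

  snd-pair : ∀ x y → snd (pair x y) ≡ y
  snd-pair x y = trans (cong (λ r → pair x y ∸ tri r) (troot-tri (x + y) y (m≤n+m y x)))
                       (m+n∸m≡n (tri (x + y)) y)

  fst-pair : ∀ x y → fst (pair x y) ≡ x
  fst-pair x y = trans (cong₂ _∸_ (troot-tri (x + y) y (m≤n+m y x)) (snd-pair x y)) (m+n∸n≡m x y)

  -- The empty stack of the machine below is coded by 0, so popping it is harmless.
  pair-0-0 : pair 0 0 ≡ 0
  pair-0-0 = refl

  pair-≥₂ : ∀ x y → y ≤ pair x y
  pair-≥₂ x y = m≤n+m y _

-- Parity and halving

par : ℕ → ℕ
par x = nrec 0 (λ _ y → 1 ∸ y) x

half : ℕ → ℕ
half x = nrec 0 (λ k y → y + par k) x

c-par : Op₁ par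
c-par = op₁ par (c-nrec (c-const 0) (c-∸ (c-const 1) v1) v0)

c-half : Op₁ half
c-half = op₁ half (c-nrec (c-const 0) (c-+ v1 (c-par v0)) v0)

c-2* : Op₁ (2 *_)
c-2* = op₁ (2 *_) (c-+ v0 (c-+ v0 (c-const 0)))

2*suc : ∀ i → 2 * suc i ≡ suc (suc (2 * i))
2*suc i = *-suc 2 i

par-even : ∀ i → par (2 * i) ≡ 0
par-even zero = refl
par-even (suc i) = trans (cong par (2*suc i)) (cong (λ p → 1 ∸ (1 ∸ p)) (par-even i))

par-odd : ∀ i → par (2 * i + 1) ≡ 1
par-odd i = trans (cong par (+-comm (2 * i) 1)) (cong (1 ∸_) (par-even i))

half-even : ∀ i → half (2 * i) ≡ i
half-even zero = refl
half-even (suc i) = trans (cong half (2*suc i))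
  (trans (cong₂ (λ h p → h + p + (1 ∸ p)) (half-even i) (par-even i))
         (trans (cong (_+ 1) (+-identityʳ i)) (+-comm i 1)))

half-odd : ∀ i → half (2 * i + 1) ≡ i
half-odd i = trans (cong half (+-comm (2 * i) 1))
  (trans (cong₂ _+_ (half-even i) (par-even i)) (+-identityʳ i))

evenOrOdd : ∀ x → (∃ λ i → x ≡ 2 * i) ⊎ (∃ λ i → x ≡ 2 * i + 1)
evenOrOdd zero = inj₁ (0 , refl)
evenOrOdd (suc x) with evenOrOdd x
... | inj₁ (i , refl) = inj₂ (i , +-comm 1 (2 * i))
... | inj₂ (i , refl) = inj₁ (suc i , trans (cong suc (+-comm (2 * i) 1)) (sym (2*suc i)))

2*-inj : ∀ {i j} → 2 * i ≡ 2 * j → i ≡ j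
2*-inj {i} {j} eq = trans (sym (half-even i)) (trans (cong half eq) (half-even j))

odd-inj : ∀ {i j} → 2 * i + 1 ≡ 2 * j + 1 → i ≡ j
odd-inj {i} {j} eq = trans (sym (half-odd i)) (trans (cong half eq) (half-odd j))

2i≢2j+1 : ∀ {i j} → 2 * i ≢ 2 * j + 1
2i≢2j+1 {i} {j} eq with () ← trans (sym (par-even i)) (trans (cong par eq) (par-odd j))

par0-even : ∀ x → par x ≡ 0 → x ≡ 2 * half x
par0-even x p with evenOrOdd x
... | inj₁ (i , refl) = cong (2 *_) (sym (half-even i))
... | inj₂ (i , refl) with () ← trans (sym p) (par-odd i)

par1-odd : ∀ x → par x ≡ 1 → x ≡ 2 * half x + 1
par1-odd x p with evenOrOdd x
... | inj₁ (i , refl) with () ← trans (sym p) (par-even i)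
par1-odd x p | inj₂ (i , refl) = cong (λ h → 2 * h + 1) (sym (half-odd i))

half≤ : ∀ x → half x ≤ x
half≤ x with evenOrOdd x
... | inj₁ (i , refl) = subst (_≤ 2 * i) (sym (half-even i)) (m≤m+n i _)
... | inj₂ (i , refl) = subst (_≤ 2 * i + 1) (sym (half-odd i)) (≤-trans (m≤m+n i _) (m≤m+n _ 1))

-- A universal machine

data Instr : Set where
  iZ iS iF iR iPush iSwap iCons : Instr
  iSeq : Instr → Instr → Instr
  iLoop : Instr → Instr

record Config : Set where
  constructor cfg
  field
    ctrl : List Instr
    cur : ℕ
    stk : List ℕ
open Config

top : List ℕ → ℕ
top [] = 0
top (x ∷ S) = x

pop : List ℕ → List ℕ
pop [] = []
pop (x ∷ S) = S

-- The body receives the decremented counter together with the state and may return any counter. The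
-- same instruction therefore serves bounded recursion and unbounded search.
loopStep : ℕ → Instr → List Instr → ℕ → List ℕ → Config
loopStep zero a K y S = cfg K y S
loopStep (suc r) a K y S = cfg (a ∷ iLoop a ∷ K) (pair r y) S

step : Config → Config
step (cfg [] x S) = cfg [] x S
step (cfg (iZ ∷ K) x S) = cfg K 0 S
step (cfg (iS ∷ K) x S) = cfg K (suc x) S
step (cfg (iF ∷ K) x S) = cfg K (fst x) S
step (cfg (iR ∷ K) x S) = cfg K (snd x) S
step (cfg (iPush ∷ K) x S) = cfg K x (x ∷ S)
step (cfg (iSwap ∷ K) x S) = cfg K (top S) (x ∷ pop S)
step (cfg (iCons ∷ K) x S) = cfg K (pair (top S) x) (pop S)
step (cfg (iSeq a b ∷ K) x S) = cfg (a ∷ b ∷ K) x S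
step (cfg (iLoop a ∷ K) x S) = loopStep (fst x) a K (snd x) S

run : ℕ → Config → Config
run zero c = c
run (suc s) c = run s (step c)

encI : Instr → ℕ
encI iZ = pair 0 0
encI iS = pair 1 0
encI iF = pair 2 0
encI iR = pair 3 0
encI iPush = pair 4 0
encI iSwap = pair 5 0
encI iCons = pair 6 0
encI (iSeq a b) = pair 7 (pair (encI a) (encI b))
encI (iLoop a) = pair 8 (encI a)

-- Unlike the stack, the control needs a code of the empty list that no other list shares, since the
-- empty control is how halting is recognised.
encK : List Instr → ℕ
encK [] = 0
encK (i ∷ K) = suc (pair (encI i) (encK K))

encS : List ℕ → ℕ
encS [] = 0
encS (x ∷ S) = pair x (encS S)

fst-0 : fst 0 ≡ 0
fst-0 = trans (cong fst (sym pair-0-0)) (fst-pair 0 0)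

snd-0 : snd 0 ≡ 0
snd-0 = trans (cong snd (sym pair-0-0)) (snd-pair 0 0)

encS-top : ∀ S → fst (encS S) ≡ top S
encS-top [] = fst-0
encS-top (x ∷ S) = fst-pair x (encS S)

encS-pop : ∀ S → snd (encS S) ≡ encS (pop S)
encS-pop [] = snd-0
encS-pop (x ∷ S) = snd-pair x (encS S)

cfgℕ : ℕ → ℕ → ℕ → ℕ
cfgℕ K x S = pair K (pair x S)

encC : Config → ℕ
encC (cfg K x S) = cfgℕ (encK K) x (encS S)

pushK : ℕ → ℕ → ℕ
pushK i K = suc (pair i K)

exec : ℕ → ℕ → ℕ → ℕ → ℕ → ℕ
exec t g K x S =
  if t ≡ᵇ 0 then cfgℕ K 0 S else
  if t ≡ᵇ 1 then cfgℕ K (suc x) S else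
  if t ≡ᵇ 2 then cfgℕ K (fst x) S else
  if t ≡ᵇ 3 then cfgℕ K (snd x) S else
  if t ≡ᵇ 4 then cfgℕ K x (pair x S) else
  if t ≡ᵇ 5 then cfgℕ K (fst S) (pair x (snd S)) else
  if t ≡ᵇ 6 then cfgℕ K (pair (fst S) x) (snd S) else
  if t ≡ᵇ 7 then cfgℕ (pushK (fst g) (pushK (snd g) K)) x S else
  if fst x ≡ᵇ 0 then cfgℕ K (snd x) S else
  cfgℕ (pushK g (pushK (pair 8 g) K)) (pair (pred (fst x)) (snd x)) S

stepℕ : ℕ → ℕ
stepℕ c =
  if fst c ≡ᵇ 0 then c else
  exec (fst (fst (pred (fst c)))) (snd (fst (pred (fst c)))) (snd (pred (fst c)))
       (fst (snd c)) (snd (snd c))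

stepℕ-done : ∀ x S → stepℕ (cfgℕ 0 x S) ≡ cfgℕ 0 x S
stepℕ-done x S rewrite fst-pair 0 (pair x S) = refl

stepℕ-instr : ∀ t g K x S → stepℕ (cfgℕ (pushK (pair t g) K) x S) ≡ exec t g K x S
stepℕ-instr t g K x S
  rewrite fst-pair (pushK (pair t g) K) (pair x S) | snd-pair (pushK (pair t g) K) (pair x S)
        | fst-pair (pair t g) K | snd-pair (pair t g) K | fst-pair t g | snd-pair t g
        | fst-pair x S | snd-pair x S = refl

step-enc : ∀ c → stepℕ (encC c) ≡ encC (step c)
step-enc (cfg [] x S) = stepℕ-done x (encS S)
step-enc (cfg (iZ ∷ K) x S) = stepℕ-instr 0 0 (encK K) x (encS S)
step-enc (cfg (iS ∷ K) x S) = stepℕ-instr 1 0 (encK K) x (encS S)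
step-enc (cfg (iF ∷ K) x S) = stepℕ-instr 2 0 (encK K) x (encS S)
step-enc (cfg (iR ∷ K) x S) = stepℕ-instr 3 0 (encK K) x (encS S)
step-enc (cfg (iPush ∷ K) x S) = stepℕ-instr 4 0 (encK K) x (encS S)
step-enc (cfg (iSwap ∷ K) x S) = trans (stepℕ-instr 5 0 (encK K) x (encS S))
  (cong₂ (λ u v → cfgℕ (encK K) u (pair x v)) (encS-top S) (encS-pop S))
step-enc (cfg (iCons ∷ K) x S) = trans (stepℕ-instr 6 0 (encK K) x (encS S))
  (cong₂ (λ u v → cfgℕ (encK K) (pair u x) v) (encS-top S) (encS-pop S))
step-enc (cfg (iSeq a b ∷ K) x S) =
  trans (stepℕ-instr 7 (pair (encI a) (encI b)) (encK K) x (encS S))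
        (cong₂ (λ u v → cfgℕ (pushK u (pushK v (encK K))) x (encS S))
               (fst-pair (encI a) (encI b)) (snd-pair (encI a) (encI b)))
step-enc (cfg (iLoop a ∷ K) x S) = trans (stepℕ-instr 8 (encI a) (encK K) x (encS S)) (go (fst x) refl)
  where
  go : ∀ r → fst x ≡ r → exec 8 (encI a) (encK K) x (encS S) ≡ encC (loopStep r a K (snd x) S)
  go zero eq rewrite eq = refl
  go (suc r) eq rewrite eq = refl

runℕ : ℕ → ℕ → ℕ
runℕ c s = nrec c (λ _ d → stepℕ d) s

run-step : ∀ s c → run s (step c) ≡ step (run s c)
run-step zero c = refl
run-step (suc s) c = run-step s (step c)

run-enc : ∀ s c → runℕ (encC c) s ≡ encC (run s c)
run-enc zero c = refl
run-enc (suc s) c = trans (cong stepℕ (run-enc s c))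
                   (trans (step-enc (run s c)) (cong encC (sym (run-step s c))))

c-exec : Op₅ exec
c-exec = op₅ exec
  (c-if (is 0) (c-cfg v2 (c-const 0) v4)
  (c-if (is 1) (c-cfg v2 (c-suc v3) v4)
  (c-if (is 2) (c-cfg v2 (c-fst v3) v4)
  (c-if (is 3) (c-cfg v2 (c-snd v3) v4)
  (c-if (is 4) (c-cfg v2 v3 (c-pair v3 v4))
  (c-if (is 5) (c-cfg v2 (c-fst v4) (c-pair v3 (c-snd v4)))
  (c-if (is 6) (c-cfg v2 (c-pair (c-fst v4) v3) (c-snd v4))
  (c-if (is 7) (c-cfg (c-push (c-fst v1) (c-push (c-snd v1) v2)) v3 v4)
  (c-if (c-≡ᵇ (c-fst v3) (c-const 0)) (c-cfg v2 (c-snd v3) v4)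
  (c-cfg (c-push v1 (c-push (c-pair (c-const 8) v1) v2))
         (c-pair (c-pred (c-fst v3)) (c-snd v3)) v4))))))))))
  where
  is : ∀ t → CompB {5} (λ xs → x0 xs ≡ᵇ t)
  is t = c-≡ᵇ v0 (c-const t)
  c-cfg : Op₃ cfgℕ
  c-cfg a b c = c-pair a (c-pair b c)
  c-push : Op₂ pushK
  c-push a b = c-suc (c-pair a b)

c-stepℕ : Op₁ stepℕ
c-stepℕ = op₁ stepℕ (c-if (c-≡ᵇ (c-fst v0) (c-const 0)) v0
  (c-exec (c-fst (c-fst (c-pred (c-fst v0)))) (c-snd (c-fst (c-pred (c-fst v0))))
          (c-snd (c-pred (c-fst v0))) (c-fst (c-snd v0)) (c-snd (c-snd v0))))

output : ℕ → ℕ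
output c = if fst c ≡ᵇ 0 then suc (fst (snd c)) else 0

init : ℕ → ℕ → ℕ
init e x = cfgℕ (pushK e 0) x 0

-- U e x s is 1 + the value computed by the program e on x if it halts within s steps, and 0 otherwise.
opaque
  U : ℕ → ℕ → ℕ → ℕ
  U e x s = output (runℕ (init e x) s)

  c-U : Op₃ U
  c-U = op₃ U (c-output (c-nrec (c-pair (c-suc (c-pair v0 (c-const 0))) (c-pair v1 (c-const 0)))
                                (c-stepℕ v1) v2))
    where
    c-output : Op₁ output
    c-output = op₁ output (c-if (c-≡ᵇ (c-fst v0) (c-const 0)) (c-suc (c-fst (c-snd v0))) (c-const 0))

  U-mono : ∀ {e x s s′ v} → s ≤ s′ → U e x s ≡ suc v → U e x s′ ≡ suc v
  U-mono {e} {x} {s} {s′} {v} s≤s′ h = subst (λ r → U e x r ≡ suc v) (m∸n+n≡m s≤s′) (go (s′ ∸ s))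
    where
    -- A positive output means an empty control, and a configuration with empty control no longer
    -- changes.
    stable : ∀ c → output c ≡ suc v → stepℕ c ≡ c
    stable c h with fst c ≡ᵇ 0
    ... | true = refl
    go : ∀ k → U e x (k + s) ≡ suc v
    go zero = h
    go (suc k) = trans (cong output (stable _ (go k))) (go k)

  U-run : ∀ i x s → U (encI i) x s ≡ output (encC (run s (cfg (i ∷ []) x [])))
  U-run i x s = cong output (run-enc s (cfg (i ∷ []) x []))

-- Compilation of codes and completeness of the machine

record _⟶_ (c d : Config) : Set where
  constructor steps
  field
    count : ℕ
    reaches : run count c ≡ d

run-+ : ∀ m n c → run (m + n) c ≡ run n (run m c)
run-+ zero n c = refl
run-+ (suc m) n c = run-+ m n (step c)

infixr 4 _▹_
_▹_ : ∀ {c d e} → c ⟶ d → d ⟶ e → c ⟶ e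
steps m refl ▹ steps n refl = steps (m + n) (run-+ m n _)

one : ∀ {c} → c ⟶ step c
one = steps 1 refl

-- There is no empty instruction; the value is paired with itself and projected back.
iId : Instr
iId = iSeq iPush (iSeq iCons iF)

iPair : Instr → Instr → Instr
iPair a b = iSeq iPush (iSeq a (iSeq iSwap (iSeq b iCons)))

compile : ∀ {n} → PR n → Instr
compiles : ∀ {n m} → Vec (PR n) m → Instr
compileProj : ∀ {n} → Fin n → Instr

-- The state consists of the rounds left, the index, the value so far and the parameters. All but
-- the first form precisely the encoded argument of `g`.
loopBody : Instr → Instr
loopBody g = iPair iF (iSeq iR (iPair (iSeq iF iS) (iPair g (iSeq iR iR))))

-- The loop counter is the value of `f` at the current candidate, so the loop stops at the first
-- zero. The decremented counter is discarded and the value at the next candidate put in its place.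
searchBody : Instr → Instr
searchBody f = iSeq iR (iSeq (iPair (iSeq iF iS) iR) (iPair f iId))

compile zer = iZ
compile succ = iSeq iF iS
compile (proj i) = compileProj i
compile (comp f gs) = iSeq (compiles gs) (compile f)
compile (prec f g) =
  iSeq (iPair iF (iPair iZ (iPair (iSeq iR (compile f)) iR)))
       (iSeq (iLoop (loopBody (compile g))) (iSeq iR iF))
compile (mini f) =
  iSeq (iPair iZ iId)
       (iSeq (iPair (compile f) iId) (iSeq (iLoop (searchBody (compile f))) iF))

compiles [] = iZ
compiles (g ∷ gs) = iPair (compile g) (compiles gs)

compileProj zero = iF
compileProj (suc i) = iSeq iR (compileProj i)

encV : ∀ {n} → Vec ℕ n → ℕ
encV [] = 0
encV (x ∷ xs) = pair x (encV xs)

-- Quantifying over control and stack says that the instruction leaves its surroundings intact,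
-- which is what makes runs composable.
Runs : Instr → ℕ → ℕ → Set
Runs a x y = ∀ K S → cfg (a ∷ K) x S ⟶ cfg K y S

runs-seq : ∀ {a b x y z} → Runs a x y → Runs b y z → Runs (iSeq a b) x z
runs-seq p q K S = one ▹ p _ S ▹ q K S

runs-pair : ∀ {a b x y z} → Runs a x y → Runs b x z → Runs (iPair a b) x (pair y z)
runs-pair p q K S = one ▹ one ▹ one ▹ p _ _ ▹ one ▹ one ▹ one ▹ q _ _ ▹ one

runs-Z : ∀ {x} → Runs iZ x 0
runs-Z K S = one

runs-S : ∀ {x} → Runs iS x (suc x)
runs-S K S = one

runs-fst : ∀ {x y} → Runs iF (pair x y) x
runs-fst {x} {y} K S = subst (λ w → cfg (iF ∷ K) (pair x y) S ⟶ cfg K w S) (fst-pair x y) one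

runs-snd : ∀ {x y} → Runs iR (pair x y) y
runs-snd {x} {y} K S = subst (λ w → cfg (iR ∷ K) (pair x y) S ⟶ cfg K w S) (snd-pair x y) one

runs-id : ∀ {x} → Runs iId x x
runs-id {x} K S = one ▹ one ▹ one ▹ one ▹ runs-fst K S

step-loop : ∀ r a K y S → step (cfg (iLoop a ∷ K) (pair r y) S) ≡ loopStep r a K y S
step-loop r a K y S = cong₂ (λ r′ y′ → loopStep r′ a K y′ S) (fst-pair r y) (snd-pair r y)

runs-loop-0 : ∀ {a y} → Runs (iLoop a) (pair 0 y) y
runs-loop-0 {a} {y} K S = steps 1 (step-loop 0 a K y S)

runs-loop-suc : ∀ {a r x y z} → Runs a (pair r x) y → Runs (iLoop a) y z →
                Runs (iLoop a) (pair (suc r) x) z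
runs-loop-suc {a} {r} {x} p q K S = steps 1 (step-loop (suc r) a K x S) ▹ p _ S ▹ q K S

runs-loopBody : ∀ {g r i y x z} → Runs g (pair i (pair y x)) z →
                Runs (loopBody g) (pair r (pair i (pair y x))) (pair r (pair (suc i) (pair z x)))
runs-loopBody p = runs-pair runs-fst (runs-seq runs-snd
  (runs-pair (runs-seq runs-fst runs-S) (runs-pair p (runs-seq runs-snd runs-snd))))

runs-searchBody : ∀ {f r i x v} → Runs f (pair (suc i) x) v →
                  Runs (searchBody f) (pair r (pair i x)) (pair v (pair (suc i) x))
runs-searchBody p = runs-seq runs-snd
  (runs-seq (runs-pair (runs-seq runs-fst runs-S) runs-snd) (runs-pair p runs-id))

runs-search : ∀ {f x k} → Runs f (pair k x) 0 → (∀ j → j < k → ∃ λ v → Runs f (pair j x) (suc v)) →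
              ∀ d i → d + i ≡ k → ∃ λ t → Runs f (pair i x) t ×
                Runs (iLoop (searchBody f)) (pair t (pair i x)) (pair k x)
runs-search p below zero i refl = 0 , p , runs-loop-0
runs-search p below (suc d) i eq
  with below i (subst (i <_) eq (s≤s (m≤n+m i d))) | runs-search p below d (suc i) (trans (+-suc d i) eq)
... | v , q | t , q′ , l = suc v , q , runs-loop-suc (runs-searchBody q′) l

complete : ∀ {n} {c : PR n} {xs v} → c [ xs ]⇓ v → Runs (compile c) (encV xs) v
completes : ∀ {n m} {gs : Vec (PR n) m} {xs ys} → gs [ xs ]⇓* ys →
            Runs (compiles gs) (encV xs) (encV ys)
completeProj : ∀ {n} (i : Fin n) (xs : Vec ℕ n) → Runs (compileProj i) (encV xs) (lookup xs i)
-- The derivation grows at the last round whereas a loop unfolds at its first. Hence the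
-- continuation form: whatever the loop achieves from index k with r rounds left, it achieves from
-- index 0 with k + r rounds left.
completePrec : ∀ {n} {f : PR n} {g k xs v} → prec f g [ k ∷ xs ]⇓ v →
  ∃ λ y₀ → Runs (compile f) (encV xs) y₀ × (∀ r z →
    Runs (iLoop (loopBody (compile g))) (pair r (pair k (pair v (encV xs)))) z →
    Runs (iLoop (loopBody (compile g))) (pair (k + r) (pair 0 (pair y₀ (encV xs)))) z)
completeLoop : ∀ {n} {f : PR n} {g k xs v} → prec f g [ k ∷ xs ]⇓ v →
               Runs (compile (prec f g)) (encV (k ∷ xs)) v

complete zer⇓ = runs-Z
complete succ⇓ = runs-seq runs-fst runs-S
complete (proj⇓ {i = i} {xs}) = completeProj i xs
complete (comp⇓ ds d) = runs-seq (completes ds) (complete d)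
complete d@(prec0 _) = completeLoop d
complete d@(precS _ _) = completeLoop d
complete {xs = xs} (mini⇓ {f = f} d ds)
  with runs-search {compile f} {encV xs} (complete d) (λ j j<k → _ , complete (proj₂ (ds j j<k))) _ 0 (+-identityʳ _)
... | t , p , l = runs-seq (runs-pair runs-Z runs-id) (runs-seq (runs-pair p runs-id) (runs-seq l runs-fst))

completeLoop {k = k} {xs} {v} d with completePrec d
... | y₀ , p , q = runs-seq
  (runs-pair runs-fst (runs-pair runs-Z (runs-pair (runs-seq runs-snd p) runs-snd)))
  (runs-seq (subst (λ w → Runs _ (pair w (pair 0 (pair y₀ (encV xs)))) (pair k (pair v (encV xs))))
                   (+-identityʳ k) (q 0 _ runs-loop-0))
            (runs-seq runs-snd runs-fst))

completes []⇓ = runs-Z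
completes (d ∷⇓ ds) = runs-pair (complete d) (completes ds)

completeProj zero (x ∷ xs) = runs-fst
completeProj (suc i) (x ∷ xs) = runs-seq runs-snd (completeProj i xs)

completePrec (prec0 d) = _ , complete d , λ r z p → p
completePrec {g = g} {xs = xs} (precS {k = k} d e) with completePrec d
... | y₀ , p , q = y₀ , p , λ r z h → subst (λ w → Runs (iLoop (loopBody (compile g))) (pair w (pair 0 (pair y₀ (encV xs)))) z)
  (+-suc k r) (q (suc r) z (runs-loop-suc (runs-loopBody (complete e)) h))

-- Soundness of the machine

Ends : Config → ℕ → Set
Ends c s = ctrl (run s c) ≡ []

-- The converse of `Runs`: a halting computation that starts with `a` must get through `a`, with a
-- result in `D`. The strict loss of steps is the measure on which the unbounded search terminates.
Halting : Instr → ℕ → (ℕ → Set) → Set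
Halting a x D = ∀ K S s → Ends (cfg (a ∷ K) x S) s →
                ∃ λ y → D y × ∃ λ s′ → s′ < s × Ends (cfg K y S) s′

halting-seq : ∀ {a b x D D′} → Halting a x D → (∀ y → D y → Halting b y D′) → Halting (iSeq a b) x D′
halting-seq p q K S (suc s) h with p _ S s h
... | y , d , s₁ , s₁<s , h₁ with q y d K S s₁ h₁
... | z , d′ , s₂ , s₂<s₁ , h₂ = z , d′ , s₂ , <-trans s₂<s₁ (<-trans s₁<s (n<1+n s)) , h₂

Pairs : (ℕ → Set) → (ℕ → Set) → ℕ → Set
Pairs D D′ z = ∃ λ x → ∃ λ y → D x × D′ y × z ≡ pair x y

halting-pair : ∀ {a b x D D′} → Halting a x D → Halting b x D′ → Halting (iPair a b) x (Pairs D D′)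
halting-pair p q K S (suc (suc (suc s))) h with p _ _ s h
... | y , d , suc (suc (suc s₁)) , s₁<s , h₁ with q _ _ s₁ h₁
... | z , d′ , suc s₂ , s₂<s₁ , h₂ =
  pair y z , (y , z , d , d′ , refl) , s₂ ,
  ≤-trans (≤-trans (<⇒≤ s₂<s₁) (≤-trans (n≤1+n s₁) (≤-trans (n≤1+n _) (n≤1+n _))))
          (≤-trans (<⇒≤ s₁<s) (≤-trans (n≤1+n s) (≤-trans (n≤1+n _) (n≤1+n _)))) , h₂

halting-map : ∀ {a x D D′} → Halting a x D → (∀ y → D y → D′ y) → Halting a x D′
halting-map p f K S s h with p K S s h
... | y , d , rest = y , f y d , rest

halting-Z : ∀ {x} → Halting iZ x (_≡ 0)
halting-Z K S (suc s) h = 0 , refl , s , n<1+n s , h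

halting-S : ∀ {x} → Halting iS x (_≡ suc x)
halting-S K S (suc s) h = _ , refl , s , n<1+n s , h

halting-fst : ∀ {x y} → Halting iF (pair x y) (_≡ x)
halting-fst K S (suc s) h = _ , fst-pair _ _ , s , n<1+n s , h

halting-snd : ∀ {x y} → Halting iR (pair x y) (_≡ y)
halting-snd K S (suc s) h = _ , snd-pair _ _ , s , n<1+n s , h

halting-id : ∀ {x} → Halting iId x (_≡ x)
halting-id {x} K S (suc (suc (suc (suc (suc s))))) h =
  x , refl , s , s≤s (≤-trans (n≤1+n s) (≤-trans (n≤1+n _) (≤-trans (n≤1+n _) (n≤1+n _)))) ,
  subst (λ w → Ends (cfg K w S) s) (fst-pair x x) h

halting-loop : ∀ {a r y} K S s → Ends (cfg (iLoop a ∷ K) (pair r y) S) s →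
               ∃ λ s′ → s ≡ suc s′ × Ends (loopStep r a K y S) s′
halting-loop {a} {r} {y} K S (suc s) h =
  s , refl , subst (λ c → Ends c s) (step-loop r a K y S) h

halting-loopBody : ∀ {g r i y x} {D : ℕ → Set} → Halting g (pair i (pair y x)) D →
  Halting (loopBody g) (pair r (pair i (pair y x))) (λ w → ∃ λ z → D z × w ≡ pair r (pair (suc i) (pair z x)))
halting-loopBody {g} {r} {i} {y} {x} p = halting-map
  (halting-pair halting-fst
    (halting-seq halting-snd λ { _ refl →
      halting-pair (halting-seq halting-fst λ { _ refl → halting-S })
        (halting-pair p (halting-seq halting-snd λ { _ refl → halting-snd })) }))
  λ { _ (_ , _ , refl , (_ , _ , refl , (z , _ , d , refl , refl) , refl) , refl) → z , d , refl }

halting-searchBody : ∀ {f r i x} {D : ℕ → Set} → Halting f (pair (suc i) x) D →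
  Halting (searchBody f) (pair r (pair i x)) (λ w → ∃ λ v → D v × w ≡ pair v (pair (suc i) x))
halting-searchBody {f} {r} {i} {x} p = halting-map
  (halting-seq halting-snd λ { _ refl →
    halting-seq (halting-pair (halting-seq halting-fst λ { _ refl → halting-S }) halting-snd)
      λ { _ (_ , _ , refl , refl , refl) → halting-pair p halting-id } })
  λ { _ (v , _ , d , refl , refl) → v , d , refl }

sound : ∀ {n} (c : PR n) xs → Halting (compile c) (encV xs) (λ y → c [ xs ]⇓ y)
sounds : ∀ {n m} (gs : Vec (PR n) m) xs →
         Halting (compiles gs) (encV xs) (λ y → ∃ λ ys → gs [ xs ]⇓* ys × y ≡ encV ys)
soundProj : ∀ {n} (i : Fin n) xs → Halting (compileProj i) (encV xs) (_≡ lookup xs i)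
soundPrec : ∀ {n} (f : PR n) g xs r {i y} → prec f g [ i ∷ xs ]⇓ y →
  Halting (iLoop (loopBody (compile g))) (pair r (pair i (pair y (encV xs))))
    (λ w → ∃ λ z → prec f g [ r + i ∷ xs ]⇓ z × w ≡ pair (r + i) (pair z (encV xs)))
-- The search has no structural measure, so the induction is on a bound `b` for the machine steps
-- left; `below` accumulates the positive values that `mini⇓` asks for.
soundMini : ∀ {n} (f : PR (suc n)) xs b {i t} → f [ i ∷ xs ]⇓ t →
  (∀ j → j < i → ∃ λ v → f [ j ∷ xs ]⇓ suc v) → ∀ K S s → s ≤ b →
  Ends (cfg (iLoop (searchBody (compile f)) ∷ K) (pair t (pair i (encV xs))) S) s →
  ∃ λ w → (∃ λ k → mini f [ xs ]⇓ k × w ≡ pair k (encV xs)) × ∃ λ s′ → s′ < s × Ends (cfg K w S) s′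

sound zer xs = halting-map halting-Z λ { _ refl → zer⇓ }
sound succ (x ∷ []) = halting-map (halting-seq halting-fst λ { _ refl → halting-S }) λ { _ refl → succ⇓ }
sound (proj i) xs = halting-map (soundProj i xs) λ { _ refl → proj⇓ }
sound (comp f gs) xs = halting-seq (sounds gs xs)
  λ { _ (ys , ds , refl) → halting-map (sound f ys) λ _ d → comp⇓ ds d }
sound (prec f g) (k ∷ xs) = halting-seq
  (halting-pair halting-fst (halting-pair halting-Z
    (halting-pair (halting-seq halting-snd λ { _ refl → sound f xs }) halting-snd)))
  λ { _ (_ , _ , refl , (_ , _ , refl , (y , _ , d , refl , refl) , refl) , refl) →
    halting-seq (soundPrec f g xs k (prec0 d))
      λ { _ (z , e , refl) → halting-seq halting-snd
        λ { _ refl → halting-map halting-fst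
          λ { _ refl → subst (λ w → prec f g [ w ∷ xs ]⇓ z) (+-identityʳ k) e } } } }
sound (mini f) xs = halting-seq (halting-pair halting-Z halting-id)
  λ { _ (_ , _ , refl , refl , refl) → halting-seq (halting-pair (sound f (0 ∷ xs)) halting-id)
    λ { _ (t , _ , d , refl , refl) → halting-seq
      (λ K S s h → soundMini f xs s d (λ _ ()) K S s ≤-refl h)
      λ { _ (k , e , refl) → halting-map halting-fst λ { _ refl → e } } } }

sounds [] xs = halting-map halting-Z λ { _ refl → [] , []⇓ , refl }
sounds (g ∷ gs) xs = halting-map (halting-pair (sound g xs) (sounds gs xs))
  λ { _ (y , _ , d , (ys , ds , refl) , refl) → y ∷ ys , (d ∷⇓ ds) , refl }

soundProj zero (x ∷ xs) = halting-fst
soundProj (suc i) (x ∷ xs) = halting-seq halting-snd λ { _ refl → soundProj i xs }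

soundPrec f g xs zero {i} {y} d K S s h with halting-loop K S s h
... | s′ , refl , h′ = _ , (y , d , refl) , s′ , n<1+n s′ , h′
soundPrec f g xs (suc r) {i} {y} d K S s h with halting-loop K S s h
... | s₁ , refl , h₁ with halting-loopBody (sound g (i ∷ y ∷ xs)) _ S s₁ h₁
... | _ , (z , e , refl) , s₂ , s₂<s₁ , h₂ with soundPrec f g xs r (precS d e) K S s₂ h₂
... | _ , (v , e′ , refl) , s₃ , s₃<s₂ , h₃ =
  _ , (v , subst (λ w → prec f g [ w ∷ xs ]⇓ v) (+-suc r i) e′ , cong (λ w → pair w (pair v (encV xs))) (+-suc r i)) ,
  s₃ , <-trans s₃<s₂ (<-trans s₂<s₁ (n<1+n s₁)) , h₃

soundMini f xs b {i} {zero} d below K S s s≤b h with halting-loop K S s h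
... | s′ , refl , h′ = _ , (i , mini⇓ d below , refl) , s′ , n<1+n s′ , h′
soundMini f xs b {i} {suc t} d below K S s s≤b h with halting-loop K S s h
soundMini f xs (suc b) {i} {suc t} d below K S s (s≤s s≤b) h | s₁ , refl , h₁
  with halting-searchBody (sound f (suc i ∷ xs)) _ S s₁ h₁
... | _ , (v , e , refl) , s₂ , s₂<s₁ , h₂
  with soundMini f xs b e below′ K S s₂ (≤-trans (<⇒≤ s₂<s₁) s≤b) h₂
  where
  below′ : ∀ j → j < suc i → ∃ λ v → f [ j ∷ xs ]⇓ suc v
  below′ j (s≤s j≤i) with m≤n⇒m<n∨m≡n j≤i
  ... | inj₁ j<i = below j j<i
  ... | inj₂ refl = t , d
... | w , res , s₃ , s₃<s₂ , h₃ = w , res , s₃ , <-trans s₃<s₂ (<-trans s₂<s₁ (n<1+n s₁)) , h₃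

U-complete : ∀ {n} (c : PR n) {xs v} → c [ xs ]⇓ v → ∃ λ s → U (encI (compile c)) (encV xs) s ≡ suc v
U-complete c {xs} {v} d with complete d [] []
... | steps s h = s , trans (U-run (compile c) (encV xs) s) (trans (cong (output ∘ encC) h) halted)
  where
  halted : output (cfgℕ 0 v 0) ≡ suc v
  halted rewrite fst-pair 0 (pair v 0) | snd-pair 0 (pair v 0) | fst-pair v 0 = refl

output-ends : ∀ c {v} → output (encC c) ≡ suc v → ctrl c ≡ []
output-ends (cfg [] x S) h = refl
output-ends (cfg (i ∷ K) x S) h rewrite fst-pair (encK (i ∷ K)) (pair x (encS S)) with () ← h

-- Convergence suffices here because `CE` presents relations as domains of codes.
U-sound : ∀ {n} (c : PR n) {xs v s} → U (encI (compile c)) (encV xs) s ≡ suc v → ∃ λ y → c [ xs ]⇓ y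
U-sound c {xs} {v} {s} h
  with y , d , _ ← sound c xs [] [] s (output-ends (run s (cfg (compile c ∷ []) (encV xs) []))
                                     (trans (sym (U-run (compile c) (encV xs) s)) h)) = y , d

φ : ℕ → ℕ → ℕ → ℕ
φ e x s = U e (pair x 0) s

c-φ : Op₃ φ
c-φ a b c = c-U a (c-pair b (c-const 0)) c

φ-mono : ∀ {e x s s′ v} → s ≤ s′ → φ e x s ≡ suc v → φ e x s′ ≡ suc v
φ-mono = U-mono

φ-index : ∀ {f} → Op₁ f → ∃ λ e → ∀ x → ∃ λ s → φ e x s ≡ suc (f x)
φ-index {f} cf = encI (compile c) , λ x → U-complete c (ok x)
  where
  open Σ (toComputable {f} cf) renaming (proj₁ to c; proj₂ to ok)

-- Determinism, unbounded search and enumeration in stages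

⇓-det : ∀ {n} {c : PR n} {xs v w} → c [ xs ]⇓ v → c [ xs ]⇓ w → v ≡ w
⇓*-det : ∀ {n m} {cs : Vec (PR n) m} {xs vs ws} → cs [ xs ]⇓* vs → cs [ xs ]⇓* ws → vs ≡ ws
⇓-det zer⇓ zer⇓ = refl
⇓-det succ⇓ succ⇓ = refl
⇓-det proj⇓ proj⇓ = refl
⇓-det (comp⇓ ds d) (comp⇓ es e) with refl ← ⇓*-det ds es = ⇓-det d e
⇓-det (prec0 d) (prec0 e) = ⇓-det d e
⇓-det (precS d d′) (precS e e′) with refl ← ⇓-det d e = ⇓-det d′ e′
⇓-det (mini⇓ {k = k} d ds) (mini⇓ {k = l} e es) with <-cmp k l
... | tri< k<l _ _ with () ← ⇓-det d (proj₂ (es k k<l))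
... | tri≈ _ k≡l _ = k≡l
... | tri> _ _ l<k with () ← ⇓-det (proj₂ (ds l l<k)) e
⇓*-det []⇓ []⇓ = refl
⇓*-det (d ∷⇓ ds) (e ∷⇓ es) = cong₂ _∷_ (⇓-det d e) (⇓*-det ds es)

firstTrue : (b : ℕ → Bool) (d i : ℕ) → (∀ j → j < i → b j ≡ false) → b (d + i) ≡ true →
            ∃ λ k → b k ≡ true × (∀ j → j < k → b j ≡ false)
firstTrue b zero i below h = i , h , below
firstTrue b (suc d) i below h with b i in eq
... | true = i , eq , below
... | false = firstTrue b d (suc i) below′ (subst (λ w → b w ≡ true) (sym (+-suc d i)) h)
  where
  below′ : ∀ j → j < suc i → b j ≡ false
  below′ j (s≤s j≤i) with m≤n⇒m<n∨m≡n j≤i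
  ... | inj₁ j<i = below j j<i
  ... | inj₂ refl = eq

leastTrue : (b : ℕ → Bool) → ∃ (λ k → b k ≡ true) → ∃ λ k → b k ≡ true × (∀ j → j < k → b j ≡ false)
leastTrue b (k , h) = firstTrue b k 0 (λ _ ()) (subst (λ w → b w ≡ true) (sym (+-identityʳ k)) h)

-- `mini` looks for a zero, so truth is 0 here, opposite to `b2n`.
flag : Bool → ℕ
flag b = if b then 0 else 1

c-flag : ∀ {n} {b : Vec ℕ n → Bool} → CompB b → Comp (λ xs → flag (b xs))
c-flag cb = c-if cb (c-const 0) (c-const 1)

μ : ∀ {n} {b : Vec ℕ (suc n) → Bool} → CompB b → PR n
μ cb = mini (code (c-flag cb))

μ⇓ : ∀ {n} {b : Vec ℕ (suc n) → Bool} (cb : CompB b) {xs k} → b (k ∷ xs) ≡ true →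
     (∀ j → j < k → b (j ∷ xs) ≡ false) → μ cb [ xs ]⇓ k
μ⇓ {b = b} cb {xs} {k} h below =
  mini⇓ (at k true h) λ j j<k → 0 , at j false (below j j<k)
  where
  at : ∀ j a → b (j ∷ xs) ≡ a → code (c-flag cb) [ j ∷ xs ]⇓ flag a
  at j a refl = computes (c-flag cb) (j ∷ xs)

μ-true : ∀ {n} {b : Vec ℕ (suc n) → Bool} (cb : CompB b) {xs k} → μ cb [ xs ]⇓ k → b (k ∷ xs) ≡ true
μ-true {b = b} cb {xs} {k} (mini⇓ d _) = zero-flag _ (⇓-det (computes (c-flag cb) (k ∷ xs)) d)
  where
  zero-flag : ∀ a → flag a ≡ 0 → a ≡ true
  zero-flag true _ = refl

opaque
  -- Totality may be known only classically; the function obtained is computable nevertheless.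
  -- Halting times, coding locations and preimages are all found in this way.
  c-search : ∀ {b : ℕ → ℕ → Bool} → OpB₂ b → (∀ x → ∃ λ k → b k x ≡ true) →
             Σ (ℕ → ℕ) λ f → Op₁ f × (∀ x → b (f x) x ≡ true)
  c-search {b} cb total = f , op₁ f (mkComp (μ c) λ { (x ∷ []) →
      μ⇓ c (proj₁ (proj₂ (least x))) (proj₂ (proj₂ (least x))) }) , λ x → proj₁ (proj₂ (least x))
    where
    least : ∀ x → ∃ λ k → b k x ≡ true × (∀ j → j < k → b j x ≡ false)
    least x = leastTrue (λ k → b k x) (total x)
    f : ℕ → ℕ
    f x = proj₁ (least x)
    c : CompB {2} (λ xs → b (x0 xs) (x1 xs))
    c = cb v0 v1

record Staged (R : ℕ → ℕ → Set) : Set where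
  field
    stage : ℕ → ℕ → ℕ → Bool
    c-stage : OpB₃ stage
    mono : ∀ {s s′ x y} → s ≤ s′ → stage s x y ≡ true → stage s′ x y ≡ true
    holds : ∀ {s x y} → stage s x y ≡ true → R x y
    appears : ∀ {x y} → R x y → ∃ λ s → stage s x y ≡ true

CE⇒Staged : ∀ {R} → CE R → Staged R
CE⇒Staged {R} (c , ok) = record
  { stage = λ s x y → 0 <ᵇ u s x y
  ; c-stage = λ a b d → c-<ᵇ (c-const 0) (c-U (c-const e) (c-pair b (c-pair d (c-const 0))) a)
  ; mono = λ {s} {s′} {x} {y} → mono′ s s′ x y
  ; holds = λ {s} {x} {y} → holds′ s x y
  ; appears = λ {x} {y} r → let v , d = to (ok x y) r ; s , h = U-complete c d in
                            s , cong (0 <ᵇ_) h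
  }
  where
  e = encI (compile c)
  u : ℕ → ℕ → ℕ → ℕ
  u s x y = U e (pair x (pair y 0)) s
  mono′ : ∀ s s′ x y → s ≤ s′ → (0 <ᵇ u s x y) ≡ true → (0 <ᵇ u s′ x y) ≡ true
  mono′ s s′ x y le h with u s x y in eq
  ... | suc v = cong (0 <ᵇ_) (U-mono le eq)
  holds′ : ∀ s x y → (0 <ᵇ u s x y) ≡ true → R x y
  holds′ s x y h with u s x y in eq
  ... | suc v = from (ok x y) (U-sound c {x ∷ y ∷ []} eq)

Staged⇒CE : ∀ {R} → Staged R → CE R
Staged⇒CE {R} S = μ c , λ x y → mk⇔ (halts x y) λ { (k , d) → holds (μ-true c d) }
  where
  open Staged S
  c : CompB {3} (λ xs → stage (x0 xs) (x1 xs) (x2 xs))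
  c = c-stage v0 v1 v2
  halts : ∀ x y → R x y → ∃ λ v → μ c [ x ∷ y ∷ [] ]⇓ v
  halts x y r with leastTrue (λ s → stage s x y) (appears r)
  ... | k , h , below = k , μ⇓ c h below

nrec-cong : ∀ {z f g} s → (∀ k → k < s → ∀ y → f k y ≡ g k y) → nrec z f s ≡ nrec z g s
nrec-cong zero h = refl
nrec-cong {z} {f} {g} (suc s) h = trans (h s (n<1+n s) _)
  (cong (g s) (nrec-cong s λ k k<s → h k (≤-trans k<s (n≤1+n s))))

-- The priority construction

-- The action of a stage: req is 0 if no requirement acts and 1 + n if requirement n does; every element
-- represented by src is from then on represented by tgt, and src = tgt = 0 changes nothing.
req src tgt : ℕ → ℕ
req a = fst a
src a = fst (snd a)
tgt a = snd (snd a)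

action : ℕ → ℕ → ℕ → ℕ
action r w v = pair r (pair w v)

req-action : ∀ r w v → req (action r w v) ≡ r
req-action r w v = fst-pair r _

src-action : ∀ r w v → src (action r w v) ≡ w
src-action r w v = trans (cong fst (snd-pair r _)) (fst-pair w v)

tgt-action : ∀ r w v → tgt (action r w v) ≡ v
tgt-action r w v = trans (cong snd (snd-pair r _)) (snd-pair w v)

c-action : Op₃ action
c-action a b c = c-pair a (c-pair b c)

c-src : Op₁ src
c-src a = c-fst (c-snd a)

c-tgt : Op₁ tgt
c-tgt a = c-snd (c-snd a)

injures owns : ℕ → ℕ → Bool
injures n a = (0 <ᵇ req a) ∧ (req a <ᵇ suc n)
owns n a = req a ≡ᵇ suc n

moved : ℕ → ℕ → ℕ
moved a y = if y ≡ᵇ src a then tgt a else y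

-- Requirement n is injured by the actions of the requirements below it. lastInj is the first stage after its last
-- injury, count the number of its own actions since then, and loc gives the stage of the i-th of these.
rep lastInj count : (ℕ → ℕ) → ℕ → ℕ → ℕ
rep α s x = nrec x (λ k y → moved (α k) y) s
lastInj α n s = nrec 0 (λ k y → if injures n (α k) then suc k else y) s
count α n s = nrec 0 (λ k y → if injures n (α k) then 0 else if owns n (α k) then suc y else y) s

loc : (ℕ → ℕ) → ℕ → ℕ → ℕ → ℕ
loc α n i s = nrec 0 (λ k y → if owns n (α k) ∧ (count α n k ≡ᵇ i) then k else y) s

-- All that stage s consults depends on the actions before s only. This allows `α` to be replaced by
-- a finite history, and so turns a course-of-values recursion into a primitive one.
module _ {α β : ℕ → ℕ} (s : ℕ) (agree : ∀ k → k < s → α k ≡ β k) where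
  rep-cong : ∀ x → rep α s x ≡ rep β s x
  rep-cong x = nrec-cong s λ k k<s y → cong (λ a → moved a y) (agree k k<s)

  lastInj-cong : ∀ n → lastInj α n s ≡ lastInj β n s
  lastInj-cong n = nrec-cong s λ k k<s y → cong (λ a → if injures n a then suc k else y) (agree k k<s)

  count-cong : ∀ n → count α n s ≡ count β n s
  count-cong n = nrec-cong s λ k k<s y →
    cong (λ a → if injures n a then 0 else if owns n a then suc y else y) (agree k k<s)

loc-cong : ∀ {α β : ℕ → ℕ} s → (∀ k → k < s → α k ≡ β k) → ∀ n i → loc α n i s ≡ loc β n i s
loc-cong s agree n i = nrec-cong s λ k k<s y →
  cong₂ (λ a c → if owns n a ∧ (c ≡ᵇ i) then k else y) (agree k k<s)
        (count-cong k (λ l l<k → agree l (<-trans l<k k<s)) n)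

-- A history h lists the actions of the stages before s, the latest one first.
past : ℕ → ℕ → ℕ → ℕ
past s h k = fst (nrec h (λ _ y → snd y) (s ∸ suc k))

-- The coding location opened by requirement n at stage τ: not yet used at τ, and below the restraint that the
-- action at τ imposes on the requirements after n.
mark : ℕ → ℕ → ℕ
mark n τ = 2 * (τ + suc n) + 1

-- The count of a requirement of the second kind is read as a code ⟨x , y , i , j , ρ⟩: φ e is
-- tested on x and y, the pair i, j of D is the one to be coded, and ρ is the stage at which D is
-- consulted.
_at₀ _at₁ _at₂ _at₃ _rest : ℕ → ℕ
k at₀ = fst k
k at₁ = fst (snd k)
k at₂ = fst (snd (snd k))
k at₃ = fst (snd (snd (snd k)))
k rest = snd (snd (snd (snd k)))

module Construction {A B D : ℕ → ℕ → Set} (SA : Staged A) (SB : Staged B) (SD : Staged D) where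
  open Staged SA using () renaming (stage to stageA; c-stage to c-stageA)
  open Staged SB using () renaming (stage to stageB; c-stage to c-stageB)
  open Staged SD using () renaming (stage to stageD; c-stage to c-stageD)

  opaque
    related : ℕ → ℕ → ℕ → Bool
    related s u v = (u ≡ᵇ v) ∨ ((par u ≡ᵇ 0) ∧ ((par v ≡ᵇ 0) ∧ stageA s (half u) (half v)))

    c-related : OpB₃ related
    c-related a b c = c-∨ (c-≡ᵇ b c) (c-∧ (c-≡ᵇ (c-par b) (c-const 0))
      (c-∧ (c-≡ᵇ (c-par c) (c-const 0)) (c-stageA a (c-half b) (c-half c))))

    related-equal : ∀ s {u v} → u ≡ v → related s u v ≡ true
    related-equal s {u} refl = cong (_∨ ((par u ≡ᵇ 0) ∧ ((par u ≡ᵇ 0) ∧ stageA s (half u) (half u))))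
                                    (≡ᵇ-yes {u} refl)

    related-even : ∀ s {a b} → stageA s a b ≡ true → related s (2 * a) (2 * b) ≡ true
    related-even s {a} {b} h = or-true (2 * a ≡ᵇ 2 * b)
      (∧-yes (≡ᵇ-yes (par-even a)) (∧-yes (≡ᵇ-yes (par-even b))
        (trans (cong₂ (stageA s) (half-even a) (half-even b)) h)))
      where
      or-true : ∀ x {y} → y ≡ true → (x ∨ y) ≡ true
      or-true true _ = refl
      or-true false e = e

    related-inv : ∀ s {u v} → related s u v ≡ true →
                  u ≡ v ⊎ (∃ λ a → ∃ λ b → u ≡ 2 * a × v ≡ 2 * b × stageA s a b ≡ true)
    related-inv s {u} {v} h with u ≡ᵇ v in e
    ... | true = inj₁ (≡ᵇ-true u v e)
    ... | false = let p , h₁ = ∧-true h ; q , a = ∧-true h₁ in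
      inj₂ (half u , half v , par0-even u (≡ᵇ-true (par u) 0 p) , par0-even v (≡ᵇ-true (par v) 0 q) , a)

  -- Oddness of w protects A, and the bound l + n protects what requirements of higher priority rely
  -- on. The bound on w leaves odd numbers of index s or more untouched before stage s + 1; the one
  -- on v keeps the representatives of small numbers small.
  permitted : ℕ → ℕ → ℕ → ℕ → ℕ → Bool
  permitted s n l w v =
    (par w ≡ᵇ 1) ∧ ((l + n <ᵇ half w) ∧ ((half w <ᵇ s) ∧ (half v <ᵇ s)))

  -- Values of φ are stored as 1 + result, so positivity is convergence. Agreement on a negative
  -- answer counts as well, although a later stage may revoke it.
  agrees : ℕ → ℕ → ℕ → ℕ → ℕ → Bool
  agrees s zx zy u v =
    (0 <ᵇ zx) ∧ ((0 <ᵇ zy) ∧ (related s u v ≡b stageB s (pred zx) (pred zy)))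

  chooseP : ℕ → ℕ → ℕ → ℕ → ℕ → ℕ → ℕ → ℕ
  chooseP s n c l z w v =
    if (0 <ᵇ z) ∧ ((c ≡ᵇ 0) ∧ permitted s n l w v) then action (suc n) w v else action 0 0 0

  collapses : ℕ → ℕ → ℕ → ℕ → ℕ → ℕ → Bool
  collapses s n c l w v =
    ((c at₂) <ᵇ c) ∧ (((c at₃) <ᵇ c) ∧ (stageD (c rest) (c at₂) (c at₃) ∧ permitted s n l w v))

  -- Agreement alone makes the requirement act: the count rises and a new location opens even when
  -- nothing can be collapsed.
  chooseN : ℕ → ℕ → ℕ → ℕ → ℕ → ℕ → ℕ → ℕ → ℕ
  chooseN s n c l u₁ u₂ w v =
    if agrees s (φ (snd n) (c at₀) s) (φ (snd n) (c at₁) s) u₁ u₂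
    then (if collapses s n c l w v then action (suc n) w v else action (suc n) 0 0)
    else action 0 0 0

  -- Stage s = ⟨n , x , σ⟩ serves requirement n; n = ⟨0 , e , j⟩ is of the first kind and n = ⟨1 , e⟩ of the second.
  found : ℕ → ℕ → ℕ
  found s n = φ (fst (snd n)) (fst (snd s)) (snd (snd s))

  choose : (ℕ → ℕ) → ℕ → ℕ
  choose α s =
    if fst (fst s) ≡ᵇ 0
    then chooseP s (fst s) (count α (fst s) s) (lastInj α (fst s) s) (found s (fst s))
               (rep α s (pred (found s (fst s)))) (rep α s (snd (snd (fst s))))
    else chooseN s (fst s) (count α (fst s) s) (lastInj α (fst s) s)
               (rep α s (count α (fst s) s at₀)) (rep α s (count α (fst s) s at₁))
               (rep α s (mark (fst s) (loc α (fst s) (count α (fst s) s at₃) s)))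
               (rep α s (mark (fst s) (loc α (fst s) (count α (fst s) s at₂) s)))

  choose-cong : ∀ {α β} s → (∀ k → k < s → α k ≡ β k) → choose α s ≡ choose β s
  choose-cong {α} {β} s agree
    rewrite count-cong s agree (fst s) | lastInj-cong s agree (fst s)
          | loc-cong s agree (fst s) (count β (fst s) s at₃)
          | loc-cong s agree (fst s) (count β (fst s) s at₂)
          | rep-cong s agree (pred (found s (fst s))) | rep-cong s agree (snd (snd (fst s)))
          | rep-cong s agree (count β (fst s) s at₀) | rep-cong s agree (count β (fst s) s at₁)
          | rep-cong s agree (mark (fst s) (loc β (fst s) (count β (fst s) s at₃) s))
          | rep-cong s agree (mark (fst s) (loc β (fst s) (count β (fst s) s at₂) s)) = refl

  c-past : Op₃ past
  c-past = op₃ past (c-fst (c-nrec v1 (c-snd v1) (c-∸ v0 (c-suc v2))))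

  c-injures : OpB₂ injures
  c-injures a b = c-∧ (c-<ᵇ (c-const 0) (c-fst b)) (c-<ᵇ (c-fst b) (c-suc a))

  c-owns : OpB₂ owns
  c-owns a b = c-≡ᵇ (c-fst b) (c-suc a)

  c-rep : Op₄ (λ s h k x → rep (past s h) k x)
  c-rep = op₄ (λ s h k x → rep (past s h) k x) (c-nrec v3 (c-if (c-≡ᵇ v1 (c-src (c-past v2 v3 v0))) (c-tgt (c-past v2 v3 v0)) v1) v2)

  c-lastInj : Op₄ (λ s h n k → lastInj (past s h) n k)
  c-lastInj = op₄ (λ s h n k → lastInj (past s h) n k) (c-nrec (c-const 0) (c-if (c-injures v4 (c-past v2 v3 v0)) (c-suc v0) v1) v3)

  c-count : Op₄ (λ s h n k → count (past s h) n k)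
  c-count = op₄ (λ s h n k → count (past s h) n k) (c-nrec (c-const 0) (c-if (c-injures v4 (c-past v2 v3 v0)) (c-const 0)
                                        (c-if (c-owns v4 (c-past v2 v3 v0)) (c-suc v1) v1)) v3)

  c-loc : Op₅ (λ s h n i k → loc (past s h) n i k)
  c-loc = op₅ (λ s h n i k → loc (past s h) n i k) (c-nrec (c-const 0) (c-if (c-∧ (c-owns v4 (c-past v2 v3 v0))
                                             (c-≡ᵇ (c-count v2 v3 v4 v0) v5)) v0 v1) v4)

  c-mark : Op₂ mark
  c-mark a b = c-+ (c-2* (c-+ b (c-suc a))) (c-const 1)

  c-choose : Op₂ (λ s h → choose (past s h) s)
  c-choose = op₂ (λ s h → choose (past s h) s) (c-if (c-≡ᵇ (c-fst n) (c-const 0))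
    (c-if (c-∧ (c-<ᵇ (c-const 0) z) (c-∧ (c-≡ᵇ c (c-const 0)) (perm wP vP)))
          (c-action (c-suc n) wP vP) (c-action (c-const 0) (c-const 0) (c-const 0)))
    (c-if (c-∧ (c-<ᵇ (c-const 0) zx) (c-∧ (c-<ᵇ (c-const 0) zy)
             (c-≡b (c-related s (c-rep s h s k₀) (c-rep s h s k₁)) (c-stageB s (c-pred zx) (c-pred zy)))))
      (c-if (c-∧ (c-<ᵇ k₂ c) (c-∧ (c-<ᵇ k₃ c) (c-∧ (c-stageD kr k₂ k₃) (perm wN vN))))
            (c-action (c-suc n) wN vN) (c-action (c-suc n) (c-const 0) (c-const 0)))
      (c-action (c-const 0) (c-const 0) (c-const 0))))
    where
    s = v0
    h = v1
    n = c-fst v0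
    c = c-count s h n s
    l = c-lastInj s h n s
    z = c-φ (c-fst (c-snd n)) (c-fst (c-snd s)) (c-snd (c-snd s))
    wP = c-rep s h s (c-pred z)
    vP = c-rep s h s (c-snd (c-snd n))
    k₀ = c-fst c
    k₁ = c-fst (c-snd c)
    k₂ = c-fst (c-snd (c-snd c))
    k₃ = c-fst (c-snd (c-snd (c-snd c)))
    kr = c-snd (c-snd (c-snd (c-snd c)))
    wN = c-rep s h s (c-mark n (c-loc s h n k₃ s))
    vN = c-rep s h s (c-mark n (c-loc s h n k₂ s))
    zx = c-φ (c-snd n) k₀ s
    zy = c-φ (c-snd n) k₁ s
    perm : ∀ {w v : Vec ℕ 2 → ℕ} → Comp w → Comp v → CompB _
    perm w v = c-∧ (c-≡ᵇ (c-par w) (c-const 1))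
      (c-∧ (c-<ᵇ (c-+ l n) (c-half w)) (c-∧ (c-<ᵇ (c-half w) s) (c-<ᵇ (c-half v) s)))

  opaque
    history : ℕ → ℕ
    history s = nrec 0 (λ s h → pair (choose (past s h) s) h) s

    α : ℕ → ℕ
    α s = choose (past s (history s)) s

    dropped : ∀ d k → nrec (history (d + k)) (λ _ y → snd y) d ≡ history k
    dropped zero k = refl
    dropped (suc d) k = trans (shift d _) (trans (cong (λ h → nrec h (λ _ y → snd y) d) (snd-pair _ _)) (dropped d k))
      where
      shift : ∀ d h → snd (nrec h (λ _ y → snd y) d) ≡ nrec (snd h) (λ _ y → snd y) d
      shift zero h = refl
      shift (suc d) h = cong snd (shift d h)

    past-α : ∀ s k → k < s → past s (history s) k ≡ α k
    past-α s k k<s = trans (cong (λ m → fst (nrec (history m) (λ _ y → snd y) (s ∸ suc k))) (sym (m∸n+n≡m k<s)))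
                    (trans (cong fst (dropped (s ∸ suc k) (suc k))) (fst-pair _ _))

    -- The recursion equation of the construction; with it the coded history disappears from the
    -- verification.
    α-choose : ∀ s → α s ≡ choose α s
    α-choose s = choose-cong s (past-α s)

    c-history : Op₁ history
    c-history = op₁ history (c-nrec (c-const 0) (c-pair (c-choose v0 v1) v1) v0)

  c-α-rep : Op₂ (rep α)
  c-α-rep = op₂ (rep α) (comp-ext (λ xs → rep-cong (x0 xs) (past-α (x0 xs)) (x1 xs))
                                  (c-rep v0 (c-history v0) v0 v1))

  c-α-count : Op₂ (count α)
  c-α-count = op₂ (count α) (comp-ext (λ xs → count-cong (x1 xs) (past-α (x1 xs)) (x0 xs))
                                      (c-count v1 (c-history v1) v0 v1))

  c-α-loc : Op₃ (loc α)
  c-α-loc = op₃ (loc α) (comp-ext (λ xs → loc-cong (x2 xs) (past-α (x2 xs)) (x0 xs) (x1 xs))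
                                  (c-loc v2 (c-history v2) v0 v1 v2))

  -- What a single stage can change

  M : ℕ → ℕ → ℕ
  M = rep α

  L C : ℕ → ℕ → ℕ
  L = lastInj α
  C = count α

  record Permitted (s n w v : ℕ) : Set where
    constructor permit
    field
      i : ℕ
      odd : w ≡ 2 * i + 1
      low : L n s + n < i
      high : i < s
      target : half v < s

  permitted-true : ∀ {s n w v} → permitted s n (L n s) w v ≡ true → Permitted s n w v
  permitted-true {s} {n} {w} {v} h =
    let p , h₁ = ∧-true h ; q , h₂ = ∧-true h₁ ; r , t = ∧-true h₂ in
    permit (half w) (par1-odd w (≡ᵇ-true (par w) 1 p)) (<ᵇ-true _ _ q) (<ᵇ-true _ _ r) (<ᵇ-true _ _ t)

  permitted-yes : ∀ {s n w v} → Permitted s n w v → permitted s n (L n s) w v ≡ true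
  permitted-yes {s} {n} {v = v} (permit i refl low high target) =
    ∧-yes (≡ᵇ-yes (par-odd i)) (∧-yes (<ᵇ-yes (subst (L n s + n <_) (sym (half-odd i)) low))
      (∧-yes (<ᵇ-yes (subst (_< s) (sym (half-odd i)) high)) (<ᵇ-yes target)))

  markOf : ℕ → ℕ → ℕ → ℕ
  markOf n i s = mark n (loc α n i s)

  Agreement : ℕ → ℕ → Set
  Agreement s n =
    agrees s (φ (snd n) (C n s at₀) s) (φ (snd n) (C n s at₁) s) (M s (C n s at₀)) (M s (C n s at₁)) ≡ true

  record Collapse (s n w v : ℕ) : Set where
    constructor collapse
    field
      i<c : (C n s at₂) < C n s
      j<c : (C n s at₃) < C n s
      here : stageD (C n s rest) (C n s at₂) (C n s at₃) ≡ true
      w≡ : w ≡ M s (markOf n (C n s at₃) s)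
      v≡ : v ≡ M s (markOf n (C n s at₂) s)
      perm : Permitted s n w v

  data Move (s a : ℕ) : Set where
    idle : req a ≡ 0 → src a ≡ 0 → tgt a ≡ 0 → Move s a
    meet : fst (fst s) ≡ 0 → req a ≡ suc (fst s) → C (fst s) s ≡ 0 →
           ∀ z → found s (fst s) ≡ suc z → src a ≡ M s z → tgt a ≡ M s (snd (snd (fst s))) →
           Permitted s (fst s) (src a) (tgt a) → Move s a
    wait : fst (fst s) ≢ 0 → req a ≡ suc (fst s) → Agreement s (fst s) →
           src a ≡ 0 → tgt a ≡ 0 → Move s a
    join : fst (fst s) ≢ 0 → req a ≡ suc (fst s) → Agreement s (fst s) →
           Collapse s (fst s) (src a) (tgt a) → Move s a

  opaque
    move : ∀ s → Move s (α s)
    move s = subst (Move s) (sym (α-choose s)) go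
      where
      n c w v : ℕ
      n = fst s
      c = C n s
      w = M s (markOf n (c at₃) s)
      v = M s (markOf n (c at₂) s)
      idle′ : Move s (action 0 0 0)
      idle′ = idle (req-action 0 0 0) (src-action 0 0 0) (tgt-action 0 0 0)
      goP : fst n ≡ 0 → ∀ z → found s n ≡ z →
            Move s (chooseP s n c (L n s) z (M s (pred z)) (M s (snd (snd n))))
      goP n≡ zero eq = idle′
      goP n≡ (suc z) eq with (c ≡ᵇ 0) ∧ permitted s n (L n s) (M s z) (M s (snd (snd n))) in h
      ... | false = idle′
      ... | true = let c≡0 , p = ∧-true h in
        meet n≡ (req-action _ _ _) (≡ᵇ-true c 0 c≡0) z eq (src-action _ _ _) (tgt-action _ _ _)
          (subst₂ (Permitted s n) (sym (src-action _ _ _)) (sym (tgt-action _ _ _)) (permitted-true p))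
      goN : fst n ≢ 0 → Move s (chooseN s n c (L n s) (M s (c at₀)) (M s (c at₁)) w v)
      goN n≢ with agrees s (φ (snd n) (c at₀) s) (φ (snd n) (c at₁) s) (M s (c at₀)) (M s (c at₁)) in h
      ... | false = idle′
      ... | true with collapses s n c (L n s) w v in h′
      ...   | false = wait n≢ (req-action _ _ _) h (src-action _ _ _) (tgt-action _ _ _)
      ...   | true = let i<c , h₁ = ∧-true h′ ; j<c , h₂ = ∧-true h₁ ; d , p = ∧-true h₂ in
        join n≢ (req-action _ _ _) h
          (collapse (<ᵇ-true _ _ i<c) (<ᵇ-true _ _ j<c) d (src-action _ _ _) (tgt-action _ _ _)
            (subst₂ (Permitted s n) (sym (src-action _ _ _)) (sym (tgt-action _ _ _)) (permitted-true p)))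
      go : Move s (choose α s)
      go with fst n ≡ᵇ 0 in h
      ... | true = goP (≡ᵇ-true _ _ h) (found s n) refl
      ... | false = goN λ e → case-bool (trans (sym h) (≡ᵇ-yes e))
        where
        case-bool : false ≡ true → ⊥
        case-bool ()

  meets : ∀ {s z} → fst (fst s) ≡ 0 → C (fst s) s ≡ 0 → found s (fst s) ≡ suc z →
          Permitted s (fst s) (M s z) (M s (snd (snd (fst s)))) → req (α s) ≡ suc (fst s)
  meets {s} {z} n≡ c≡ z≡ p = trans (cong req (α-choose s)) go
    where
    go : req (choose α s) ≡ suc (fst s)
    go rewrite ≡ᵇ-yes n≡ | z≡ | ≡ᵇ-yes c≡ | permitted-yes p = req-action _ _ _

  acts : ∀ {s} → fst (fst s) ≢ 0 → Agreement s (fst s) → req (α s) ≡ suc (fst s)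
  acts {s} n≢ h = trans (cong req (α-choose s)) go
    where
    go : req (choose α s) ≡ suc (fst s)
    go rewrite ≡ᵇ-no n≢ | h
      with collapses s (fst s) (C (fst s) s) (L (fst s) s)
             (M s (markOf (fst s) (C (fst s) s at₃) s)) (M s (markOf (fst s) (C (fst s) s at₂) s))
    ... | true = req-action _ _ _
    ... | false = req-action _ _ _

  joins : ∀ {s w v} → fst (fst s) ≢ 0 → Agreement s (fst s) → Collapse s (fst s) w v →
          src (α s) ≡ w × tgt (α s) ≡ v
  joins {s} n≢ h (collapse i<c j<c d refl refl p) =
    trans (cong src eq) (src-action _ _ _) , trans (cong tgt eq) (tgt-action _ _ _)
    where
    go : choose α s ≡ action (suc (fst s)) (M s (markOf (fst s) (C (fst s) s at₃) s))
                             (M s (markOf (fst s) (C (fst s) s at₂) s))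
    go rewrite ≡ᵇ-no n≢ | h | <ᵇ-yes i<c | <ᵇ-yes j<c | d | permitted-yes p = refl
    eq = trans (α-choose s) go

  moved-src : ∀ {a y} → y ≡ src a → moved a y ≡ tgt a
  moved-src {a} {y} e rewrite ≡ᵇ-yes e = refl

  moved-other : ∀ {a y} → y ≢ src a → moved a y ≡ y
  moved-other {a} {y} e rewrite ≡ᵇ-no e = refl

  moved-trivial : ∀ {a} y → src a ≡ 0 → tgt a ≡ 0 → moved a y ≡ y
  moved-trivial {a} y s≡0 t≡0 with y ≟ src a
  ... | yes e = trans (moved-src e) (trans t≡0 (sym (trans e s≡0)))
  ... | no e = moved-other e

  data Effect (s : ℕ) : Set where
    trivial : src (α s) ≡ 0 → tgt (α s) ≡ 0 → Effect s
    removal : ∀ n → req (α s) ≡ suc n → Permitted s n (src (α s)) (tgt (α s)) → Effect s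

  effect : ∀ s → Effect s
  effect s with move s
  ... | idle _ p q = trivial p q
  ... | meet _ r _ _ _ _ _ p = removal _ r p
  ... | wait _ _ _ p q = trivial p q
  ... | join _ r _ (collapse _ _ _ _ _ p) = removal _ r p

  -- Preservation arguments come down to this test: a representative can move only if it is odd,
  -- above the restraint of the acting requirement and of index below the stage.
  moved-keep : ∀ s y → (∀ n → req (α s) ≡ suc n → ∀ i → y ≡ 2 * i + 1 → L n s + n < i → i < s → ⊥) →
               moved (α s) y ≡ y
  moved-keep s y safe with effect s
  ... | trivial p q = moved-trivial y p q
  ... | removal n r (permit i odd low high _) = moved-other λ e → safe n r i (trans e odd) low high

  M-even : ∀ s x → M s (2 * x) ≡ 2 * x
  M-even zero x = refl
  M-even (suc s) x = trans (cong (moved (α s)) (M-even s x))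
    (moved-keep s _ λ _ _ i e _ _ → 2i≢2j+1 {x} {i} e)

  M-even-step : ∀ s x y → M s x ≡ 2 * y → M (suc s) x ≡ 2 * y
  M-even-step s x y e = trans (cong (moved (α s)) e)
    (moved-keep s _ λ _ _ i e _ _ → 2i≢2j+1 {y} {i} e)

  M-fresh : ∀ s i → s ≤ i → M s (2 * i + 1) ≡ 2 * i + 1
  M-fresh zero i _ = refl
  M-fresh (suc s) i s<i = trans (cong (moved (α s)) (M-fresh s i (<⇒≤ s<i)))
    (moved-keep s _ λ _ _ j e _ j<s → <-asym s<i (subst (_< s) (sym (odd-inj {i} {j} e)) j<s))

  -- Either z was never really moved, or its representative was the target of a collapse, and
  -- targets have halves below the stage.
  M-bound : ∀ s z → M s z ≡ z ⊎ half (M s z) < s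
  M-bound zero z = inj₁ refl
  M-bound (suc s) z with effect s | M s z ≟ src (α s)
  ... | removal n r p | yes e =
    inj₂ (subst (λ w → half w < suc s) (sym (moved-src e)) (≤-trans (Permitted.target p) (n≤1+n s)))
  ... | trivial p q | yes e rewrite moved-trivial {α s} (M s z) p q = keep (M-bound s z)
    where
    keep : M s z ≡ z ⊎ half (M s z) < s → M s z ≡ z ⊎ half (M s z) < suc s
    keep (inj₁ h) = inj₁ h
    keep (inj₂ h) = inj₂ (≤-trans h (n≤1+n s))
  ... | _ | no e rewrite moved-other {α s} e = keep (M-bound s z)
    where
    keep : M s z ≡ z ⊎ half (M s z) < s → M s z ≡ z ⊎ half (M s z) < suc s
    keep (inj₁ h) = inj₁ h
    keep (inj₂ h) = inj₂ (≤-trans h (n≤1+n s))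

  M-bounded : ∀ {s z} → z < s → half (M s z) < s
  M-bounded {s} {z} zlt with M-bound s z
  ... | inj₁ e = subst (λ w → half w < s) (sym e) (≤-trans (s≤s (half≤ z)) zlt)
  ... | inj₂ h = h

  -- Injuries, counts and restraints

  data View (n a : ℕ) : Set where
    injury : ∀ q → req a ≡ suc q → q < n → View n a
    own : req a ≡ suc n → View n a
    other : (∀ q → req a ≡ suc q → n < q) → View n a

  view : ∀ n a → View n a
  view n a with req a in e
  ... | zero = other λ q e′ → ⊥-elim (0≢1+n (trans (sym e) e′))
  ... | suc q with <-cmp q n
  ...   | tri< q<n _ _ = injury q e q<n
  ...   | tri≈ _ refl _ = own e
  ...   | tri> _ _ n<q = other λ q′ e′ → subst (n <_) (suc-injective (trans (sym e) e′)) n<q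

  injures-yes : ∀ {n a q} → req a ≡ suc q → q < n → injures n a ≡ true
  injures-yes e q<n rewrite e = <ᵇ-yes (s≤s q<n)

  injures-no : ∀ {n a} → (∀ q → req a ≡ suc q → n ≤ q) → injures n a ≡ false
  injures-no {n} {a} h with injures n a in e
  ... | false = refl
  ... | true with req a
  ...   | suc q = ⊥-elim (≤⇒≯ (h q refl) (s<s⁻¹ (<ᵇ-true (suc q) (suc n) e)))

  owns-no : ∀ {n a} → (∀ q → req a ≡ suc q → n < q) → owns n a ≡ false
  owns-no {n} h = ≡ᵇ-no λ e → <-irrefl refl (h n e)

  module _ {n s : ℕ} where
    own-≤ : req (α s) ≡ suc n → ∀ q → req (α s) ≡ suc q → n ≤ q
    own-≤ e q e′ = ≤-reflexive (suc-injective (trans (sym e) e′))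

    L-injury : ∀ {q} → req (α s) ≡ suc q → q < n → L n (suc s) ≡ suc s
    L-injury e q<n rewrite injures-yes {n} {α s} e q<n = refl

    C-injury : ∀ {q} → req (α s) ≡ suc q → q < n → C n (suc s) ≡ 0
    C-injury e q<n rewrite injures-yes {n} {α s} e q<n = refl

    L-same : (∀ q → req (α s) ≡ suc q → n ≤ q) → L n (suc s) ≡ L n s
    L-same h rewrite injures-no {n} {α s} h = refl

    C-own : req (α s) ≡ suc n → C n (suc s) ≡ suc (C n s)
    C-own e rewrite injures-no {n} {α s} (own-≤ e) | ≡ᵇ-yes e = refl

    C-other : (∀ q → req (α s) ≡ suc q → n < q) → C n (suc s) ≡ C n s
    C-other h rewrite injures-no {n} {α s} (λ q e → <⇒≤ (h q e)) | owns-no {n} {α s} h = refl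

    loc-other : ∀ i → (∀ q → req (α s) ≡ suc q → n < q) → loc α n i (suc s) ≡ loc α n i s
    loc-other i h rewrite owns-no {n} {α s} h = refl

    loc-old : ∀ i → i < C n s → loc α n i (suc s) ≡ loc α n i s
    loc-old i i<c rewrite ≡ᵇ-no (λ e → <-irrefl (sym e) i<c) with owns n (α s)
    ... | true = refl
    ... | false = refl

    loc-new : req (α s) ≡ suc n → loc α n (C n s) (suc s) ≡ s
    loc-new e rewrite ≡ᵇ-yes e | ≡ᵇ-yes {C n s} refl = refl

  L≤ : ∀ n s → L n s ≤ s
  L≤ n zero = z≤n
  L≤ n (suc s) with injures n (α s)
  ... | true = ≤-refl
  ... | false = ≤-trans (L≤ n s) (n≤1+n s)

  L-mono : ∀ n s → L n s ≤ L n (suc s)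
  L-mono n s with injures n (α s)
  ... | true = ≤-trans (L≤ n s) (n≤1+n s)
  ... | false = ≤-refl

  C≤ : ∀ n s → C n s ≤ s
  C≤ n zero = z≤n
  C≤ n (suc s) with injures n (α s) | owns n (α s)
  ... | true | _ = z≤n
  ... | false | true = s≤s (C≤ n s)
  ... | false | false = ≤-trans (C≤ n s) (n≤1+n s)

  -- Whatever injures n injures every later requirement at the same stage.
  L-mono-req : ∀ {n m} → n ≤ m → ∀ s → L n s ≤ L m s
  L-mono-req n≤m zero = z≤n
  L-mono-req {n} {m} n≤m (suc s) with view n (α s)
  ... | injury q e q<n = ≤-reflexive (trans (L-injury e q<n) (sym (L-injury e (≤-trans q<n n≤m))))
  ... | own e = ≤-trans (≤-reflexive (L-same (own-≤ e))) (≤-trans (L-mono-req n≤m s) (L-mono m s))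
  ... | other h = ≤-trans (≤-reflexive (L-same (λ q e → <⇒≤ (h q e)))) (≤-trans (L-mono-req n≤m s) (L-mono m s))

  -- Requirements from n on may only remove representatives above the pole of n, and an injury moves it to an
  -- unused number; the final poles are the sites below.
  pole : ℕ → ℕ → ℕ
  pole n s = 2 * (L n s + n) + 1

  M-pole : ∀ n s → M s (pole n s) ≡ pole n s
  M-pole n zero = refl
  M-pole n (suc s) with view n (α s)
  ... | injury q e q<n rewrite L-injury {n} {s} e q<n = M-fresh (suc s) (suc s + n) (m≤m+n _ n)
  ... | own e rewrite L-same {n} {s} (own-≤ e) = trans (cong (moved (α s)) (M-pole n s))
    (moved-keep s _ λ m e′ i e″ low _ → <-irrefl refl (≤-<-trans
      (+-mono-≤ (L-mono-req (own-≤ e m e′) s) (own-≤ e m e′))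
      (subst (L m s + m <_) (sym (odd-inj {L n s + n} {i} e″)) low)))
  ... | other h rewrite L-same {n} {s} (λ q e → <⇒≤ (h q e)) = trans (cong (moved (α s)) (M-pole n s))
    (moved-keep s _ λ m e′ i e″ low _ → <-irrefl refl (≤-<-trans
      (+-mono-≤ (L-mono-req (<⇒≤ (h m e′)) s) (<⇒≤ (h m e′)))
      (subst (L m s + m <_) (sym (odd-inj {L n s + n} {i} e″)) low)))

  module Verification (em : ∀ {P : Set} → Dec P) (isA : IsEquivalence A) (isD : IsEquivalence D) (D≰B : ¬ (D ≤ᶜ B)) where
    module A≈ = IsEquivalence isA
    module D≈ = IsEquivalence isD

    mark-inj : ∀ {n τ τ′} → mark n τ ≡ mark n τ′ → τ ≡ τ′
    mark-inj {n} {τ} {τ′} e = +-cancelʳ-≡ (suc n) τ τ′ (odd-inj {τ + suc n} {τ′ + suc n} e)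

    -- The i-th coding location is represented by the i′-th one for some i′ D-equivalent to i; as different locations
    -- are different numbers, E induces no more than D on them.
    record Coded (n s i : ℕ) : Set where
      constructor coded
      field
        lo : L n s ≤ loc α n i s
        hi : loc α n i s < L (suc n) s
        distinct : ∀ j → j < C n s → loc α n i s ≡ loc α n j s → i ≡ j
        i′ : ℕ
        i′<c : i′ < C n s
        image : M s (markOf n i s) ≡ markOf n i′ s
        same : D i i′

    opaque
      coding : ∀ {n} → fst n ≢ 0 → ∀ s i → i < C n s → Coded n s i
      coding {n} n≢ (suc s) i i<c with view n (α s)
      ... | injury q e q<n = ⊥-elim (n≮0 (subst (i <_) (C-injury e q<n) i<c))
      ... | other h = coded
        (subst₂ _≤_ (sym (L-same (λ q e → <⇒≤ (h q e)))) (sym (loc≡ i)) lo)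
        (subst (_< L (suc n) (suc s)) (sym (loc≡ i)) (≤-trans hi (L-mono (suc n) s)))
        (λ j j<c e → distinct j (subst (j <_) (C-other h) j<c) (trans (sym (loc≡ i)) (trans e (loc≡ j))))
        i′ (subst (i′ <_) (sym (C-other h)) i′<c)
        (trans (cong (λ τ → M (suc s) (mark n τ)) (loc≡ i))
          (trans (cong (moved (α s)) image)
            (trans (moved-keep s _ unharmed) (sym (cong (mark n) (loc≡ i′)))))) same
        where
        loc≡ : ∀ j → loc α n j (suc s) ≡ loc α n j s
        loc≡ j = loc-other j h
        open Coded (coding n≢ s i (subst (i <_) (C-other h) i<c))
        unharmed : ∀ q → req (α s) ≡ suc q → ∀ k → markOf n i′ s ≡ 2 * k + 1 → L q s + q < k → k < s → ⊥
        unharmed q e k e′ low _ = <-irrefl refl (<-trans low (subst (_< L q s + q)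
          (odd-inj {loc α n i′ s + suc n} {k} e′)
          (+-mono-<-≤ (≤-trans (Coded.hi (coding n≢ s i′ i′<c)) (L-mono-req (h q e) s)) (h q e))))
      ... | own e with m≤n⇒m<n∨m≡n (s≤s⁻¹ (subst (i <_) (C-own e) i<c))
      ...   | inj₂ refl = coded
        (subst₂ _≤_ (sym L≡) (sym (loc-new e)) (L≤ n s))
        (subst₂ _<_ (sym (loc-new e)) (sym (L-injury e (n<1+n n))) (n<1+n s))
        dist i i<c (trans (cong (λ τ → M (suc s) (mark n τ)) (loc-new e))
          (trans (cong (moved (α s)) (M-fresh s (s + suc n) (m≤m+n s _)))
            (trans (moved-keep s _ fresh) (sym (cong (mark n) (loc-new e)))))) D≈.refl
        where
        L≡ : L n (suc s) ≡ L n s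
        L≡ = L-same (own-≤ e)
        fresh : ∀ q → req (α s) ≡ suc q → ∀ k → mark n s ≡ 2 * k + 1 → L q s + q < k → k < s → ⊥
        fresh _ _ k e′ _ k<s = <-irrefl (sym (odd-inj {s + suc n} {k} e′)) (≤-trans k<s (m≤m+n s _))
        dist : ∀ j → j < C n (suc s) → loc α n (C n s) (suc s) ≡ loc α n j (suc s) → C n s ≡ j
        dist j j<c e′ with m≤n⇒m<n∨m≡n (s≤s⁻¹ (subst (j <_) (C-own e) j<c))
        ... | inj₂ e″ = sym e″
        ... | inj₁ j<c′ = ⊥-elim (<-irrefl (trans (sym (loc-old {n} {s} j j<c′)) (trans (sym e′) (loc-new e)))
                           (≤-trans (Coded.hi (coding n≢ s j j<c′)) (L≤ (suc n) s)))
      ...   | inj₁ i<c′ = build (move s)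
        where
        open Coded (coding n≢ s i i<c′)
        L≡ : L n (suc s) ≡ L n s
        L≡ = L-same (own-≤ e)
        grow : ∀ {j} → j < C n s → j < C n (suc s)
        grow j<c = subst (_ <_) (sym (C-own e)) (≤-trans j<c (n≤1+n _))
        lo′ : L n (suc s) ≤ loc α n i (suc s)
        lo′ = subst₂ _≤_ (sym L≡) (sym (loc-old {n} {s} i i<c′)) lo
        hi′ : loc α n i (suc s) < L (suc n) (suc s)
        hi′ = subst (_< L (suc n) (suc s)) (sym (loc-old {n} {s} i i<c′)) (≤-trans hi (L-mono (suc n) s))
        dist : ∀ j → j < C n (suc s) → loc α n i (suc s) ≡ loc α n j (suc s) → i ≡ j
        dist j j<c e′ with m≤n⇒m<n∨m≡n (s≤s⁻¹ (subst (j <_) (C-own e) j<c))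
        ... | inj₁ j<c′ = distinct j j<c′ (trans (sym (loc-old {n} {s} i i<c′)) (trans e′ (loc-old {n} {s} j j<c′)))
        ... | inj₂ refl = ⊥-elim (<-irrefl (trans (sym (loc-old {n} {s} i i<c′)) (trans e′ (loc-new e)))
                                           (≤-trans hi (L≤ (suc n) s)))
        finish : ∀ k → k < C n s → moved (α s) (markOf n i′ s) ≡ markOf n k s → D i k → Coded n (suc s) i
        finish k k<c m d = coded lo′ hi′ dist k (grow k<c)
          (trans (cong (λ τ → M (suc s) (mark n τ)) (loc-old {n} {s} i i<c′))
            (trans (cong (moved (α s)) image) (trans m (sym (cong (mark n) (loc-old {n} {s} k k<c)))))) d
        build : Move s (α s) → Coded n (suc s) i
        build (idle r _ _) = ⊥-elim (0≢1+n (trans (sym r) e))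
        build (meet n≡ r _ _ _ _ _ _) = ⊥-elim (n≢ (subst (λ m → fst m ≡ 0) (suc-injective (trans (sym r) e)) n≡))
        build (wait _ _ _ p q) = finish i′ i′<c (moved-trivial _ p q) same
        build (join _ r _ c) with refl ← suc-injective (trans (sym r) e) = joined c
          where
          joined : Collapse s (fst s) (src (α s)) (tgt (α s)) → Coded n (suc s) i
          joined (collapse a<c b<c here w≡ v≡ _) with markOf n i′ s ≟ src (α s)
          ... | no ne = finish i′ i′<c (moved-other ne) same
          -- The removed image is that of the location `at₃`, so i′ = b.i′ by distinctness. The new
          -- image stays in the D-class of i along i, i′ = b.i′, `at₃`, `at₂`, a.i′; the link
          -- between the last two locations is the pair of D being coded.
          ... | yes eq = finish a.i′ a.i′<c (trans (moved-src eq) (trans v≡ a.image))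
                  (D≈.trans same (D≈.trans (subst (λ k → D k b.i′) b′≡i′ D≈.refl)
                    (D≈.trans (D≈.sym b.same) (D≈.trans (D≈.sym (Staged.holds SD here)) a.same))))
            where
            module a = Coded (coding n≢ s _ a<c)
            module b = Coded (coding n≢ s _ b<c)
            b′≡i′ : b.i′ ≡ i′
            b′≡i′ = Coded.distinct (coding n≢ s b.i′ b.i′<c) i′ i′<c
                      (mark-inj {n} (trans (sym b.image) (trans (sym w≡) (sym eq))))

    -- The limit relation and its enumeration

    Q : ℕ → ℕ → Set
    Q u v = u ≡ v ⊎ (∃ λ a → ∃ λ b → u ≡ 2 * a × v ≡ 2 * b × A a b)

    E : ℕ → ℕ → Set
    E x y = ∃ λ s → Q (M s x) (M s y)

    Q-refl : ∀ {u} → Q u u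
    Q-refl = inj₁ refl

    Q-sym : ∀ {u v} → Q u v → Q v u
    Q-sym (inj₁ e) = inj₁ (sym e)
    Q-sym (inj₂ (a , b , e , e′ , h)) = inj₂ (b , a , e′ , e , A≈.sym h)

    Q-trans : ∀ {u v w} → Q u v → Q v w → Q u w
    Q-trans (inj₁ refl) q = q
    Q-trans p@(inj₂ _) (inj₁ refl) = p
    Q-trans (inj₂ (a , b , e , e′ , h)) (inj₂ (b′ , c , e″ , e‴ , h′)) =
      inj₂ (a , c , e , e‴ , A≈.trans h (subst (λ w → A w c) (2*-inj {b′} {b} (trans (sym e″) e′)) h′))

    -- Equal representatives move together, and even ones never move.
    Q-suc : ∀ s {x y} → Q (M s x) (M s y) → Q (M (suc s) x) (M (suc s) y)
    Q-suc s (inj₁ e) = inj₁ (cong (moved (α s)) e)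
    Q-suc s {x} {y} (inj₂ (a , b , e , e′ , h)) = inj₂ (a , b , M-even-step s x a e , M-even-step s y b e′ , h)

    Q-mono : ∀ {s s′ x y} → s ≤ s′ → Q (M s x) (M s y) → Q (M s′ x) (M s′ y)
    Q-mono {s} {s′} {x} {y} s≤s′ q = subst (λ r → Q (M r x) (M r y)) (m∸n+n≡m s≤s′) (go (s′ ∸ s))
      where
      go : ∀ k → Q (M (k + s) x) (M (k + s) y)
      go zero = q
      go (suc k) = Q-suc (k + s) (go k)

    E-refl : ∀ {x} → E x x
    E-refl = 0 , Q-refl

    E-sym : ∀ {x y} → E x y → E y x
    E-sym (s , q) = s , Q-sym q

    E-trans : ∀ {x y z} → E x y → E y z → E x z
    E-trans (s , q) (s′ , q′) = s ⊔ s′ , Q-trans (Q-mono (m≤m⊔n s s′) q) (Q-mono (m≤n⊔m s s′) q′)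

    E-later : ∀ {x y} s → E x y → ∃ λ s′ → s ≤ s′ × Q (M s′ x) (M s′ y)
    E-later s (s′ , q) = s ⊔ s′ , m≤m⊔n s s′ , Q-mono (m≤n⊔m s s′) q

    E-equiv : IsEquivalence E
    E-equiv = record { refl = E-refl ; sym = E-sym ; trans = E-trans }

    M-even-later : ∀ {s s′ x a} → s ≤ s′ → M s x ≡ 2 * a → M s′ x ≡ 2 * a
    M-even-later {s} {s′} {x} {a} s≤s′ e = subst (λ r → M r x ≡ 2 * a) (m∸n+n≡m s≤s′) (go (s′ ∸ s))
      where
      go : ∀ k → M (k + s) x ≡ 2 * a
      go zero = e
      go (suc k) = M-even-step (k + s) x a (go k)

    M-equal-later : ∀ {s s′ x y} → s ≤ s′ → M s x ≡ M s y → M s′ x ≡ M s′ y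
    M-equal-later {s} {s′} {x} {y} s≤s′ e = subst (λ r → M r x ≡ M r y) (m∸n+n≡m s≤s′) (go (s′ ∸ s))
      where
      go : ∀ k → M (k + s) x ≡ M (k + s) y
      go zero = e
      go (suc k) = cong (moved (α (k + s))) (go k)

    E-stage : ℕ → ℕ → ℕ → Bool
    E-stage s x y = related s (M s x) (M s y)

    E-holds : ∀ {s x y} → E-stage s x y ≡ true → E x y
    E-holds {s} h with related-inv s h
    ... | inj₁ e = s , inj₁ e
    ... | inj₂ (a , b , e , e′ , h′) = s , inj₂ (a , b , e , e′ , Staged.holds SA h′)

    E-mono : ∀ {s s′ x y} → s ≤ s′ → E-stage s x y ≡ true → E-stage s′ x y ≡ true
    E-mono {s} {s′} {x} {y} s≤s′ h with related-inv s h
    ... | inj₁ e = related-equal s′ (M-equal-later {s} {s′} {x} {y} s≤s′ e)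
    ... | inj₂ (a , b , e , e′ , h′) = subst₂ (λ u v → related s′ u v ≡ true)
      (sym (M-even-later {s} {s′} {x} {a} s≤s′ e)) (sym (M-even-later {s} {s′} {y} {b} s≤s′ e′))
      (related-even s′ (Staged.mono SA s≤s′ h′))

    E-appears : ∀ {x y} → E x y → ∃ λ s → E-stage s x y ≡ true
    E-appears (s , inj₁ e) = s , related-equal s e
    E-appears {x} {y} (s , inj₂ (a , b , e , e′ , h)) with Staged.appears SA h
    ... | s₁ , h′ = s ⊔ s₁ , subst₂ (λ u v → related (s ⊔ s₁) u v ≡ true)
      (sym (M-even-later {s} {s ⊔ s₁} {x} {a} (m≤m⊔n s s₁) e))
      (sym (M-even-later {s} {s ⊔ s₁} {y} {b} (m≤m⊔n s s₁) e′))
      (related-even (s ⊔ s₁) (Staged.mono SA (m≤n⊔m s s₁) h′))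

    E-staged : Staged E
    E-staged = record
      { stage = E-stage
      ; c-stage = λ a b c → c-related a (c-α-rep a b) (c-α-rep a c)
      ; mono = λ {s} {s′} {x} {y} → E-mono {s} {s′} {x} {y}
      ; holds = λ {s} {x} {y} → E-holds {s} {x} {y}
      ; appears = E-appears
      }

    Quiet : ℕ → ℕ → Set
    Quiet n s₀ = ∀ s → s₀ ≤ s → ∀ q → req (α s) ≡ suc q → n ≤ q

    φ-det : ∀ {e x s s′ v w} → φ e x s ≡ suc v → φ e x s′ ≡ suc w → v ≡ w
    φ-det {s = s} {s′} p q = suc-injective (trans (sym (φ-mono (m≤m⊔n s s′) p)) (φ-mono (m≤n⊔m s s′) q))

    opaque
      agreement : ∀ {s n} → Agreement s n → ∃ λ u → ∃ λ v →
        φ (snd n) (C n s at₀) s ≡ suc u × φ (snd n) (C n s at₁) s ≡ suc v ×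
        related s (M s (C n s at₀)) (M s (C n s at₁)) ≡ stageB s u v
      agreement {s} {n} h with φ (snd n) (C n s at₀) s | φ (snd n) (C n s at₁) s
      ... | suc u | suc v = u , v , refl , refl , ≡b-true h

    code₅ : ℕ → ℕ → ℕ → ℕ → ℕ → ℕ
    code₅ x y i j ρ = pair x (pair y (pair i (pair j ρ)))

    module _ (x y i j ρ : ℕ) where
      private
        k = code₅ x y i j ρ
      code₅-0 : k at₀ ≡ x
      code₅-0 = fst-pair _ _
      code₅-1 : k at₁ ≡ y
      code₅-1 = trans (cong fst (snd-pair _ _)) (fst-pair _ _)
      code₅-2 : k at₂ ≡ i
      code₅-2 = trans (cong (fst ∘ snd) (snd-pair _ _)) (trans (cong fst (snd-pair _ _)) (fst-pair _ _))
      code₅-3 : k at₃ ≡ j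
      code₅-3 = trans (cong (fst ∘ snd ∘ snd) (snd-pair _ _)) (trans (cong (fst ∘ snd) (snd-pair _ _))
                (trans (cong fst (snd-pair _ _)) (fst-pair _ _)))
      code₅-rest : k rest ≡ ρ
      code₅-rest = trans (cong (snd ∘ snd ∘ snd) (snd-pair _ _)) (trans (cong (snd ∘ snd) (snd-pair _ _))
                (trans (cong snd (snd-pair _ _)) (snd-pair _ _)))
      code₅-≥ : ρ ≤ k
      code₅-≥ = ≤-trans (pair-≥₂ j ρ) (≤-trans (pair-≥₂ i _) (≤-trans (pair-≥₂ y _) (pair-≥₂ x _)))

    -- A requirement of the second kind cannot act infinitely often

    module Infinite {n s₀ : ℕ} (n≢ : fst n ≢ 0) (quiet : Quiet n s₀)
                    (infinite : ∀ s → s₀ ≤ s → ∃ λ t → s ≤ t × req (α t) ≡ suc n) where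

      calm : ∀ {s} → s₀ ≤ s → (req (α s) ≡ suc n) ⊎ (∀ q → req (α s) ≡ suc q → n < q)
      calm {s} s₀≤s with view n (α s)
      ... | injury q e q<n = ⊥-elim (<⇒≱ q<n (quiet s s₀≤s q e))
      ... | own e = inj₁ e
      ... | other h = inj₂ h

      C-suc-≤ : ∀ {s} → s₀ ≤ s → C n s ≤ C n (suc s)
      C-suc-≤ {s} s₀≤s with calm s₀≤s
      ... | inj₁ e = subst (C n s ≤_) (sym (C-own e)) (n≤1+n _)
      ... | inj₂ h = ≤-reflexive (sym (C-other h))

      C-+-≤ : ∀ {s} → s₀ ≤ s → ∀ k → C n s ≤ C n (k + s)
      C-+-≤ s₀≤s zero = ≤-refl
      C-+-≤ {s} s₀≤s (suc k) = ≤-trans (C-+-≤ s₀≤s k) (C-suc-≤ (≤-trans s₀≤s (m≤n+m s k)))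

      C-mono : ∀ {s s′} → s₀ ≤ s → s ≤ s′ → C n s ≤ C n s′
      C-mono {s} {s′} s₀≤s s≤s′ = subst (λ r → C n s ≤ C n r) (m∸n+n≡m s≤s′) (C-+-≤ s₀≤s (s′ ∸ s))

      opaque
        unbounded : ∀ k → ∃ λ s → s₀ ≤ s × k ≤ C n s
        unbounded zero = s₀ , ≤-refl , z≤n
        unbounded (suc k) =
          let s , s₀≤s , k≤c = unbounded k ; t , s≤t , e = infinite s s₀≤s ; s₀≤t = ≤-trans s₀≤s s≤t in
          suc t , ≤-trans s₀≤t (n≤1+n t) , subst (suc k ≤_) (sym (C-own e)) (s≤s (≤-trans k≤c (C-mono s₀≤s s≤t)))

      opaque
        -- A discrete intermediate value argument: after s₀ the count rises by at most one per
        -- stage, and only when the requirement acts.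
        hit : ∀ d {s k} → s₀ ≤ s → C n s ≤ k → k < C n (d + s) → ∃ λ t → s₀ ≤ t × C n t ≡ k × req (α t) ≡ suc n
        hit zero s₀≤s c≤k k<c = ⊥-elim (<⇒≱ k<c c≤k)
        hit (suc d) {s} {k} s₀≤s c≤k k<c with calm s₀≤s
        ... | inj₂ h = hit d (≤-trans s₀≤s (n≤1+n s)) (subst (_≤ k) (sym (C-other h)) c≤k)
                           (subst (λ r → k < C n r) (sym (+-suc d s)) k<c)
        ... | inj₁ e with m≤n⇒m<n∨m≡n c≤k
        ...   | inj₂ c≡k = s , s₀≤s , c≡k , e
        ...   | inj₁ c<k = hit d (≤-trans s₀≤s (n≤1+n s)) (subst (_≤ k) (sym (C-own e)) c<k)
                               (subst (λ r → k < C n r) (sym (+-suc d s)) k<c)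

      opaque
        expansion : ∀ k → C n s₀ ≤ k → ∃ λ t → s₀ ≤ t × C n t ≡ k × req (α t) ≡ suc n
        expansion k c≤k with unbounded (suc k)
        ... | s , s₀≤s , k<c = hit (s ∸ s₀) ≤-refl c≤k (subst (λ r → k < C n r) (sym (m∸n+n≡m s₀≤s)) k<c)

      opaque
        owner : ∀ {t} → req (α t) ≡ suc n → fst t ≡ n × Agreement t n
        owner {t} e with move t
        ... | idle r _ _ = ⊥-elim (0≢1+n (trans (sym r) e))
        ... | meet n≡ r _ _ _ _ _ _ = ⊥-elim (n≢ (subst (λ m → fst m ≡ 0) (suc-injective (trans (sym r) e)) n≡))
        ... | wait _ r a _ _ with refl ← suc-injective (trans (sym r) e) = refl , a
        ... | join _ r a _ with refl ← suc-injective (trans (sym r) e) = refl , a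

      -- The k-th action of requirement n tests φ on the pair coded by k, and every pair has arbitrarily large codes.
      opaque
        tested : ∀ x y i j ρ → ∃ λ t → s₀ ≤ t × ρ ≤ t × fst t ≡ n × Agreement t n × ρ ≤ C n t ×
                 C n t at₀ ≡ x × C n t at₁ ≡ y × C n t at₂ ≡ i × C n t at₃ ≡ j × ρ ≤ C n t rest
        tested x y i j ρ with expansion (code₅ x y i j (ρ ⊔ C n s₀))
                                (≤-trans (m≤n⊔m ρ _) (code₅-≥ x y i j _))
        ... | t , s₀≤t , c≡ , e = t , s₀≤t , ≤-trans ρ≤c (C≤ n t) , proj₁ (owner e) , proj₂ (owner e) , ρ≤c ,
          trans (cong _at₀ c≡) (code₅-0 x y i j _) , trans (cong _at₁ c≡) (code₅-1 x y i j _) ,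
          trans (cong _at₂ c≡) (code₅-2 x y i j _) , trans (cong _at₃ c≡) (code₅-3 x y i j _) ,
          subst (ρ ≤_) (sym (trans (cong _rest c≡) (code₅-rest x y i j _))) (m≤m⊔n ρ _)
          where
          ρ≤c : ρ ≤ C n t
          ρ≤c = subst (ρ ≤_) (sym c≡) (≤-trans (m≤m⊔n ρ _) (code₅-≥ x y i j _))

      opaque
        halts : ∀ x → ∃ λ s → (0 <ᵇ φ (snd n) x s) ≡ true
        halts x with tested x x 0 0 0
        ... | t , _ , _ , _ , a , _ , x≡ , _ with agreement {t} {n} a
        ... | u , _ , p , _ = t , cong (0 <ᵇ_) (subst (λ w → φ (snd n) w t ≡ suc u) x≡ p)

      opaque
        time : Σ (ℕ → ℕ) λ g → Op₁ g × (∀ x → (0 <ᵇ φ (snd n) x (g x)) ≡ true)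
        time = c-search {λ s x → 0 <ᵇ φ (snd n) x s} (λ a b → c-<ᵇ (c-const 0) (c-φ (c-const (snd n)) b a)) halts

      f : ℕ → ℕ
      f x = pred (φ (snd n) x (proj₁ time x))

      c-f : Op₁ f
      c-f a = c-pred (c-φ (c-const (snd n)) a (proj₁ (proj₂ time) a))

      opaque
        f-value : ∀ {x s v} → φ (snd n) x s ≡ suc v → v ≡ f x
        f-value {x} p with φ (snd n) x (proj₁ time x) in e | proj₂ (proj₂ time) x
        ... | suc w | _ = φ-det p e

      opaque
        -- Both approximations increase, so agreement at arbitrarily late stages gives both
        -- directions of the reduction: a pair seen on one side by stage ρ is seen on the other at
        -- t.
        correct : ∀ x y ρ → ∃ λ t → ρ ≤ t × related t (M t x) (M t y) ≡ stageB t (f x) (f y)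
        correct x y ρ with tested x y 0 0 ρ
        ... | t , _ , ρ≤t , _ , a , _ , x≡ , y≡ , _ with agreement {t} {n} a
        ... | u , v , p , q , r = t , ρ≤t , subst₂ (λ u v → related t (M t x) (M t y) ≡ stageB t u v)
          (f-value (subst (λ w → φ (snd n) w t ≡ suc u) x≡ p)) (f-value (subst (λ w → φ (snd n) w t ≡ suc v) y≡ q))
          (subst₂ (λ x′ y′ → related t (M t x′) (M t y′) ≡ stageB t u v) x≡ y≡ r)

      E⇒B : ∀ {x y} → E x y → B (f x) (f y)
      E⇒B {x} {y} h with E-appears h
      ... | s , h′ with correct x y s
      ... | t , s≤t , r = Staged.holds SB (trans (sym r) (E-mono {s} {t} {x} {y} s≤t h′))

      B⇒E : ∀ {x y} → B (f x) (f y) → E x y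
      B⇒E {x} {y} h with Staged.appears SB h
      ... | s , h′ with correct x y s
      ... | t , s≤t , r = E-holds {t} {x} {y} (trans r (Staged.mono SB s≤t h′))

      stable : ∀ {i s} → s₀ ≤ s → i < C n s → ∀ k → loc α n i (k + s) ≡ loc α n i s
      stable s₀≤s i<c zero = refl
      stable {i} {s} s₀≤s i<c (suc k) =
        trans (loc-old {n} {k + s} i (≤-trans i<c (C-+-≤ s₀≤s k))) (stable s₀≤s i<c k)

      stable-≤ : ∀ {i s s′} → s₀ ≤ s → i < C n s → s ≤ s′ → markOf n i s′ ≡ markOf n i s
      stable-≤ {i} {s} {s′} s₀≤s i<c s≤s′ = cong (mark n)
        (trans (cong (loc α n i) (sym (m∸n+n≡m s≤s′))) (stable s₀≤s i<c (s′ ∸ s)))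

      opaque
        index : Σ (ℕ → ℕ) λ g → Op₁ g × (∀ i → ((s₀ <ᵇ suc (g i)) ∧ (i <ᵇ C n (g i))) ≡ true)
        index = c-search {λ s i → (s₀ <ᵇ suc s) ∧ (i <ᵇ C n s)}
          (λ a b → c-∧ (c-<ᵇ (c-const s₀) (c-suc a)) (c-<ᵇ b (c-α-count (c-const n) a)))
          (λ i → let s , s₀≤s , i<c = unbounded (suc i) in s , ∧-yes (<ᵇ-yes (s≤s s₀≤s)) (<ᵇ-yes i<c))

      d : ℕ → ℕ
      d i = markOf n i (proj₁ index i)

      c-d : Op₁ d
      c-d a = c-mark (c-const n) (c-α-loc (c-const n) a (proj₁ (proj₂ index) a))

      opaque
        d-ready : ∀ i → s₀ ≤ proj₁ index i × i < C n (proj₁ index i)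
        d-ready i = let p , q = ∧-true (proj₂ (proj₂ index) i) in
          s≤s⁻¹ (<ᵇ-true s₀ (suc (proj₁ index i)) p) , <ᵇ-true _ _ q

      d-mark : ∀ {i s} → proj₁ index i ≤ s → d i ≡ markOf n i s
      d-mark {i} le = sym (stable-≤ (proj₁ (d-ready i)) (proj₂ (d-ready i)) le)

      opaque
        D⇒E : ∀ {i j} → D i j → E (d i) (d j)
        D⇒E {i} {j} h = joinedAt (tested 0 0 i j bound)
          where
          first : ∃ λ s → stageD s i j ≡ true
          first = Staged.appears SD h
          bound : ℕ
          -- One number above all that stage t has to exceed: the appearance of the pair in D, the
          -- counts that open locations i and j, the stages that locate them, and the two marks
          -- themselves.
          bound = proj₁ first + (suc i + (suc j + (proj₁ index i + (proj₁ index j + (suc (d i) + suc (d j))))))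
          b₁ : bound ≥ suc i + (suc j + (proj₁ index i + (proj₁ index j + (suc (d i) + suc (d j)))))
          b₁ = m≤n+m _ (proj₁ first)
          b₂ : bound ≥ suc j + (proj₁ index i + (proj₁ index j + (suc (d i) + suc (d j))))
          b₂ = ≤-trans (m≤n+m _ (suc i)) b₁
          b₃ : bound ≥ proj₁ index i + (proj₁ index j + (suc (d i) + suc (d j)))
          b₃ = ≤-trans (m≤n+m _ (suc j)) b₂
          b₄ : bound ≥ proj₁ index j + (suc (d i) + suc (d j))
          b₄ = ≤-trans (m≤n+m _ (proj₁ index i)) b₃
          b₅ : bound ≥ suc (d i) + suc (d j)
          b₅ = ≤-trans (m≤n+m _ (proj₁ index j)) b₄
          joinedAt : (∃ λ t → s₀ ≤ t × bound ≤ t × fst t ≡ n × Agreement t n × bound ≤ C n t ×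
            C n t at₀ ≡ 0 × C n t at₁ ≡ 0 × C n t at₂ ≡ i × C n t at₃ ≡ j × bound ≤ C n t rest) → E (d i) (d j)
          joinedAt (t , s₀≤t , b≤t , refl , a , b≤c , _ , _ , i≡ , j≡ , b≤ρ) = suc t , inj₁ merged
            where
            dᵢ : d i ≡ markOf n i t
            dᵢ = d-mark (≤-trans (≤-trans (m≤m+n _ _) b₃) b≤t)
            dⱼ : d j ≡ markOf n j t
            dⱼ = d-mark (≤-trans (≤-trans (m≤m+n _ _) b₄) b≤t)
            i<c : i < C n t
            i<c = ≤-trans (≤-trans (m≤m+n _ _) b₁) b≤c
            j<c : j < C n t
            j<c = ≤-trans (≤-trans (m≤m+n _ _) b₂) b≤c
            dᵢ<t : markOf n i t < t
            dᵢ<t = subst (_< t) dᵢ (≤-trans (≤-trans (m≤m+n _ _) b₅) b≤t)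
            dⱼ<t : markOf n j t < t
            dⱼ<t = subst (_< t) dⱼ (≤-trans (≤-trans (m≤n+m _ (suc (d i))) b₅) b≤t)
            module cᵢ = Coded (coding n≢ t i i<c)
            module cⱼ = Coded (coding n≢ t j j<c)
            module c′ = Coded (coding n≢ t cⱼ.i′ cⱼ.i′<c)
            w v : ℕ
            w = M t (markOf n j t)
            v = M t (markOf n i t)
            k : ℕ
            k = loc α n cⱼ.i′ t + suc n
            perm : Permitted t n w v
            -- The offset `suc n` in `mark` is what lifts the mark strictly above the requirement's
            -- own restraint L + n.
            perm = permit k cⱼ.image (+-mono-≤-< c′.lo (n<1+n n))
                     (subst (_< t) (trans (cong half cⱼ.image) (half-odd k)) (M-bounded dⱼ<t)) (M-bounded dᵢ<t)
            ready : Collapse t n w v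
            ready = collapse (subst (_< C n t) (sym i≡) i<c) (subst (_< C n t) (sym j≡) j<c)
              (subst₂ (λ i j → stageD (C n t rest) i j ≡ true) (sym i≡) (sym j≡)
                (Staged.mono SD (≤-trans (≤-trans (m≤m+n _ _) ≤-refl) b≤ρ) (proj₂ first)))
              (cong (λ j → M t (markOf n j t)) (sym j≡)) (cong (λ i → M t (markOf n i t)) (sym i≡)) perm
            done : src (α t) ≡ w × tgt (α t) ≡ v
            done = joins n≢ a ready
            -- If the two locations have already merged, v is itself the source, and it is sent to
            -- v.
            to-v : moved (α t) v ≡ v
            to-v with v ≟ src (α t)
            ... | yes e = trans (moved-src e) (proj₂ done)
            ... | no e = moved-other e
            merged : M (suc t) (d i) ≡ M (suc t) (d j)
            merged = trans (cong (M (suc t)) dᵢ) (trans to-v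
              (sym (trans (cong (M (suc t)) dⱼ) (trans (moved-src (sym (proj₁ done))) (proj₂ done)))))

      opaque
        E⇒D : ∀ {i j} → E (d i) (d j) → D i j
        E⇒D {i} {j} h with E-later (proj₁ index i ⊔ proj₁ index j) h
        ... | s , le , q = conclude (subst₂ Q (image-at cᵢ.image iᵢ) (image-at cⱼ.image iⱼ) q)
          where
          iᵢ : proj₁ index i ≤ s
          iᵢ = ≤-trans (m≤m⊔n _ _) le
          iⱼ : proj₁ index j ≤ s
          iⱼ = ≤-trans (m≤n⊔m (proj₁ index i) _) le
          module cᵢ = Coded (coding n≢ s i (≤-trans (proj₂ (d-ready i)) (C-mono (proj₁ (d-ready i)) iᵢ)))
          module cⱼ = Coded (coding n≢ s j (≤-trans (proj₂ (d-ready j)) (C-mono (proj₁ (d-ready j)) iⱼ)))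
          image-at : ∀ {k w} → M s (markOf n k s) ≡ w → proj₁ index k ≤ s → M s (d k) ≡ w
          image-at e le = trans (cong (M s) (d-mark le)) e
          conclude : Q (markOf n cᵢ.i′ s) (markOf n cⱼ.i′ s) → D i j
          conclude (inj₁ e) = D≈.trans cᵢ.same (D≈.trans (subst (D cᵢ.i′)
            (Coded.distinct (coding n≢ s _ cᵢ.i′<c) _ cⱼ.i′<c (mark-inj {n} e)) D≈.refl) (D≈.sym cⱼ.same))
          conclude (inj₂ (a , b , e , _)) = ⊥-elim (2i≢2j+1 {a} {loc α n cᵢ.i′ s + suc n} (sym e))

      impossible : ⊥
      impossible = D≰B ((λ i → f (d i)) , toComputable {λ i → f (d i)} (λ a → c-f (c-d a)) ,
                        λ i j → mk⇔ (λ h → E⇒B (D⇒E h)) (λ h → E⇒D (B⇒E h)))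

    -- Finite injury and the surviving odd classes

    not-empty : ∀ {P : Set} → ¬ ¬ P → P
    not-empty {P} nn with em {P}
    ... | yes p = p
    ... | no ¬p = ⊥-elim (nn ¬p)

    C-positive : ∀ {n s₀} → Quiet n s₀ → ∀ {s} → s₀ ≤ s → 0 < C n s → ∀ k → 0 < C n (k + s)
    C-positive quiet s₀≤s c>0 zero = c>0
    C-positive {n} {s₀} quiet {s} s₀≤s c>0 (suc k) with view n (α (k + s)) | C-positive quiet s₀≤s c>0 k
    ... | injury q e q<n | _ = ⊥-elim (<⇒≱ q<n (quiet _ (≤-trans s₀≤s (m≤n+m s k)) q e))
    ... | own e | _ = subst (0 <_) (sym (C-own e)) (s≤s z≤n)
    ... | other h | c = subst (0 <_) (sym (C-other h)) c

    meet-count : ∀ {n t} → fst n ≡ 0 → req (α t) ≡ suc n → C n t ≡ 0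
    meet-count {n} {t} n≡ e with move t
    ... | idle r _ _ = ⊥-elim (0≢1+n (trans (sym r) e))
    ... | meet _ r c≡ _ _ _ _ _ = subst (λ m → C m t ≡ 0) (suc-injective (trans (sym r) e)) c≡
    ... | wait n≢ r _ _ _ = ⊥-elim (n≢ (subst (λ m → fst m ≡ 0) (sym (suc-injective (trans (sym r) e))) n≡))
    ... | join n≢ r _ _ = ⊥-elim (n≢ (subst (λ m → fst m ≡ 0) (sym (suc-injective (trans (sym r) e))) n≡))

    -- A requirement of the first kind acts only at count 0, and its action makes the count positive
    -- until the next injury, so it acts at most once after s₀.
    finitely-often : ∀ {n s₀} → Quiet n s₀ → ¬ (∀ s → s₀ ≤ s → ∃ λ t → s ≤ t × req (α t) ≡ suc n)
    finitely-often {n} {s₀} quiet infinite with fst n ≟ 0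
    ... | no n≢ = Infinite.impossible n≢ quiet infinite
    ... | yes n≡ =
      let t , s₀≤t , e = infinite s₀ ≤-refl
          t′ , t<t′ , e′ = infinite (suc t) (≤-trans s₀≤t (n≤1+n t))
          c>0 = C-positive quiet (≤-trans s₀≤t (n≤1+n t)) (subst (0 <_) (sym (C-own e)) (s≤s z≤n)) (t′ ∸ suc t)
      in <-irrefl (sym (meet-count n≡ e′)) (subst (λ r → 0 < C n r) (m∸n+n≡m t<t′) c>0)

    opaque
      settle : ∀ n → ∃ λ s₀ → Quiet n s₀
      settle zero = 0 , λ _ _ _ _ → z≤n
      settle (suc n) with settle n
      ... | s₀ , quiet with em {∃ λ s₁ → s₀ ≤ s₁ × (∀ t → s₁ ≤ t → req (α t) ≢ suc n)}
      ...   | yes (s₁ , s₀≤s₁ , never) = s₁ , λ s s₁≤s q e →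
        ≤∧≢⇒< (quiet s (≤-trans s₀≤s₁ s₁≤s) q e) λ { refl → never s s₁≤s e }
      ...   | no ¬never = ⊥-elim (finitely-often quiet λ s s₀≤s → not-empty λ ¬t →
        ¬never (s , s₀≤s , λ t s≤t e → ¬t (t , s≤t , e)))

    L-settled : ∀ {n s₀ s} → Quiet n s₀ → s₀ ≤ s → L n s ≡ L n s₀
    L-settled {n} {s₀} {s} quiet s₀≤s = trans (cong (L n) (sym (m∸n+n≡m s₀≤s))) (go (s ∸ s₀))
      where
      go : ∀ k → L n (k + s₀) ≡ L n s₀
      go zero = refl
      go (suc k) = trans (L-same (quiet (k + s₀) (m≤n+m s₀ k))) (go k)

    C-settled : ∀ {n s₀ s} → Quiet (suc n) s₀ → s₀ ≤ s → C n s ≡ C n s₀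
    C-settled {n} {s₀} {s} quiet s₀≤s = trans (cong (C n) (sym (m∸n+n≡m s₀≤s))) (go (s ∸ s₀))
      where
      go : ∀ k → C n (k + s₀) ≡ C n s₀
      go zero = refl
      go (suc k) = trans (C-other (quiet (k + s₀) (m≤n+m s₀ k))) (go k)

    site : ℕ → ℕ
    site n = L n (proj₁ (settle n)) + n

    site-later : ∀ {n s} → proj₁ (settle n) ≤ s → site n ≡ L n s + n
    site-later {n} le = cong (_+ n) (sym (L-settled (proj₂ (settle n)) le))

    M-site : ∀ {n s} → proj₁ (settle n) ≤ s → M s (2 * site n + 1) ≡ 2 * site n + 1
    M-site {n} {s} le = subst (λ c → M s (2 * c + 1) ≡ 2 * c + 1) (sym (site-later le)) (M-pole n s)

    site-mono : ∀ {n m} → n < m → site n < site m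
    site-mono {n} {m} n<m = subst₂ _<_
      (sym (site-later (m≤m⊔n (proj₁ (settle n)) (proj₁ (settle m)))))
      (sym (site-later (m≤n⊔m (proj₁ (settle n)) (proj₁ (settle m)))))
      (+-mono-≤-< (L-mono-req (<⇒≤ n<m) (proj₁ (settle n) ⊔ proj₁ (settle m))) n<m)

    site-inj : ∀ {n m} → site n ≡ site m → n ≡ m
    site-inj {n} {m} e with <-cmp n m
    ... | tri< n<m _ _ = ⊥-elim (<-irrefl e (site-mono n<m))
    ... | tri≈ _ n≡m _ = n≡m
    ... | tri> _ _ m<n = ⊥-elim (<-irrefl (sym e) (site-mono m<n))

    site-even : ∀ n a → ¬ E (2 * site n + 1) (2 * a)
    site-even n a h with E-later (proj₁ (settle n)) h
    ... | s , le , q with subst₂ Q (M-site le) (M-even s a) q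
    ...   | inj₁ e = 2i≢2j+1 {a} {site n} (sym e)
    ...   | inj₂ (b , _ , e , _) = 2i≢2j+1 {b} {site n} (sym e)

    site-distinct : ∀ n m → E (2 * site n + 1) (2 * site m + 1) → n ≡ m
    site-distinct n m h with E-later (proj₁ (settle n) ⊔ proj₁ (settle m)) h
    ... | s , le , q with subst₂ Q (M-site (≤-trans (m≤m⊔n _ _) le)) (M-site (≤-trans (m≤n⊔m (proj₁ (settle n)) _) le)) q
    ...   | inj₁ e = site-inj (odd-inj {site n} {site m} e)
    ...   | inj₂ (b , _ , e , _) = ⊥-elim (2i≢2j+1 {b} {site n} (sym e))

    E-even : ∀ {x y} → E (2 * x) (2 * y) → A x y
    E-even {x} {y} (s , q) with subst₂ Q (M-even s x) (M-even s y) q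
    ... | inj₁ e = subst (A x) (2*-inj {x} {y} e) A≈.refl
    ... | inj₂ (a , b , e , e′ , h) = subst₂ A (sym (2*-inj {x} {a} e)) (sym (2*-inj {y} {b} e′)) h

    target-rep : ∀ s → (src (α s) ≡ 0 × tgt (α s) ≡ 0) ⊎ (∃ λ y → tgt (α s) ≡ M s y)
    target-rep s with move s
    ... | idle _ p q = inj₁ (p , q)
    ... | meet _ _ _ _ _ _ t _ = inj₂ (_ , t)
    ... | wait _ _ _ p q = inj₁ (p , q)
    ... | join _ _ _ (collapse _ _ _ _ v≡ _) = inj₂ (_ , v≡)

    moved-tgt : ∀ a → moved a (tgt a) ≡ tgt a
    moved-tgt a with tgt a ≟ src a
    ... | yes e = moved-src e
    ... | no e = moved-other e

    -- Collapses go into current representatives, so no chains arise. Hence a number is E-equivalent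
    -- to its representative at every stage.
    M-idem : ∀ s x → M s (M s x) ≡ M s x
    M-idem zero x = refl
    M-idem (suc s) x with target-rep s | M s x ≟ src (α s)
    ... | _ | no e rewrite moved-other {α s} e = trans (cong (moved (α s)) (M-idem s x)) (moved-other e)
    ... | inj₁ (p , q) | yes _ rewrite moved-trivial {α s} (M s x) p q =
      trans (cong (moved (α s)) (M-idem s x)) (moved-trivial _ p q)
    ... | inj₂ (y , t) | yes e rewrite moved-src {α s} e =
      trans (cong (moved (α s)) (trans (cong (M s) t) (trans (M-idem s y) (sym t)))) (moved-tgt (α s))

    E-M : ∀ s x → E x (M s x)
    E-M s x = s , inj₁ (sym (M-idem s x))

    acted : ∀ {n} s → 0 < C n s → ∃ λ t → req (α t) ≡ suc n
    acted {n} (suc s) c>0 with view n (α s)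
    ... | injury q e q<n = ⊥-elim (<-irrefl (sym (C-injury e q<n)) c>0)
    ... | own e = s , e
    ... | other h = acted s (subst (0 <_) (C-other h) c>0)

    -- The dichotomy for computable ranges

    module Meeting {f : ℕ → ℕ} {e : ℕ} (index : ∀ x → ∃ λ s → φ e x s ≡ suc (f x)) (j : ℕ) where
      n : ℕ
      n = pair 0 (pair e j)

      n-0 : fst n ≡ 0
      n-0 = fst-pair 0 _
      n-e : fst (snd n) ≡ e
      n-e = trans (cong fst (snd-pair 0 _)) (fst-pair e j)
      n-j : snd (snd n) ≡ j
      n-j = trans (cong snd (snd-pair 0 _)) (snd-pair e j)

      success : ∀ t → req (α t) ≡ suc n → ∃ λ x → E (f x) j
      success t r with move t
      ... | idle r′ _ _ = ⊥-elim (0≢1+n (trans (sym r′) r))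
      ... | wait n≢ r′ _ _ _ = ⊥-elim (n≢ (trans (cong fst (suc-injective (trans (sym r′) r))) n-0))
      ... | join n≢ r′ _ _ = ⊥-elim (n≢ (trans (cong fst (suc-injective (trans (sym r′) r))) n-0))
      ... | meet _ r′ _ z z≡ s≡ t≡ _ = x , suc t , inj₁ (trans (cong (M (suc t)) fx≡z)
            (trans (moved-src (sym s≡)) (trans (sym (moved-tgt (α t))) (cong (moved (α t)) (trans t≡ (cong (M t) j≡))))))
        where
        x : ℕ
        x = fst (snd t)
        fst-t : fst t ≡ n
        fst-t = suc-injective (trans (sym r′) r)
        j≡ : snd (snd (fst t)) ≡ j
        j≡ = trans (cong (snd ∘ snd) fst-t) n-j
        fx≡z : f x ≡ z
        fx≡z = φ-det (proj₂ (index x))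
          (subst (λ e′ → φ e′ x (snd (snd t)) ≡ suc z) (trans (cong (fst ∘ snd) fst-t) n-e) z≡)

      module _ {s₀ : ℕ} (quiet : Quiet (suc n) s₀) (c≡0 : C n s₀ ≡ 0) where
        bound : ℕ
        bound = L n s₀ + n

        quiet′ : Quiet n s₀
        quiet′ s le q e = <⇒≤ (quiet s le q e)

        -- Otherwise the requirement would act at a stage at which it is quiet. The bound is the
        -- same for all x because L has settled.
        failure : ∀ x s₁ → ∃ λ s → s₁ ≤ s × (par (M s (f x)) ≡ 0 ⊎ half (M s (f x)) ≤ bound)
        failure x s₁ = s , s₁≤s , decide
          where
          σ₀ σ s : ℕ
          σ₀ = proj₁ (index x)
          -- The last component of the stage absorbs every lower bound: convergence on x, settling,
          -- s₁, and the sizes of f x and j.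
          σ = σ₀ + (s₀ + (s₁ + (suc (f x) + suc j)))
          s = pair n (pair x σ)
          σ≤s : σ ≤ s
          σ≤s = ≤-trans (pair-≥₂ x σ) (pair-≥₂ n _)
          s₀≤s : s₀ ≤ s
          s₀≤s = ≤-trans (≤-trans (m≤m+n s₀ _) (m≤n+m _ σ₀)) σ≤s
          s₁≤s : s₁ ≤ s
          s₁≤s = ≤-trans (≤-trans (m≤m+n s₁ _) (≤-trans (m≤n+m _ s₀) (m≤n+m _ σ₀))) σ≤s
          tail≤s : suc (f x) + suc j ≤ s
          tail≤s = ≤-trans (≤-trans (m≤n+m _ s₁) (≤-trans (m≤n+m _ s₀) (m≤n+m _ σ₀))) σ≤s
          fst-s : fst s ≡ n
          fst-s = fst-pair n _
          found-s : found s n ≡ suc (f x)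
          found-s = trans (cong₂ (λ e′ x′ → φ e′ x′ (snd (snd s))) n-e (trans (cong fst (snd-pair n _)) (fst-pair x σ)))
            (trans (cong (φ e x) (trans (cong snd (snd-pair n _)) (snd-pair x σ)))
                   (φ-mono (m≤m+n σ₀ _) (proj₂ (index x))))
          meets′ : ∀ {m z} → fst s ≡ m → fst m ≡ 0 → C m s ≡ 0 → found s m ≡ suc z →
                   Permitted s m (M s z) (M s (snd (snd m))) → req (α s) ≡ suc m
          meets′ refl = meets
          decide : par (M s (f x)) ≡ 0 ⊎ half (M s (f x)) ≤ bound
          decide with evenOrOdd (M s (f x))
          ... | inj₁ (i , e) = inj₁ (trans (cong par e) (par-even i))
          ... | inj₂ (i , e) with i ≤? bound
          ...   | yes i≤b = inj₂ (subst (_≤ bound) (sym (trans (cong half e) (half-odd i))) i≤b)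
          ...   | no i≰b = ⊥-elim (<-irrefl refl (quiet s s₀≤s n
            (meets′ fst-s n-0 (trans (C-settled quiet s₀≤s) c≡0) found-s
              (permit i e (subst (_< i) (cong (_+ n) (sym (L-settled quiet′ s₀≤s))) (≰⇒> i≰b))
                (subst (_< s) (trans (cong half e) (half-odd i)) (M-bounded (≤-trans (m≤m+n _ _) tail≤s)))
                (subst (λ j′ → half (M s j′) < s) (sym n-j) (M-bounded (≤-trans (m≤n+m _ (suc (f x))) tail≤s)))))))

    Confined : (ℕ → ℕ) → ℕ → Set
    Confined f b = ∀ x s₁ → ∃ λ s → s₁ ≤ s × (par (M s (f x)) ≡ 0 ⊎ half (M s (f x)) ≤ b)

    -- If the class of j is missed, the requirement for e and j never acts, since one action would
    -- bring the range into that class. Its final count is then 0 and `failure` applies.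
    dichotomy : ∀ {f} → Op₁ f → (∀ j → ∃ λ x → E (f x) j) ⊎ ∃ (Confined f)
    dichotomy {f} cf with em {∃ λ j → ¬ (∃ λ x → E (f x) j)}
    ... | no ¬missed = inj₁ λ j → not-empty λ ¬x → ¬missed (j , ¬x)
    ... | yes (j , missed) = inj₂ (_ , failure quiet c≡0)
      where
      open Meeting {f} (proj₂ (φ-index {f} cf)) j
      s₀ : ℕ
      s₀ = proj₁ (settle (suc n))
      quiet : Quiet (suc n) s₀
      quiet = proj₂ (settle (suc n))
      c≡0 : C n s₀ ≡ 0
      c≡0 with C n s₀ in eq
      ... | zero = refl
      ... | suc c = ⊥-elim (missed (let t , r = acted s₀ (subst (0 <_) (sym eq) (s≤s z≤n)) in success t r))

    confined-reps : ∀ {f b} → Op₁ f → Confined f b →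
                    ∃ λ g → Op₁ g × (∀ x → E (f x) (g x) × (par (g x) ≡ 0 ⊎ half (g x) ≤ b))
    confined-reps {f} {b} cf conf = (λ x → M (stage x) (f x)) , (λ a → c-α-rep (c-stage a) (cf a)) ,
      λ x → E-M (stage x) (f x) , split x
      where
      time : Σ (ℕ → ℕ) λ g → Op₁ g × (∀ x → ((par (M (g x) (f x)) ≡ᵇ 0) ∨ (half (M (g x) (f x)) <ᵇ suc b)) ≡ true)
      time = c-search {λ s x → (par (M s (f x)) ≡ᵇ 0) ∨ (half (M s (f x)) <ᵇ suc b)}
        (λ u v → c-∨ (c-≡ᵇ (c-par (c-α-rep u (cf v))) (c-const 0))
                     (c-<ᵇ (c-half (c-α-rep u (cf v))) (c-const (suc b))))
        λ x → let s , _ , h = conf x 0 in s , or h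
        where
        or : ∀ {p q} → p ≡ 0 ⊎ q ≤ b → ((p ≡ᵇ 0) ∨ (q <ᵇ suc b)) ≡ true
        or (inj₁ refl) = refl
        or {zero} (inj₂ _) = refl
        or {suc p} (inj₂ le) = <ᵇ-yes (s≤s le)
      stage : ℕ → ℕ
      stage = proj₁ time
      c-stage : Op₁ stage
      c-stage = proj₁ (proj₂ time)
      split : ∀ x → par (M (stage x) (f x)) ≡ 0 ⊎ half (M (stage x) (f x)) ≤ b
      split x = unor (proj₂ (proj₂ time) x)
        where
        unor : ∀ {p q} → ((p ≡ᵇ 0) ∨ (q <ᵇ suc b)) ≡ true → p ≡ 0 ⊎ q ≤ b
        unor {zero} _ = inj₁ refl
        unor {suc p} {q} h = inj₂ (s≤s⁻¹ (<ᵇ-true q (suc b) h))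

    -- From some stage on a site is its own representative; that is why confinement is demanded at
    -- arbitrarily late stages.
    confined-site : ∀ {f b} → Confined f b → ∀ n x → b < site n → f x ≢ 2 * site n + 1
    confined-site {f} {b} conf n x b<c e with conf x (proj₁ (settle n))
    ... | s , le , h = absurd (subst (λ u → par u ≡ 0 ⊎ half u ≤ b) (trans (cong (M s) e) (M-site le)) h)
      where
      absurd : par (2 * site n + 1) ≡ 0 ⊎ half (2 * site n + 1) ≤ b → ⊥
      absurd (inj₁ p) = 0≢1+n (trans (sym p) (par-odd (site n)))
      absurd (inj₂ le) = <⇒≱ b<c (subst (_≤ b) (half-odd (site n)) le)

    -- The requirement for an index e of f has a final count, which codes one last test pair. Under
    -- a reduction both approximations settle on the same answer for this pair, so at a late stage
    -- the requirement acts once more although it is quiet.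
    notBelow : ¬ (E ≤ᶜ B)
    notBelow (f , computable , red) = <-irrefl refl (quiet s s₀≤s n (acts′ fst-s n≢ agreed))
      where
      cf : Op₁ f
      cf = fromComputable {f} computable
      e n s₀ x y : ℕ
      e = proj₁ (φ-index {f} cf)
      n = pair 1 e
      index : ∀ x → ∃ λ s → φ e x s ≡ suc (f x)
      index = proj₂ (φ-index {f} cf)
      n≢ : fst n ≢ 0
      n≢ p = 0≢1+n (trans (sym p) (fst-pair 1 e))
      s₀ = proj₁ (settle (suc n))
      quiet : Quiet (suc n) s₀
      quiet = proj₂ (settle (suc n))
      x = C n s₀ at₀
      y = C n s₀ at₁
      eventually : ∃ λ s₁ → ∀ s → s₁ ≤ s → E-stage s x y ≡ stageB s (f x) (f y)
      eventually with em {E x y}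
      ... | yes h = let s₁ , p = E-appears h ; s₂ , q = Staged.appears SB (to (red x y) h) in
        s₁ ⊔ s₂ , λ s le → trans (E-mono {s₁} {s} {x} {y} (≤-trans (m≤m⊔n s₁ s₂) le) p)
                                 (sym (Staged.mono SB (≤-trans (m≤n⊔m s₁ s₂) le) q))
      ... | no ¬h = 0 , λ s _ → trans (false-unless (λ p → ¬h (E-holds {s} {x} {y} p)))
                              (sym (false-unless (λ p → ¬h (from (red x y) (Staged.holds SB p)))))
        where
        false-unless : ∀ {b} → b ≢ true → b ≡ false
        false-unless {true} h = ⊥-elim (h refl)
        false-unless {false} _ = refl
      σ s : ℕ
      σ = proj₁ eventually + (s₀ + (proj₁ (index x) + proj₁ (index y)))
      s = pair n σ
      fst-s : fst s ≡ n
      fst-s = fst-pair n σ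
      σ≤s : σ ≤ s
      σ≤s = pair-≥₂ n σ
      rest≤s : s₀ + (proj₁ (index x) + proj₁ (index y)) ≤ s
      rest≤s = ≤-trans (m≤n+m _ (proj₁ eventually)) σ≤s
      s₀≤s : s₀ ≤ s
      s₀≤s = ≤-trans (m≤m+n s₀ _) rest≤s
      acts′ : ∀ {m} → fst s ≡ m → fst m ≢ 0 → Agreement s m → req (α s) ≡ suc m
      acts′ refl = acts
      agrees-yes : ∀ {zx zy u v} → zx ≡ suc (f x) → zy ≡ suc (f y) → related s u v ≡ stageB s (f x) (f y) →
                   agrees s zx zy u v ≡ true
      agrees-yes refl refl h = ≡b-yes h
      agreed : Agreement s n
      agreed = subst (λ c → agrees s (φ (snd n) (c at₀) s) (φ (snd n) (c at₁) s) (M s (c at₀)) (M s (c at₁)) ≡ true)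
        (sym (C-settled quiet s₀≤s))
        (agrees-yes (halted x (≤-trans (m≤m+n _ (proj₁ (index y))) (≤-trans (m≤n+m _ s₀) rest≤s)))
                    (halted y (≤-trans (m≤n+m _ (proj₁ (index x))) (≤-trans (m≤n+m _ s₀) rest≤s)))
                    (proj₂ eventually s (≤-trans (m≤m+n _ _) σ≤s)))
        where
        halted : ∀ z → proj₁ (index z) ≤ s → φ (snd n) z s ≡ suc (f z)
        halted z le = trans (cong (λ e′ → φ e′ z s) (snd-pair 1 e)) (φ-mono le (proj₂ (index z)))

-- Consequences of the construction

record Extension (A B : Rel ℕ 0ℓ) : Set₁ where
  field
    E : Rel ℕ 0ℓ
    isCeer : IsCeer E
    embeds : ∀ {x y} → A x y ⇔ E (2 * x) (2 * y)
    site : ℕ → ℕ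
    site-≥ : ∀ n → n ≤ site n
    site-even : ∀ n a → ¬ E (2 * site n + 1) (2 * a)
    site-distinct : ∀ n m → E (2 * site n + 1) (2 * site m + 1) → n ≡ m

  -- The first half provides computable representatives, from which reductions to A ⊕ Id k are
  -- built; the second, the avoidance of large sites, is for inseparability.
  Confined : (ℕ → ℕ) → ℕ → Set
  Confined f b =
    (∃ λ g → Op₁ g × (∀ x → E (f x) (g x) × (par (g x) ≡ 0 ⊎ half (g x) ≤ b))) ×
    (∀ n x → b < site n → f x ≢ 2 * site n + 1)

  field
    dichotomy : ∀ {f} → Op₁ f → (∀ j → ∃ λ x → E (f x) j) ⊎ ∃ (Confined f)
    notBelow : ¬ (E ≤ᶜ B)

-- Reductions and uniform joins

reduction : ∀ (E R : Rel ℕ 0ℓ) f → Op₁ f → (∀ x y → E x y ⇔ R (f x) (f y)) → E ≤ᶜ R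
reduction E R f cf red = f , toComputable {f} cf , red

≤ᶜ-trans : ∀ (E R S : Rel ℕ 0ℓ) → E ≤ᶜ R → R ≤ᶜ S → E ≤ᶜ S
≤ᶜ-trans E R S (f , cf , red) (g , cg , red′) =
  reduction E S (λ x → g (f x)) (λ a → fromComputable {g} cg (fromComputable {f} cf a))
    λ x y → mk⇔ (to (red′ _ _) ∘ to (red x y)) (from (red x y) ∘ from (red′ _ _))

≤ᶜ-refl : ∀ (E : Rel ℕ 0ℓ) → E ≤ᶜ E
≤ᶜ-refl E = reduction E E (λ x → x) (λ a → a) λ x y → mk⇔ (λ h → h) (λ h → h)

decidable-set : ∀ {P : Pred ℕ 0ℓ} (b : ℕ → Bool) →
                (∀ {n} {a : Vec ℕ n → ℕ} → Comp a → CompB (λ xs → b (a xs))) →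
                (∀ x → P x ⇔ b x ≡ true) → ComputableSet P
decidable-set {P} b cb spec = (λ x → b2n (b x)) , toComputable {λ x → b2n (b x)} (λ a → numeric (cb a)) ,
  λ x → mk⇔ (λ p → cong b2n (to (spec x) p)) (λ h → from (spec x) (b2n-1 (b x) h))
  where
  b2n-1 : ∀ c → b2n c ≡ 1 → c ≡ true
  b2n-1 true _ = refl

module _ {P Q : Rel ℕ 0ℓ} where
  ⊕-even : ∀ a b → (P ⊕ Q) (2 * a) (2 * b) ⇔ P a b
  ⊕-even a b = mk⇔
    (λ { (inj₁ (u , v , e , e′ , h)) → subst₂ P (sym (2*-inj {a} {u} e)) (sym (2*-inj {b} {v} e′)) h
       ; (inj₂ (u , v , e , _)) → ⊥-elim (2i≢2j+1 {a} {u} e) })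
    (λ h → inj₁ (a , b , refl , refl , h))

  ⊕-odd : ∀ a b → (P ⊕ Q) (2 * a + 1) (2 * b + 1) ⇔ Q a b
  ⊕-odd a b = mk⇔
    (λ { (inj₁ (u , v , e , _)) → ⊥-elim (2i≢2j+1 {u} {a} (sym e))
       ; (inj₂ (u , v , e , e′ , h)) → subst₂ Q (sym (odd-inj {a} {u} e)) (sym (odd-inj {b} {v} e′)) h })
    (λ h → inj₂ (a , b , refl , refl , h))

  ⊕-par : ∀ {x y} → (P ⊕ Q) x y → par x ≡ par y
  ⊕-par (inj₁ (u , v , refl , refl , _)) = trans (par-even u) (sym (par-even v))
  ⊕-par (inj₂ (u , v , refl , refl , _)) = trans (par-odd u) (sym (par-odd v))

  ⊕-even-odd : ∀ {a b} → ¬ (P ⊕ Q) (2 * a) (2 * b + 1)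
  ⊕-even-odd {a} {b} h = 0≢1+n (trans (sym (par-even a)) (trans (⊕-par h) (par-odd b)))

  ⊕-odd-even : ∀ {a b} → ¬ (P ⊕ Q) (2 * a + 1) (2 * b)
  ⊕-odd-even {a} {b} h = 0≢1+n (trans (sym (par-even b)) (trans (sym (⊕-par h)) (par-odd a)))

  ⊕-injˡ : P ≤ᶜ P ⊕ Q
  ⊕-injˡ = reduction P (P ⊕ Q) (2 *_) c-2* λ x y → mk⇔ (from (⊕-even x y)) (to (⊕-even x y))

  ⊕-injʳ : Q ≤ᶜ P ⊕ Q
  ⊕-injʳ = reduction Q (P ⊕ Q) (λ x → 2 * x + 1) (λ a → c-+ (c-2* a) (c-const 1))
    λ x y → mk⇔ (from (⊕-odd x y)) (to (⊕-odd x y))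

  ⊕-half₀ : ∀ {x y} → par x ≡ 0 → par y ≡ 0 → (P ⊕ Q) x y ⇔ P (half x) (half y)
  ⊕-half₀ {x} {y} p q = subst₂ (λ x′ y′ → (P ⊕ Q) x′ y′ ⇔ P (half x) (half y))
    (sym (par0-even x p)) (sym (par0-even y q)) (⊕-even (half x) (half y))

  ⊕-half₁ : ∀ {x y} → par x ≡ 1 → par y ≡ 1 → (P ⊕ Q) x y ⇔ Q (half x) (half y)
  ⊕-half₁ {x} {y} p q = subst₂ (λ x′ y′ → (P ⊕ Q) x′ y′ ⇔ Q (half x) (half y))
    (sym (par1-odd x p)) (sym (par1-odd y q)) (⊕-odd (half x) (half y))

  ⊕-equivalence : IsEquivalence P → IsEquivalence Q → IsEquivalence (P ⊕ Q)
  ⊕-equivalence eP eQ = record { refl = λ {x} → reflexive x ; sym = symmetric ; trans = transitive }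
    where
    module P≈ = IsEquivalence eP
    module Q≈ = IsEquivalence eQ
    reflexive : ∀ x → (P ⊕ Q) x x
    reflexive x with evenOrOdd x
    ... | inj₁ (i , refl) = from (⊕-even i i) P≈.refl
    ... | inj₂ (i , refl) = from (⊕-odd i i) Q≈.refl
    symmetric : ∀ {x y} → (P ⊕ Q) x y → (P ⊕ Q) y x
    symmetric (inj₁ (u , v , refl , refl , h)) = from (⊕-even _ _) (P≈.sym h)
    symmetric (inj₂ (u , v , refl , refl , h)) = from (⊕-odd _ _) (Q≈.sym h)
    transitive : ∀ {x y z} → (P ⊕ Q) x y → (P ⊕ Q) y z → (P ⊕ Q) x z
    transitive (inj₁ (u , v , refl , refl , h)) (inj₁ (v′ , w , e , refl , h′)) =
      from (⊕-even _ _) (P≈.trans h (subst (λ k → P k w) (sym (2*-inj {v} {v′} e)) h′))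
    transitive (inj₁ (u , v , refl , refl , h)) (inj₂ (v′ , w , e , _)) = ⊥-elim (2i≢2j+1 {v} {v′} e)
    transitive (inj₂ (u , v , refl , refl , h)) (inj₁ (v′ , w , e , _)) = ⊥-elim (2i≢2j+1 {v′} {v} (sym e))
    transitive (inj₂ (u , v , refl , refl , h)) (inj₂ (v′ , w , e , refl , h′)) =
      from (⊕-odd _ _) (Q≈.trans h (subst (λ k → Q k w) (sym (odd-inj {v} {v′} e)) h′))

  ⊕-staged : Staged P → Staged Q → Staged (P ⊕ Q)
  ⊕-staged SP SQ = record
    { stage = stage
    ; c-stage = λ a b c → c-ifB (c-≡ᵇ (c-par b) (c-par c))
        (c-ifB (c-≡ᵇ (c-par b) (c-const 0)) (Staged.c-stage SP a (c-half b) (c-half c))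
                                           (Staged.c-stage SQ a (c-half b) (c-half c)))
        (mkCompB (c-const 0))
    ; mono = λ {s} {s′} {x} {y} → mono s s′ x y
    ; holds = λ {s} {x} {y} → holds s x y
    ; appears = appears
    }
    where
    stage : ℕ → ℕ → ℕ → Bool
    stage s x y = if par x ≡ᵇ par y
      then (if par x ≡ᵇ 0 then Staged.stage SP s (half x) (half y) else Staged.stage SQ s (half x) (half y))
      else false
    mono : ∀ s s′ x y → s ≤ s′ → stage s x y ≡ true → stage s′ x y ≡ true
    mono s s′ x y le h with par x ≡ᵇ par y | par x ≡ᵇ 0
    ... | true | true = Staged.mono SP le h
    ... | true | false = Staged.mono SQ le h
    holds : ∀ s x y → stage s x y ≡ true → (P ⊕ Q) x y
    holds s x y h with evenOrOdd x | evenOrOdd y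
    ... | inj₁ (i , refl) | inj₁ (j , refl)
      rewrite par-even i | par-even j | half-even i | half-even j = from (⊕-even _ _) (Staged.holds SP h)
    ... | inj₁ (i , refl) | inj₂ (j , refl) rewrite par-even i | par-odd j with () ← h
    holds s x y h | inj₂ (i , refl) | inj₁ (j , refl) rewrite par-odd i | par-even j with () ← h
    holds s x y h | inj₂ (i , refl) | inj₂ (j , refl)
      rewrite par-odd i | par-odd j | half-odd i | half-odd j = from (⊕-odd _ _) (Staged.holds SQ h)
    stage-even : ∀ s i j → stage s (2 * i) (2 * j) ≡ Staged.stage SP s i j
    stage-even s i j rewrite par-even i | par-even j | half-even i | half-even j = refl
    stage-odd : ∀ s i j → stage s (2 * i + 1) (2 * j + 1) ≡ Staged.stage SQ s i j
    stage-odd s i j rewrite par-odd i | par-odd j | half-odd i | half-odd j = refl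
    appears : ∀ {x y} → (P ⊕ Q) x y → ∃ λ s → stage s x y ≡ true
    appears (inj₁ (u , v , refl , refl , h)) =
      let s , h′ = Staged.appears SP h in s , trans (stage-even s u v) h′
    appears (inj₂ (u , v , refl , refl , h)) =
      let s , h′ = Staged.appears SQ h in s , trans (stage-odd s u v) h′

  opaque
    ⊕-ceer : IsCeer P → IsCeer Q → IsCeer (P ⊕ Q)
    ⊕-ceer (eP , cP) (eQ , cQ) = ⊕-equivalence eP eQ , Staged⇒CE (⊕-staged (CE⇒Staged cP) (CE⇒Staged cQ))

opaque
  -- Sites and normal forms are chosen classically, but finitely many of their values can be written
  -- into a code.
  finite-table : ∀ (g : ℕ → ℕ) n → ∃ λ h → Op₁ h × (∀ i → i < n → h i ≡ g i)
  finite-table g zero = (λ _ → 0) , (λ _ → c-const 0) , λ _ ()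
  finite-table g (suc n) with finite-table g n
  ... | h , ch , eq = (λ i → if i ≡ᵇ n then g n else h i) ,
    (λ a → c-if (c-≡ᵇ a (c-const n)) (c-const (g n)) (ch a)) , eq′
    where
    eq′ : ∀ i → i < suc n → (if i ≡ᵇ n then g n else h i) ≡ g i
    eq′ i i<1+n with i ≟ n
    ... | yes refl rewrite ≡ᵇ-yes {n} refl = refl
    ... | no i≢n rewrite ≡ᵇ-no i≢n = eq i (≤∧≢⇒< (s≤s⁻¹ i<1+n) i≢n)

suc-% : ∀ m n .{{_ : NonZero n}} → suc m % n ≡ (if suc (m % n) ≡ᵇ n then 0 else suc (m % n))
suc-% m n = trans shift (wrap (m≤n⇒m<n∨m≡n (m%n<n m n)))
  where
  shift : suc m % n ≡ suc (m % n) % n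
  shift = trans (cong (λ k → suc k % n) (m≡m%n+[m/n]*n m n)) ([m+kn]%n≡m%n (suc (m % n)) (m / n) n)
  wrap : suc (m % n) < n ⊎ suc (m % n) ≡ n → suc (m % n) % n ≡ (if suc (m % n) ≡ᵇ n then 0 else suc (m % n))
  wrap (inj₁ lt) rewrite ≡ᵇ-no (<⇒≢ lt) = m<n⇒m%n≡m lt
  wrap (inj₂ eq) rewrite ≡ᵇ-yes eq = trans (cong (_% n) eq) (n%n≡0 n)

c-% : ∀ n .{{_ : NonZero n}} → Op₁ (_% n)
c-% n = op₁ (_% n) (comp-ext (λ xs → eq (x0 xs))
  (c-nrec (c-const 0) (c-if (c-≡ᵇ (c-suc v1) (c-const n)) (c-const 0) (c-suc v1)) v0))
  where
  eq : ∀ m → nrec 0 (λ _ y → if suc y ≡ᵇ n then 0 else suc y) m ≡ m % n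
  eq zero = sym (m<n⇒m%n≡m (>-nonZero⁻¹ n))
  eq (suc m) = trans (cong (λ y → if suc y ≡ᵇ n then 0 else suc y) (eq m)) (sym (suc-% m n))

module Classical (em₁ : ExcludedMiddle (lsuc 0ℓ)) where

  em : {P : Set} → Dec P
  em {P} = map′ lower lift (em₁ {Lift (lsuc 0ℓ) P})

  opaque
    extend : ∀ {A B D : Rel ℕ 0ℓ} → IsCeer A → IsCeer B → IsCeer D → ¬ (D ≤ᶜ B) → Extension A B
    extend {A} {B} {D} (eA , cA) (_ , cB) (eD , cD) D≰B = record
      { E = V.E
      ; isCeer = V.E-equiv , Staged⇒CE V.E-staged
      ; embeds = λ {x} {y} → mk⇔ (λ h → 0 , inj₂ (x , y , refl , refl , h)) V.E-even
      ; site = V.site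
      ; site-≥ = λ n → m≤n+m n _
      ; site-even = V.site-even
      ; site-distinct = V.site-distinct
      ; dichotomy = λ {f} cf → dichotomy′ f cf
      ; notBelow = V.notBelow
      }
      where
      module V = Construction.Verification (CE⇒Staged cA) (CE⇒Staged cB) (CE⇒Staged cD) em eA eD D≰B
      dichotomy′ : ∀ f → Op₁ f → (∀ j → ∃ λ x → V.E (f x) j) ⊎ ∃ λ b →
        (∃ λ g → Op₁ g × (∀ x → V.E (f x) (g x) × (par (g x) ≡ 0 ⊎ half (g x) ≤ b))) ×
        (∀ n x → b < V.site n → f x ≢ 2 * V.site n + 1)
      dichotomy′ f cf with V.dichotomy {f} cf
      ... | inj₁ full = inj₁ full
      ... | inj₂ (b , conf) = inj₂ (b , V.confined-reps {f} {b} cf conf , V.confined-site {f} {b} conf)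

  opaque
    -- The witness ranges over relations, so excluded middle is used one universe higher.
    nonuniversal-witness : ∀ B → ¬ Universal B → Σ (Rel ℕ 0ℓ) λ D → IsCeer D × ¬ (D ≤ᶜ B)
    nonuniversal-witness B nu with em₁ {Σ (Rel ℕ 0ℓ) λ D → IsCeer D × ¬ (D ≤ᶜ B)}
    ... | yes w = w
    ... | no ¬w = ⊥-elim (nu λ X ceer → below X ceer)
      where
      below : ∀ X → IsCeer X → X ≤ᶜ B
      below X ceer with em {X ≤ᶜ B}
      ... | yes h = h
      ... | no ¬h = ⊥-elim (¬w (X , ceer , ¬h))

  -- Inseparability, self-fullness and minimality

  module Properties {A B : Rel ℕ 0ℓ} (ext : Extension A B) where
    open Extension ext
    module E≈ = IsEquivalence (proj₁ isCeer)

    -- If S separated them, mapping the complement of S to x or S to y would give two ranges,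
    -- neither meeting all classes, that together contain every element.
    inseparable : ∀ x y → ¬ E x y → CompInseparable (E x) (E y)
    inseparable x y _ (S , (χ , c , spec) , x⊆S , S-y) = conclude (dichotomy {f} c-f) (dichotomy {g} c-g)
      where
      inS : ℕ → Bool
      inS z = χ z ≡ᵇ 1
      c-inS : ∀ {n} {a : Vec ℕ n → ℕ} → Comp a → CompB (λ xs → inS (a xs))
      c-inS a = c-≡ᵇ (fromComputable {χ} c a) (c-const 1)
      f g : ℕ → ℕ
      f z = if inS z then z else x
      g z = if inS z then y else z
      c-f : Op₁ f
      c-f a = c-if (c-inS a) a (c-const x)
      c-g : Op₁ g
      c-g a = c-if (c-inS a) (c-const y) a
      f∈S : ∀ z → S (f z)
      f∈S z with inS z in eq
      ... | true = from (spec z) (≡ᵇ-true _ 1 eq)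
      ... | false = x⊆S x E≈.refl
      g∉S : ∀ z → ¬ S (g z)
      g∉S z h with inS z in eq
      ... | true = S-y y h E≈.refl
      ... | false with () ← trans (sym eq) (≡ᵇ-yes (to (spec z) h))
      conclude : (∀ j → ∃ λ z → E (f z) j) ⊎ ∃ (Confined f) → (∀ j → ∃ λ z → E (g z) j) ⊎ ∃ (Confined g) → ⊥
      conclude (inj₁ full) _ = let z , h = full y in S-y _ (f∈S z) (E≈.sym h)
      conclude (inj₂ _) (inj₁ full) = let z , h = full x in g∉S z (x⊆S _ (E≈.sym h))
      conclude (inj₂ (b , _ , f≢)) (inj₂ (b′ , _ , g≢)) = either (inS z) refl
        where
        N z : ℕ
        N = suc (b ⊔ b′)
        z = 2 * site N + 1
        either : ∀ t → inS z ≡ t → ⊥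
        either true eq = f≢ N z (≤-trans (s≤s (m≤m⊔n b b′)) (site-≥ N)) (cong (λ t → if t then z else x) eq)
        either false eq = g≢ N z (≤-trans (s≤s (m≤n⊔m b b′)) (site-≥ N)) (cong (λ t → if t then y else z) eq)

    opaque
      inequivalent : ∀ x → ∃ λ y → ¬ E x y
      inequivalent x with em {E x (2 * site 0 + 1)}
      ... | no ¬h = _ , ¬h
      ... | yes h = 2 * site 1 + 1 , λ h′ → 0≢1+n (site-distinct 0 1 (E≈.trans (E≈.sym h) h′))

    class-noncomputable : ∀ x → ¬ ComputableSet (E x)
    class-noncomputable x c = let y , ¬h = inequivalent x in
      inseparable x y ¬h (E x , c , (λ _ h → h) , λ z h h′ → ¬h (E≈.trans h (E≈.sym h′)))

    -- The parity of h is a computable E-invariant. If both parities occurred, the numbers whose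
    -- image has the parity of h 0 would separate two classes.
    same-parity : ∀ {P Q} ((h , _) : E ≤ᶜ P ⊕ Q) → ∀ x → par (h 0) ≡ par (h x)
    same-parity {P} {Q} (h , c , red) x with par (h 0) ≟ par (h x)
    ... | yes e = e
    ... | no ne = ⊥-elim (inseparable 0 x (λ e → ne (⊕-par (to (red 0 x) e)))
      ( (λ z → par (h 0) ≡ par (h z))
      , decidable-set (λ z → par (h 0) ≡ᵇ par (h z))
          (λ a → c-≡ᵇ (c-const (par (h 0))) (c-par (fromComputable {h} c a)))
          (λ z → mk⇔ ≡ᵇ-yes (≡ᵇ-true _ _))
      , (λ z e → ⊕-par (to (red 0 z) e))
      , λ z p e → ne (trans p (sym (⊕-par (to (red x z) e))))))

    opaque
      one-side : ∀ {P Q} → E ≤ᶜ P ⊕ Q → E ≤ᶜ P ⊎ E ≤ᶜ Q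
      one-side {P} {Q} r@(h , c , red) with evenOrOdd (h 0)
      ... | inj₁ (i , h≡) = inj₁ (reduction E P (λ x → half (h x)) (λ a → c-half (fromComputable {h} c a)) λ x y →
          mk⇔ (to (⊕-half₀ (side x) (side y)) ∘ to (red x y)) (from (red x y) ∘ from (⊕-half₀ (side x) (side y))))
        where
        side : ∀ x → par (h x) ≡ 0
        side x = trans (sym (same-parity r x)) (trans (cong par h≡) (par-even i))
      ... | inj₂ (i , h≡) = inj₂ (reduction E Q (λ x → half (h x)) (λ a → c-half (fromComputable {h} c a)) λ x y →
          mk⇔ (to (⊕-half₁ (side x) (side y)) ∘ to (red x y)) (from (red x y) ∘ from (⊕-half₁ (side x) (side y))))
        where
        side : ∀ x → par (h x) ≡ 1
        side x = trans (sym (same-parity r x)) (trans (cong par h≡) (par-odd i))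

    Id-not-above : ∀ k .{{_ : NonZero k}} → ¬ (E ≤ᶜ Id k)
    Id-not-above k (h , c , red) with inequivalent 0
    ... | y , ¬h = class-noncomputable 0 (decidable-set (λ z → h 0 % k ≡ᵇ h z % k)
      (λ a → c-≡ᵇ (c-const (h 0 % k)) (c-% k (fromComputable {h} c a)))
      λ z → mk⇔ (λ e → ≡ᵇ-yes (to (red 0 z) e)) (λ e → from (red 0 z) (≡ᵇ-true _ _ e)))

    not-below-sum : A ≤ᶜ B → ∀ k .{{_ : NonZero k}} → ¬ (E ≤ᶜ A ⊕ Id k)
    not-below-sum A≤B k h with one-side {A} {Id k} h
    ... | inj₁ E≤A = notBelow (≤ᶜ-trans E A B E≤A A≤B)
    ... | inj₂ E≤Id = Id-not-above k E≤Id

    embedding : A ≤ᶜ E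
    embedding = reduction A E (2 *_) c-2* λ x y → embeds

    -- Sites are inequivalent to each other and to all even numbers, so the residues go to the first
    -- n sites.
    sum-embeds : ∀ n .{{_ : NonZero n}} → A ⊕ Id n ≤ᶜ E
    sum-embeds n with finite-table site n
    ... | t , c-t , t≡ = reduction (A ⊕ Id n) E f c-f red
      where
      f : ℕ → ℕ
      f z = if par z ≡ᵇ 0 then z else 2 * t (half z % n) + 1
      c-f : Op₁ f
      c-f a = c-if (c-≡ᵇ (c-par a) (c-const 0)) a (c-+ (c-2* (c-t (c-% n (c-half a)))) (c-const 1))
      f-even : ∀ i → f (2 * i) ≡ 2 * i
      f-even i rewrite par-even i = refl
      f-odd : ∀ i → f (2 * i + 1) ≡ 2 * site (i % n) + 1
      f-odd i rewrite par-odd i | half-odd i | t≡ (i % n) (m%n<n i n) = refl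
      red : ∀ x y → (A ⊕ Id n) x y ⇔ E (f x) (f y)
      red x y with evenOrOdd x | evenOrOdd y
      ... | inj₁ (i , refl) | inj₁ (j , refl) rewrite f-even i | f-even j =
        mk⇔ (to embeds ∘ to (⊕-even i j)) (from (⊕-even i j) ∘ from embeds)
      ... | inj₁ (i , refl) | inj₂ (j , refl) rewrite f-even i | f-odd j =
        mk⇔ (⊥-elim ∘ ⊕-even-odd {A} {Id n} {i} {j}) (λ h → ⊥-elim (site-even (j % n) i (E≈.sym h)))
      ... | inj₂ (i , refl) | inj₁ (j , refl) rewrite f-odd i | f-even j =
        mk⇔ (⊥-elim ∘ ⊕-odd-even {A} {Id n} {i} {j}) (λ h → ⊥-elim (site-even (i % n) j h))
      ... | inj₂ (i , refl) | inj₂ (j , refl) rewrite f-odd i | f-odd j =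
        mk⇔ (λ h → subst (λ k → E (2 * site (i % n) + 1) (2 * site k + 1)) (to (⊕-odd {A} i j) h) E≈.refl)
            (λ h → from (⊕-odd i j) (site-distinct (i % n) (j % n) h))

    -- Least indices are taken so that two odd normal numbers are E-equivalent only if equal. On
    -- normal numbers E is then A ⊕ Id (suc b) without renumbering, as indices up to b are their own
    -- residues.
    Normal : ℕ → ℕ → Set
    Normal b v = (∃ λ a → v ≡ 2 * a) ⊎
      (∃ λ i → i ≤ b × v ≡ 2 * i + 1 × (∀ a → ¬ E v (2 * a)) × (∀ j → j < i → ¬ E v (2 * j + 1)))

    opaque
      normalise : ∀ b i → i ≤ b → ∃ λ v → E (2 * i + 1) v × Normal b v
      normalise b = <-rec (λ i → i ≤ b → ∃ λ v → E (2 * i + 1) v × Normal b v) go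
        where
        go : ∀ i → (∀ {j} → j < i → j ≤ b → ∃ λ v → E (2 * j + 1) v × Normal b v) →
             i ≤ b → ∃ λ v → E (2 * i + 1) v × Normal b v
        go i rec i≤b with em {∃ λ a → E (2 * i + 1) (2 * a)} | em {∃ λ j → j < i × E (2 * i + 1) (2 * j + 1)}
        ... | yes (a , h) | _ = 2 * a , h , inj₁ (a , refl)
        ... | no _ | yes (j , j<i , h) =
          let v , h′ , nv = rec j<i (≤-trans (<⇒≤ j<i) i≤b) in v , E≈.trans h h′ , nv
        ... | no ¬a | no ¬j = 2 * i + 1 , E≈.refl ,
          inj₂ (i , i≤b , refl , (λ a h → ¬a (a , h)) , λ j j<i h → ¬j (j , j<i , h))

    normal-sum : ∀ {b v w} → Normal b v → Normal b w → E v w ⇔ (A ⊕ Id (suc b)) v w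
    normal-sum (inj₁ (i , refl)) (inj₁ (j , refl)) =
      mk⇔ (from (⊕-even i j) ∘ from embeds) (to embeds ∘ to (⊕-even i j))
    normal-sum {b} (inj₁ (i , refl)) (inj₂ (j , _ , refl , ¬a , _)) =
      mk⇔ (λ h → ⊥-elim (¬a i (E≈.sym h))) (⊥-elim ∘ ⊕-even-odd {A} {Id (suc b)} {i} {j})
    normal-sum {b} (inj₂ (i , _ , refl , ¬a , _)) (inj₁ (j , refl)) =
      mk⇔ (λ h → ⊥-elim (¬a j h)) (⊥-elim ∘ ⊕-odd-even {A} {Id (suc b)} {i} {j})
    normal-sum {b} (inj₂ (i , i≤b , refl , _ , least-i)) (inj₂ (j , j≤b , refl , _ , least-j)) =
      mk⇔ (λ h → from (⊕-odd i j) (cong (_% suc b) (same-index h)))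
          (λ h → subst (λ k → E (2 * i + 1) (2 * k + 1))
            (trans (sym (m<n⇒m%n≡m (s≤s i≤b))) (trans (to (⊕-odd {A} i j) h) (m<n⇒m%n≡m (s≤s j≤b)))) E≈.refl)
      where
      same-index : E (2 * i + 1) (2 * j + 1) → i ≡ j
      same-index h with <-cmp i j
      ... | tri< i<j _ _ = ⊥-elim (least-j i i<j (E≈.sym h))
      ... | tri≈ _ i≡j _ = i≡j
      ... | tri> _ _ j<i = ⊥-elim (least-i j j<i h)

    canonical : ℕ → ℕ → ℕ
    canonical b i with i ≤? b
    ... | yes i≤b = proj₁ (normalise b i i≤b)
    ... | no _ = 0

    -- The representatives given by confinement are normalised; for the odd ones this takes only b +
    -- 1 values, which a table makes computable.
    confined⇒below : ∀ {X f} b → (∀ x y → X x y ⇔ E (f x) (f y)) → Confined f b → X ≤ᶜ A ⊕ Id (suc b)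
    confined⇒below {X} {f} b red ((g , c-g , reps) , _) with finite-table (canonical b) (suc b)
    ... | t , c-t , t≡ = reduction X (A ⊕ Id (suc b)) h c-h λ x y →
      mk⇔ (λ r → to (normal-sum (proj₂ (good x)) (proj₂ (good y)))
                   (E≈.trans (E≈.sym (proj₁ (good x))) (E≈.trans (to (red x y) r) (proj₁ (good y)))))
          (λ r → from (red x y) (E≈.trans (proj₁ (good x))
                   (E≈.trans (from (normal-sum (proj₂ (good x)) (proj₂ (good y))) r) (E≈.sym (proj₁ (good y))))))
      where
      h : ℕ → ℕ
      h x = if par (g x) ≡ᵇ 0 then g x else t (half (g x))
      c-h : Op₁ h
      c-h a = c-if (c-≡ᵇ (c-par (c-g a)) (c-const 0)) (c-g a) (c-t (c-half (c-g a)))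
      table : ∀ i → i ≤ b → E (2 * i + 1) (t i) × Normal b (t i)
      table i i≤b rewrite t≡ i (s≤s i≤b) with i ≤? b
      ... | yes p = proj₂ (normalise b i p)
      ... | no ¬p = ⊥-elim (¬p i≤b)
      norm : ∀ u → par u ≡ 0 ⊎ half u ≤ b →
             E u (if par u ≡ᵇ 0 then u else t (half u)) × Normal b (if par u ≡ᵇ 0 then u else t (half u))
      norm u p with evenOrOdd u
      ... | inj₁ (i , refl) rewrite par-even i = E≈.refl , inj₁ (i , refl)
      norm u (inj₁ p) | inj₂ (i , refl) = ⊥-elim (0≢1+n (trans (sym p) (par-odd i)))
      norm u (inj₂ p) | inj₂ (i , refl) rewrite par-odd i | half-odd i = table i p
      good : ∀ x → E (f x) (h x) × Normal b (h x)
      good x = let e , p = reps x ; e′ , nv = norm (g x) p in E≈.trans e e′ , nv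

    opaque
      -- A reduction that meets every class is inverted by searching for a preimage together with a
      -- stage that confirms it.
      full⇒above : ∀ {X f} → Op₁ f → (∀ x y → X x y ⇔ E (f x) (f y)) → (∀ j → ∃ λ x → E (f x) j) → E ≤ᶜ X
      full⇒above {X} {f} c-f red full = reduction E X (λ y → fst (g y)) (λ a → c-fst (c-g a)) λ x y →
        mk⇔ (λ h → from (red _ _) (E≈.trans (hits x) (E≈.trans h (E≈.sym (hits y)))))
            (λ h → E≈.trans (E≈.sym (hits x)) (E≈.trans (to (red _ _) h) (hits y)))
        where
        open Staged (CE⇒Staged (proj₂ isCeer))
        found : Σ (ℕ → ℕ) λ g → Op₁ g × (∀ y → stage (snd (g y)) (f (fst (g y))) y ≡ true)
        found = c-search {λ z y → stage (snd z) (f (fst z)) y} (λ z y → c-stage (c-snd z) (c-f (c-fst z)) y)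
          λ y → let x , h = full y ; s , h′ = appears h in
            pair x s , subst₂ (λ x′ s′ → stage s′ (f x′) y ≡ true) (sym (fst-pair x s)) (sym (snd-pair x s)) h′
        g : ℕ → ℕ
        g = proj₁ found
        c-g : Op₁ g
        c-g = proj₁ (proj₂ found)
        hits : ∀ y → E (f (fst (g y))) y
        hits y = holds (proj₂ (proj₂ found) y)

    opaque
      minimal : ∀ X → X <ᶜ E → Σ ℕ λ k → Σ (NonZero k) λ nz → X ≤ᶜ (A ⊕ Id k {{nz}})
      minimal X ((f , c , red) , E≰X) with dichotomy {f} (fromComputable {f} c)
      ... | inj₁ full = ⊥-elim (E≰X (full⇒above {X} {f} (fromComputable {f} c) red full))
      ... | inj₂ (b , conf) = suc b , _ , confined⇒below {X} {f} b red conf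

    opaque
      selfFull : A ≤ᶜ B → SelfFull E
      selfFull A≤B g c red with dichotomy {g} (fromComputable {g} c)
      ... | inj₁ full = full
      ... | inj₂ (b , conf) = ⊥-elim (not-below-sum A≤B (suc b) (confined⇒below {E} {g} b red conf))

    -- A reduction of E ⊕ E to E restricts on the left copy to a self-reduction of E. Self-fullness
    -- lets it meet the class of the image of 1, a number of the right copy.
    nonuniversal : A ≤ᶜ B → ¬ Universal E
    nonuniversal A≤B univ with univ (E ⊕ E) (⊕-ceer isCeer isCeer)
    ... | h , c , red with selfFull A≤B (λ x → h (2 * x))
            (toComputable {λ x → h (2 * x)} (λ a → fromComputable {h} c (c-2* a)))
            (λ x y → mk⇔ (to (red _ _) ∘ from (⊕-even x y)) (to (⊕-even x y) ∘ from (red _ _))) (h 1)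
    ... | k , e = ⊕-even-odd {E} {E} {k} {0} (from (red (2 * k) 1) e)

  -- An extension of D₁ ⊕ D₂, with witnesses Dᵢ ≰ Bᵢ, would reduce to the join and hence to one of
  -- its sides; but both witnesses lie below the extension.
  ⊕-nonuniversal : ∀ B₁ B₂ → IsCeer B₁ → ¬ Universal B₁ → ¬ Universal B₂ → ¬ Universal (B₁ ⊕ B₂)
  ⊕-nonuniversal B₁ B₂ ceer nu₁ nu₂ univ =
    let D₁ , ceer₁ , D₁≰ = nonuniversal-witness B₁ nu₁
        D₂ , ceer₂ , D₂≰ = nonuniversal-witness B₂ nu₂
        ext = extend (⊕-ceer ceer₁ ceer₂) ceer ceer₁ D₁≰
        open Properties ext
    in conclude {D₁} {D₂} {Extension.E ext} D₁≰ D₂≰ embedding (one-side {B₁} {B₂} (univ _ (Extension.isCeer ext)))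
    where
    conclude : ∀ {D₁ D₂ E} → ¬ (D₁ ≤ᶜ B₁) → ¬ (D₂ ≤ᶜ B₂) → D₁ ⊕ D₂ ≤ᶜ E → E ≤ᶜ B₁ ⊎ E ≤ᶜ B₂ → ⊥
    conclude {D₁} {D₂} {E} D₁≰ D₂≰ D≤E (inj₁ h) =
      D₁≰ (≤ᶜ-trans D₁ (D₁ ⊕ D₂) B₁ (⊕-injˡ {D₁} {D₂}) (≤ᶜ-trans (D₁ ⊕ D₂) E B₁ D≤E h))
    conclude {D₁} {D₂} {E} D₁≰ D₂≰ D≤E (inj₂ h) =
      D₂≰ (≤ᶜ-trans D₂ (D₁ ⊕ D₂) B₂ (⊕-injʳ {D₁} {D₂}) (≤ᶜ-trans (D₁ ⊕ D₂) E B₂ D≤E h))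

  -- The incomparable sequence

  module Sequence {A : Rel ℕ 0ℓ} (ceerA : IsCeer A) (nuA : ¬ Universal A) where

    -- Non-universality is carried along because it supplies the D for the next extension, and `A≤B`
    -- because through it E ≰ B also gives E ≰ A.
    record Bound : Set₁ where
      field
        B : Rel ℕ 0ℓ
        isCeer : IsCeer B
        nonuniversal : ¬ Universal B
        A≤B : A ≤ᶜ B
      ext : Extension A B
      ext = let D , ceerD , D≰B = nonuniversal-witness B nonuniversal in extend ceerA isCeer ceerD D≰B

    next : Bound → Bound
    next b = record
      { B = Bound.B b ⊕ Extension.E ext
      ; isCeer = ⊕-ceer (Bound.isCeer b) (Extension.isCeer ext)
      ; nonuniversal = ⊕-nonuniversal (Bound.B b) (Extension.E ext) (Bound.isCeer b) (Bound.nonuniversal b) (Properties.nonuniversal ext (Bound.A≤B b))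
      ; A≤B = ≤ᶜ-trans A (Bound.B b) (Bound.B b ⊕ Extension.E ext) (Bound.A≤B b) (⊕-injˡ {Bound.B b} {Extension.E ext})
      }
      where
      ext = Bound.ext b

    bound : ℕ → Bound
    bound zero = record { B = A ; isCeer = ceerA ; nonuniversal = nuA ; A≤B = ≤ᶜ-refl A }
    bound (suc l) = next (bound l)

    ext : ∀ l → Extension A (Bound.B (bound l))
    ext l = Bound.ext (bound l)

    E : ℕ → Rel ℕ 0ℓ
    E l = Extension.E (ext l)

    below-bound : ∀ {i j} → i < j → E i ≤ᶜ Bound.B (bound j)
    below-bound {i} {suc j} (s≤s i≤j) with m≤n⇒m<n∨m≡n i≤j
    ... | inj₂ refl = ⊕-injʳ {Bound.B (bound j)} {E j}
    ... | inj₁ i<j = ≤ᶜ-trans (E i) (Bound.B (bound j)) (Bound.B (bound j) ⊕ E j)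
                              (below-bound i<j) (⊕-injˡ {Bound.B (bound j)} {E j})

    not-above : ∀ {i j} → i < j → ¬ (E j ≤ᶜ E i)
    not-above {i} {j} i<j h = Extension.notBelow (ext j) (≤ᶜ-trans (E j) (E i) (Bound.B (bound j)) h (below-bound i<j))

    not-below : ∀ {i j} → i < j → ¬ (E i ≤ᶜ E j)
    not-below {i} {j} i<j h with Properties.minimal (ext j) (E i) (h , not-above i<j)
    ... | k , nz , h′ = Properties.not-below-sum (ext i) (Bound.A≤B (bound i)) k {{nz}} h′

    incomparable : ∀ i j → i ≢ j → ¬ (E i ≤ᶜ E j)
    incomparable i j i≢j with <-cmp i j
    ... | tri< i<j _ _ = not-below i<j
    ... | tri≈ _ i≡j _ = ⊥-elim (i≢j i≡j)
    ... | tri> _ _ j<i = not-above j<i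

theorem4p10 : ExcludedMiddle (lsuc 0ℓ) →
    (A : Rel ℕ 0ℓ) → IsCeer A → ¬ Universal A →
    Σ (ℕ → Rel ℕ 0ℓ) λ E →
    (∀ l → IsCeer (E l)) ×
    (∀ i j → i ≢ j → ¬ (E i ≤ᶜ E j)) ×
    (∀ l → SelfFull (E l)) ×
    (∀ l n .{{_ : NonZero n}} → A ⊕ Id n ≤ᶜ E l) ×
    (∀ l (X : Rel ℕ 0ℓ) → IsCeer X → X <ᶜ E l →
    Σ ℕ λ k → Σ (NonZero k) λ nz → X ≤ᶜ A ⊕ Id k {{nz}}) ×
    (∀ l x y → ¬ E l x y → CompInseparable (E l x) (E l y)) ×
    (∀ l x → ¬ ComputableSet (E l x))
theorem4p10 em₁ A ceerA nuA =
  E ,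
  (λ l → Extension.isCeer (ext l)) ,
  incomparable ,
  (λ l → selfFull (ext l) (Bound.A≤B (bound l))) ,
  (λ l n → sum-embeds (ext l) n) ,
  (λ l X _ → minimal (ext l) X) ,
  (λ l → inseparable (ext l)) ,
  (λ l → class-noncomputable (ext l))
  where
  open Classical em₁
  open Sequence ceerA nuA
  open Properties
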